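{- Let $L$ and $K$ be even lattices, let $v\in\operatorname{Gr}(L_{\mathbb{R}})$ and $w\in\operatorname{Gr}(K_{\mathbb{R}})$, and let $\Gamma$ be a finite index subgroup of $\operatorname{Mp}_2(\mathbb{Z})$. Let $F$ be a modular form of weight $(k,l)$ and representation $\rho_L^*$ with respect to $\Gamma$, and let $H$ be a modular form of weight $(\kappa,\mu)$ and representation $\rho_K^*$ with respect to $\Gamma$, where $k,l,\kappa,\mu\in\frac12\mathbb{Z}$. Then for every $\tau\in\mathcal{H}$, $\zeta\in L_{\mathbb{C}}$ and $\xi\in K_{\mathbb{C}}$, $$\Phi_{L\oplus K,v\oplus w}^{F\otimes H}(\tau,\zeta+\xi)=\Phi_{L,v}^{F}(\tau,\zeta)\cdot\Phi_{K,w}^{H}(\tau,\xi).$$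
   Context: Lattices. An even lattice is a free $\mathbb{Z}$-module $L$ of finite rank with a non-degenerate symmetric bilinear form $(\cdot,\cdot):L\times L\to\mathbb{Z}$ such that $\lambda^2:=(\lambda,\lambda)$ is even for every $\lambda\in L$. Put $L_{\mathbb{R}}=L\otimes\mathbb{R}$, $L_{\mathbb{C}}=L\otimes\mathbb{C}$; the pairing and $\lambda\mapsto\lambda^2$ are extended bilinearly (no complex conjugation). The signature $(b_+,b_-)$ of $L$ is that of $L_{\mathbb{R}}$. The dual lattice is $L^*=\{\lambda\in L_{\mathbb{R}}:(\lambda,L)\subseteq\mathbb{Z}\}\supseteq L$, and $D_L=L^*/L$ is a finite group. $\mathbb{C}[D_L]$ has basis $\{\mathfrak{e}_\gamma\}_{\gamma\in D_L}$. Write $\mathbf{e}(w)=e^{2\pi iw}$ and $\mathcal{H}=\{\tau=x+iy\in\mathbb{C}:y>0\}$. $\operatorname{Gr}(L_{\mathbb{R}})$ is the set of orthogonal decompositions $v$: $L_{\mathbb{R}}=v_+\oplus v_-$ with $v_+$ positive definite and $v_-$ negative definite; $\lambda_{v_\pm}$ is the orthogonal projection of $\lambda$ onto $v_\pm$. The Jacobi--Siegel theta function: for $\tau\in\mathcal{H}$, $\zeta\in L_{\mathbb{C}}$, $$\Theta_L(\tau,\zeta;v)=\sum_{\gamma\in D_L}\Big[\sum_{\lambda\in L+\gamma}\mathbf{e}\Big(\tau\tfrac{\lambda_{v_+}^2}{2}+\overline{\tau}\tfrac{\lambda_{v_- }^2}{2}+(\lambda,\zeta)\Big)\Big]\mathfrak{e}_\gamma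 .$$ Metaplectic group. For $A=\begin{pmatrix}a&b\\c&d\end{pmatrix}\in\operatorname{SL}_2(\mathbb{R})$ put $A\tau=\frac{a\tau+b}{c\tau+d}$, $j(A,\tau)=c\tau+d$. $\operatorname{Mp}_2(\mathbb{R})$ is the group of pairs $(A,\phi)$ with $A\in\operatorname{SL}_2(\mathbb{R})$, $\phi:\mathcal{H}\to\mathbb{C}$ holomorphic, $\phi^2(\tau)=j(A,\tau)$, with product $(A,\phi)(B,\psi)=(AB,(\phi\circ B)\psi)$; $\operatorname{Mp}_2(\mathbb{Z})$ is the inverse image of $\operatorname{SL}_2(\mathbb{Z})$. It is generated by $T=\big(\begin{pmatrix}1&1\\0&1\end{pmatrix},1\big)$ and $S=\big(\begin{pmatrix}0&-1\\1&0\end{pmatrix},\sqrt{\tau}\big)$ with $\sqrt\tau\in\mathcal{H}$. The Weil representation $\rho_L$ of $\operatorname{Mp}_2(\mathbb{Z})$ on $\mathbb{C}[D_L]$ is given by $$\rho_L(T)\mathfrak{e}_\gamma=\mathbf{e}(\tfrac{\gamma^2}{2})\mathfrak{e}_\gamma,\qquad \rho_L(S)\mathfrak{e}_\gamma=\frac{\mathbf{e}\big(\frac{b_--b_+}{8}\big)}{\sqrt{|D_L|}}\sum_{\delta\in D_L}\mathbf{e}(-(\gamma,\delta))\mathfrak{e}_\delta .$$ $L(-1)$ is $L$ with the forms negated; $\mathbb{C}[D_{L(-1)}]$ has basis $\{\mathfrak{e}_\gamma^*\}_{\gamma\in D_L}$, regarded as dual to $\{\mathfrak{e}_\gamma\}$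 via the bilinear pairing $\langle\cdot,\cdot\rangle_L:\mathbb{C}[D_L]\times\mathbb{C}[D_{L(-1)}]\to\mathbb{C}$, $\langle\mathfrak{e}_\gamma,\mathfrak{e}_\delta^*\rangle_L=\delta_{\gamma,\delta}$. $\rho_L^*=\rho_{L(-1)}$ is the dual representation: $\langle\rho_L(A,\phi)U,\rho_L^*(A,\phi)V\rangle_L=\langle U,V\rangle_L$. Modular forms. For $p,q\in\frac12\mathbb{Z}$, a modular form of weight $(p,q)$ and representation $\rho_L^*$ with respect to $\Gamma$ is a smooth $F:\mathcal{H}\to\mathbb{C}[D_{L(-1)}]$ with $F(A\tau)=\phi(\tau)^{2p}\overline{\phi(\tau)}^{2q}\rho_L^*(A,\phi)F(\tau)$ for all $\tau\in\mathcal{H}$, $(A,\phi)\in\Gamma$, and with at most linear exponential growth at the cusps (for every $A\in\operatorname{SL}_2(\mathbb{Z})$ there is $C$ with $F(A\tau)=O(e^{Cy})$ as $y\to\infty$, uniformly for $x$ in bounded sets). For such $F$ put $\Phi_{L,v}^F(\tau,\zeta)=\langle\Theta_L(\tau,\zeta;v),F(\tau)\rangle_L$ for $(\tau,\zeta)\in\mathcal{H}\times L_{\mathbb{C}}$ (and similarly for any even lattice). Direct sums. $L\oplus K$ is the orthogonal direct sum, so $D_{L\oplus K}=D_L\oplus D_K$, $\mathbb{C}[D_{L\oplus K}]=\mathbb{C}[D_L]\otimes\mathbb{C}[D_K]$ (with $\mathfrak{e}_{(\gamma,\delta)}=\mathfrak{e}_\gamma\otimes\mathfrak{e}_\delta$),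 $\rho_{L\oplus K}=\rho_L\otimes\rho_K$, and similarly for the duals. $v\oplus w\in\operatorname{Gr}(L_{\mathbb{R}}\oplus K_{\mathbb{R}})$ has spaces $(v\oplus w)_\pm=v_\pm\oplus w_\pm$. $(F\otimes H)(\tau)=F(\tau)\otimes H(\tau)$ is a modular form of weight $(k+\kappa,l+\mu)$ and representation $\rho_{L\oplus K}^*$ with respect to $\Gamma$. Elements of $(L\oplus K)_{\mathbb{C}}$ are written $\zeta+\xi$ with $\zeta\in L_{\mathbb{C}}$, $\xi\in K_{\mathbb{C}}$. -}

module Defs where

open import Level using (0ℓ)
open import Algebra.Bundles using (CommutativeRing)
open import Algebra.Structures using (IsCommutativeRing)
open import Axiom.ExcludedMiddle using (ExcludedMiddle)
open import Data.Empty using (⊥-elim)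
open import Data.Fin.Base using (Fin; zero; suc; splitAt; _↑ˡ_; _↑ʳ_)
open import Data.Fin.Properties using (splitAt-↑ˡ; splitAt-↑ʳ)
open import Data.Integer.Base as ℤ using (ℤ; +_; -[1+_]; 0ℤ; 1ℤ; _⊖_)
open import Data.Integer.Divisibility.Signed using (_∣_; ∣m∣n⇒∣m+n; ∣m⇒∣-m)
import Data.Integer.Properties as ℤP
open import Data.List.Base as List using (List; []; _∷_; foldr; deduplicate)
open import Data.List.Membership.Propositional using (_∈_)
open import Data.List.Membership.Propositional.Properties using (∈-deduplicate⁺; ∈-++⁺ˡ; ∈-++⁺ʳ)
open import Data.List.Relation.Binary.Subset.Propositional using (_⊆_)
open import Data.List.Relation.Unary.All as All using (All)
import Data.List.Relation.Unary.All.Properties as AllP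
open import Data.List.Relation.Unary.Unique.Propositional using (Unique)
open import Data.List.Relation.Unary.Unique.DecPropositional.Properties using (deduplicate-!)
open import Data.Maybe.Base using (just; nothing)
open import Data.Nat.Base as ℕ using (ℕ; zero; suc; _!)
open import Data.Product.Base using (Σ; ∃; ∃-syntax; _×_; _,_; proj₁; proj₂)
open import Data.Sum.Base using (_⊎_; inj₁; inj₂)
open import Data.Unit.Base using (⊤; tt)
open import Data.Vec.Base as Vec using (Vec; []; _∷_; lookup; _++_; replicate; zipWith; take; drop)
import Data.Vec.Properties as VecP
open import Relation.Binary.Bundles using (Setoid)
open import Relation.Binary.Definitions using (tri<; tri≈; tri>; DecidableEquality; WeaklyDecidable)
open import Relation.Binary.PropositionalEquality as ≡ using (_≡_; _≢_; refl; sym; trans; cong; cong₂; subst; subst₂; module ≡-Reasoning)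
open import Relation.Binary.Structures using (IsStrictTotalOrder)
open import Relation.Nullary using (¬_; yes; no)
open import Relation.Unary using (Pred; U)

module Fromℤ (R : CommutativeRing 0ℓ 0ℓ) where
  open CommutativeRing R hiding (zero) renaming (refl to ≈-refl; sym to ≈-sym; trans to ≈-trans; reflexive to ≈-reflexive)
  open import Algebra.Definitions.RawMonoid +-rawMonoid using (_×′_)
  open import Algebra.Properties.Ring ring using (-0#≈0#; -‿+-comm; -‿involutive; -‿distribˡ-*)
  open import Algebra.Properties.Semiring.Mult.TCOptimised semiring using (1+×; ×-homo-+; ×1-homo-*)
  open import Relation.Binary.Reasoning.Setoid setoid
  import Algebra.Solver.Ring
  import Algebra.Solver.Ring.AlmostCommutativeRing as ACR

  fromℕ : ℕ → Carrier
  fromℕ n = n ×′ 1#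

  fromℤ : ℤ → Carrier
  fromℤ (+ n)      = fromℕ n
  fromℤ (-[1+ n ]) = - fromℕ (suc n)

  fromℤ-neg : ∀ k → fromℤ (ℤ.- k) ≈ - fromℤ k
  fromℤ-neg (+ zero)   = ≈-sym -0#≈0#
  fromℤ-neg (+ suc n)  = ≈-refl
  fromℤ-neg (-[1+ n ]) = ≈-sym (-‿involutive _)

  private
    cancel-1 : ∀ a b → a - b ≈ (1# + a) - (1# + b)
    cancel-1 a b = begin
      a - b                    ≈⟨ +-identityˡ _ ⟨
      0# + (a - b)             ≈⟨ +-congʳ (-‿inverseʳ 1#) ⟨
      (1# - 1#) + (a - b)      ≈⟨ +-assoc _ _ _ ⟩
      1# + (- 1# + (a - b))    ≈⟨ +-congˡ (+-assoc _ _ _) ⟨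
      1# + ((- 1# + a) - b)    ≈⟨ +-congˡ (+-congʳ (+-comm _ _)) ⟩
      1# + ((a + - 1#) - b)    ≈⟨ +-congˡ (+-assoc _ _ _) ⟩
      1# + (a + (- 1# - b))    ≈⟨ +-assoc _ _ _ ⟨
      (1# + a) + (- 1# - b)    ≈⟨ +-congˡ (-‿+-comm 1# b) ⟩
      (1# + a) - (1# + b)      ∎

  fromℤ-⊖ : ∀ m n → fromℤ (m ⊖ n) ≈ fromℕ m - fromℕ n
  fromℤ-⊖ m       zero    = ≈-trans (≈-sym (+-identityʳ _)) (+-congˡ (≈-sym -0#≈0#))
  fromℤ-⊖ zero    (suc n) = ≈-sym (+-identityˡ _)
  fromℤ-⊖ (suc m) (suc n) = begin
    fromℤ (suc m ⊖ suc n)            ≈⟨ ≈-reflexive (cong fromℤ (ℤP.[1+m]⊖[1+n]≡m⊖n m n)) ⟩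
    fromℤ (m ⊖ n)                    ≈⟨ fromℤ-⊖ m n ⟩
    fromℕ m - fromℕ n                ≈⟨ cancel-1 _ _ ⟩
    (1# + fromℕ m) - (1# + fromℕ n)  ≈⟨ +-cong (1+× m 1#) (-‿cong (1+× n 1#)) ⟨
    fromℕ (suc m) - fromℕ (suc n)    ∎

  fromℤ-+ : ∀ j k → fromℤ (j ℤ.+ k) ≈ fromℤ j + fromℤ k
  fromℤ-+ (+ m)      (+ n)      = ×-homo-+ 1# m n
  fromℤ-+ (+ m)      (-[1+ n ]) = fromℤ-⊖ m (suc n)
  fromℤ-+ (-[1+ m ]) (+ n)      = ≈-trans (fromℤ-⊖ n (suc m)) (+-comm _ _)
  fromℤ-+ (-[1+ m ]) (-[1+ n ]) = begin
    - fromℕ (suc (suc (m ℕ.+ n)))       ≈⟨ -‿cong (1+× (suc (m ℕ.+ n)) 1#) ⟩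
    - (1# + fromℕ (suc m ℕ.+ n))        ≈⟨ -‿cong (+-congˡ (×-homo-+ 1# (suc m) n)) ⟩
    - (1# + (fromℕ (suc m) + fromℕ n))  ≈⟨ -‿cong (+-assoc _ _ _) ⟨
    - ((1# + fromℕ (suc m)) + fromℕ n)  ≈⟨ -‿cong (+-congʳ (+-comm _ _)) ⟩
    - ((fromℕ (suc m) + 1#) + fromℕ n)  ≈⟨ -‿cong (+-assoc _ _ _) ⟩
    - (fromℕ (suc m) + (1# + fromℕ n))  ≈⟨ -‿cong (+-congˡ (1+× n 1#)) ⟨
    - (fromℕ (suc m) + fromℕ (suc n))   ≈⟨ -‿+-comm _ _ ⟨
    - fromℕ (suc m) - fromℕ (suc n)     ∎

  private
    fromℤ-*⁺ : ∀ m k → fromℤ (+ m ℤ.* k) ≈ fromℕ m * fromℤ k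
    fromℤ-*⁺ m (+ n)      = ≈-trans (≈-reflexive (cong fromℤ (sym (ℤP.pos-* m n)))) (×1-homo-* m n)
    fromℤ-*⁺ m (-[1+ n ]) = begin
      fromℤ (+ m ℤ.* -[1+ n ])           ≈⟨ ≈-reflexive (cong fromℤ (ℤP.neg-distribʳ-* (+ m) (+ suc n))) ⟨
      fromℤ (ℤ.- (+ m ℤ.* + suc n))      ≈⟨ fromℤ-neg (+ m ℤ.* + suc n) ⟩
      - fromℤ (+ m ℤ.* + suc n)          ≈⟨ -‿cong (fromℤ-*⁺ m (+ suc n)) ⟩
      - (fromℕ m * fromℕ (suc n))        ≈⟨ -‿cong (*-comm _ _) ⟩
      - (fromℕ (suc n) * fromℕ m)        ≈⟨ -‿distribˡ-* _ _ ⟩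
      - fromℕ (suc n) * fromℕ m          ≈⟨ *-comm _ _ ⟩
      fromℕ m * - fromℕ (suc n)          ∎

  fromℤ-* : ∀ j k → fromℤ (j ℤ.* k) ≈ fromℤ j * fromℤ k
  fromℤ-* (+ m)      k = fromℤ-*⁺ m k
  fromℤ-* (-[1+ m ]) k = begin
    fromℤ (-[1+ m ] ℤ.* k)          ≈⟨ ≈-reflexive (cong fromℤ (ℤP.neg-distribˡ-* (+ suc m) k)) ⟨
    fromℤ (ℤ.- (+ suc m ℤ.* k))     ≈⟨ fromℤ-neg (+ suc m ℤ.* k) ⟩
    - fromℤ (+ suc m ℤ.* k)         ≈⟨ -‿cong (fromℤ-*⁺ (suc m) k) ⟩
    - (fromℕ (suc m) * fromℤ k)     ≈⟨ -‿distribˡ-* _ _ ⟩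
    - fromℕ (suc m) * fromℤ k       ∎

  private
    morphism : CommutativeRing.rawRing ℤP.+-*-commutativeRing
               ACR.-Raw-AlmostCommutative⟶ ACR.fromCommutativeRing R
    morphism = record
      { ⟦_⟧    = fromℤ
      ; +-homo = fromℤ-+
      ; *-homo = fromℤ-*
      ; -‿homo = fromℤ-neg
      ; 0-homo = ≈-refl
      ; 1-homo = ≈-refl
      }

    fromℤ-≟ : WeaklyDecidable λ j k → fromℤ j ≈ fromℤ k
    fromℤ-≟ j k with j ℤP.≟ k
    ... | yes refl = just ≈-refl
    ... | no _     = nothing

  module Solver = Algebra.Solver.Ring
    (CommutativeRing.rawRing ℤP.+-*-commutativeRing) (ACR.fromCommutativeRing R) morphism
    fromℤ-≟

Gram : ℕ → Set
Gram n = Fin n → Fin n → ℤ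

block : ∀ {m n} → Gram m → Gram n → Fin m ⊎ Fin n → Fin m ⊎ Fin n → ℤ
block G H (inj₁ i) (inj₁ j) = G i j
block G H (inj₂ i) (inj₂ j) = H i j
block G H (inj₁ _) (inj₂ _) = 0ℤ
block G H (inj₂ _) (inj₁ _) = 0ℤ

_⊞_ : ∀ {m n} → Gram m → Gram n → Gram (m ℕ.+ n)
_⊞_ {m} G H i j = block G H (splitAt m i) (splitAt m j)

negate : ∀ {n} → Gram n → Gram n
negate G i j = ℤ.- G i j

module Form (R : CommutativeRing 0ℓ 0ℓ) (ι : ℤ → CommutativeRing.Carrier R) where
  open CommutativeRing R hiding (zero) renaming (refl to ≈-refl; sym to ≈-sym; trans to ≈-trans; reflexive to ≈-reflexive)
  open import Algebra.Properties.CommutativeMonoid.Sum +-commutativeMonoid using (sum; sum-cong-≋; sum-replicate-zero)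
  open import Algebra.Properties.Ring ring using (-0#≈0#; -‿+-comm; -‿distribˡ-*; -‿distribʳ-*)
  open import Relation.Binary.Reasoning.Setoid setoid

  pairing : ∀ {n} → Gram n → Vec Carrier n → Vec Carrier n → Carrier
  pairing G x y = sum λ i → sum λ j → lookup x i * (ι (G i j) * lookup y j)

  sum-0 : ∀ {n} {f : Fin n → Carrier} → (∀ i → f i ≈ 0#) → sum f ≈ 0#
  sum-0 {n} f≈0 = ≈-trans (sum-cong-≋ f≈0) (sum-replicate-zero n)

  sum-++ : ∀ m {n} (f : Fin (m ℕ.+ n) → Carrier) →
           sum f ≈ sum (λ i → f (i ↑ˡ n)) + sum (λ j → f (m ↑ʳ j))
  sum-++ zero    f = ≈-sym (+-identityˡ _)
  sum-++ (suc m) f = ≈-trans (+-congˡ (sum-++ m (λ i → f (suc i)))) (≈-sym (+-assoc _ _ _))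

  sum-neg : ∀ {n} (f : Fin n → Carrier) → sum (λ i → - f i) ≈ - sum f
  sum-neg {zero}  f = ≈-sym -0#≈0#
  sum-neg {suc n} f = ≈-trans (+-congˡ (sum-neg (λ i → f (suc i)))) (-‿+-comm _ _)

  pairing-zeroˡ : ∀ {n} (G : Gram n) y → pairing G (replicate n 0#) y ≈ 0#
  pairing-zeroˡ {n} G y = sum-0 {n} λ i → sum-0 {n} λ j →
    ≈-trans (*-congʳ (≈-reflexive (VecP.lookup-replicate i 0#))) (zeroˡ _)

  pairing-zeroʳ : ∀ {n} (G : Gram n) x → pairing G x (replicate n 0#) ≈ 0#
  pairing-zeroʳ {n} G x = sum-0 {n} λ i → sum-0 {n} λ j →
    ≈-trans (*-congˡ (≈-trans (*-congˡ (≈-reflexive (VecP.lookup-replicate j 0#))) (zeroʳ _))) (zeroʳ _)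

  pairing-negate : (∀ k → ι (ℤ.- k) ≈ - ι k) →
                   ∀ {n} (G : Gram n) x y → pairing (negate G) x y ≈ - pairing G x y
  pairing-negate ι-neg {n} G x y =
    ≈-trans (sum-cong-≋ {n} λ i → ≈-trans (sum-cong-≋ {n} (term i)) (sum-neg {n} _)) (sum-neg {n} _)
    where
    term : ∀ i j → lookup x i * (ι (ℤ.- G i j) * lookup y j) ≈ - (lookup x i * (ι (G i j) * lookup y j))
    term i j = begin
      lookup x i * (ι (ℤ.- G i j) * lookup y j)  ≈⟨ *-congˡ (*-congʳ (ι-neg (G i j))) ⟩
      lookup x i * (- ι (G i j) * lookup y j)    ≈⟨ *-congˡ (-‿distribˡ-* _ _) ⟨
      lookup x i * - (ι (G i j) * lookup y j)    ≈⟨ -‿distribʳ-* _ _ ⟨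
      - (lookup x i * (ι (G i j) * lookup y j))  ∎

  pairing-⊞ : ι 0ℤ ≈ 0# → ∀ {m n} (G : Gram m) (H : Gram n) x x′ y y′ →
              pairing (G ⊞ H) (x ++ x′) (y ++ y′) ≈ pairing G x y + pairing H x′ y′
  pairing-⊞ ι-0 {m} {n} G H x x′ y y′ =
    ≈-trans (sum-++ m _) (+-cong (sum-cong-≋ rowˡ) (sum-cong-≋ rowʳ))
    where
    B : Fin m ⊎ Fin n → Fin m ⊎ Fin n → Carrier
    B i j = ι (block G H i j)

    vanish : ∀ a b → a * (ι 0ℤ * b) ≈ 0#
    vanish a b = ≈-trans (*-congˡ (≈-trans (*-congʳ ι-0) (zeroˡ b))) (zeroʳ a)

    entry : ∀ {a a′ c c′ i i′ j j′} → a ≡ a′ → c ≡ c′ → i ≡ i′ → j ≡ j′ →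
            a * (B i j * c) ≈ a′ * (B i′ j′ * c′)
    entry refl refl refl refl = ≈-refl

    rowˡ : ∀ i → sum (λ j → lookup (x ++ x′) (i ↑ˡ n) * (ι ((G ⊞ H) (i ↑ˡ n) j) * lookup (y ++ y′) j))
               ≈ sum (λ j → lookup x i * (ι (G i j) * lookup y j))
    rowˡ i = ≈-trans (sum-++ m _) (≈-trans (+-cong
      (sum-cong-≋ λ j → entry (VecP.lookup-++ˡ x x′ i) (VecP.lookup-++ˡ y y′ j) (splitAt-↑ˡ m i n) (splitAt-↑ˡ m j n))
      (sum-0 λ j → ≈-trans
        (entry refl refl (splitAt-↑ˡ m i n) (splitAt-↑ʳ m n j)) (vanish _ _)))
      (+-identityʳ _))

    rowʳ : ∀ i → sum (λ j → lookup (x ++ x′) (m ↑ʳ i) * (ι ((G ⊞ H) (m ↑ʳ i) j) * lookup (y ++ y′) j))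
               ≈ sum (λ j → lookup x′ i * (ι (H i j) * lookup y′ j))
    rowʳ i = ≈-trans (sum-++ m _) (≈-trans (+-cong
      (sum-0 λ j → ≈-trans
        (entry refl refl (splitAt-↑ʳ m n i) (splitAt-↑ˡ m j n)) (vanish _ _))
      (sum-cong-≋ λ j → entry (VecP.lookup-++ʳ x x′ i) (VecP.lookup-++ʳ y y′ j) (splitAt-↑ʳ m n i) (splitAt-↑ʳ m n j)))
      (+-identityˡ _))

module ℤForm = Form ℤP.+-*-commutativeRing (λ k → k)

-- A free ℤ-module of finite rank is presented as ℤ^rank, and its bilinear
-- form by the Gram matrix.
record EvenLattice : Set where
  field
    rank          : ℕ
    gram          : Gram rank
    symmetric     : ∀ i j → gram i j ≡ gram j i
    nondegenerate : ∀ x → (∀ y → ℤForm.pairing gram x y ≡ 0ℤ) → x ≡ replicate rank 0ℤ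
    even          : ∀ x → + 2 ∣ ℤForm.pairing gram x x

open EvenLattice

split : ∀ {A : Set} m {n} (x : Vec A (m ℕ.+ n)) → x ≡ take m x ++ drop m x
split m x = sym (VecP.take++drop≡id m x)

replicate-++ : ∀ {A : Set} m {n} {a : A} → replicate m a ++ replicate n a ≡ replicate (m ℕ.+ n) a
replicate-++ zero    = refl
replicate-++ (suc m) = cong (_ ∷_) (replicate-++ m)

infixl 6 _⊕_

_⊕_ : EvenLattice → EvenLattice → EvenLattice
L ⊕ K = record
  { rank          = rank L ℕ.+ rank K
  ; gram          = gram L ⊞ gram K
  ; symmetric     = λ i j → block-symmetric (splitAt (rank L) i) (splitAt (rank L) j)
  ; nondegenerate = nondegenerate-⊕
  ; even          = even-⊕
  }
  where
  open ≡-Reasoning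
  open ℤForm

  block-symmetric : ∀ i j → block (gram L) (gram K) i j ≡ block (gram L) (gram K) j i
  block-symmetric (inj₁ i) (inj₁ j) = symmetric L i j
  block-symmetric (inj₂ i) (inj₂ j) = symmetric K i j
  block-symmetric (inj₁ i) (inj₂ j) = refl
  block-symmetric (inj₂ i) (inj₁ j) = refl

  even-⊕ : ∀ x → + 2 ∣ pairing (gram L ⊞ gram K) x x
  even-⊕ x = subst (+ 2 ∣_)
    (sym (trans (cong (λ z → pairing (gram L ⊞ gram K) z z) (split (rank L) x))
                (pairing-⊞ refl (gram L) (gram K) x₁ x₂ x₁ x₂)))
    (∣m∣n⇒∣m+n (even L x₁) (even K x₂))
    where
    x₁ = take (rank L) x
    x₂ = drop (rank L) x

  nondegenerate-⊕ : ∀ x → (∀ y → pairing (gram L ⊞ gram K) x y ≡ 0ℤ) → x ≡ replicate (rank L ℕ.+ rank K) 0ℤ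
  nondegenerate-⊕ x x⊥ = begin
    x                                            ≡⟨ split (rank L) x ⟩
    x₁ ++ x₂                                     ≡⟨ cong₂ _++_ (nondegenerate L x₁ left) (nondegenerate K x₂ right) ⟩
    replicate (rank L) 0ℤ ++ replicate (rank K) 0ℤ ≡⟨ replicate-++ (rank L) ⟩
    replicate (rank L ℕ.+ rank K) 0ℤ             ∎
    where
    x₁ = take (rank L) x
    x₂ = drop (rank L) x

    both : ∀ y₁ y₂ → pairing (gram L) x₁ y₁ ℤ.+ pairing (gram K) x₂ y₂ ≡ 0ℤ
    both y₁ y₂ = begin
      pairing (gram L) x₁ y₁ ℤ.+ pairing (gram K) x₂ y₂  ≡⟨ pairing-⊞ refl (gram L) (gram K) x₁ x₂ y₁ y₂ ⟨
      pairing (gram L ⊞ gram K) (x₁ ++ x₂) (y₁ ++ y₂)    ≡⟨ cong (λ z → pairing (gram L ⊞ gram K) z (y₁ ++ y₂)) (split (rank L) x) ⟨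
      pairing (gram L ⊞ gram K) x (y₁ ++ y₂)             ≡⟨ x⊥ (y₁ ++ y₂) ⟩
      0ℤ                                                 ∎

    left : ∀ y → pairing (gram L) x₁ y ≡ 0ℤ
    left y = begin
      pairing (gram L) x₁ y                                                    ≡⟨ ℤP.+-identityʳ _ ⟨
      pairing (gram L) x₁ y ℤ.+ 0ℤ                                             ≡⟨ cong (λ z → pairing (gram L) x₁ y ℤ.+ z) (pairing-zeroʳ (gram K) x₂) ⟨
      pairing (gram L) x₁ y ℤ.+ pairing (gram K) x₂ (replicate (rank K) 0ℤ)    ≡⟨ both y (replicate (rank K) 0ℤ) ⟩
      0ℤ                                                                       ∎

    right : ∀ y → pairing (gram K) x₂ y ≡ 0ℤ
    right y = begin
      pairing (gram K) x₂ y                                                    ≡⟨ ℤP.+-identityˡ _ ⟨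
      0ℤ ℤ.+ pairing (gram K) x₂ y                                             ≡⟨ cong (λ z → z ℤ.+ pairing (gram K) x₂ y) (pairing-zeroʳ (gram L) x₁) ⟨
      pairing (gram L) x₁ (replicate (rank L) 0ℤ) ℤ.+ pairing (gram K) x₂ y    ≡⟨ both (replicate (rank L) 0ℤ) y ⟩
      0ℤ                                                                       ∎

infix 8 _⟨-1⟩

_⟨-1⟩ : EvenLattice → EvenLattice
L ⟨-1⟩ = record
  { rank          = rank L
  ; gram          = negate (gram L)
  ; symmetric     = symmetric′
  ; nondegenerate = nondegenerate′
  ; even          = even′
  }
  where
  abstract
    neg : ∀ x y → ℤForm.pairing (negate (gram L)) x y ≡ ℤ.- ℤForm.pairing (gram L) x y
    neg = ℤForm.pairing-negate (λ _ → refl) (gram L)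

    symmetric′ : ∀ i j → negate (gram L) i j ≡ negate (gram L) j i
    symmetric′ i j = cong ℤ.-_ (symmetric L i j)

    nondegenerate′ : ∀ x → (∀ y → ℤForm.pairing (negate (gram L)) x y ≡ 0ℤ) → x ≡ replicate (rank L) 0ℤ
    nondegenerate′ x x⊥ = nondegenerate L x λ y → ℤP.neg-injective (trans (sym (neg x y)) (x⊥ y))

    even′ : ∀ x → + 2 ∣ ℤForm.pairing (negate (gram L)) x x
    even′ x = subst (+ 2 ∣_) (sym (neg x x)) (∣m⇒∣-m (even L x))

-- The axioms of a Dedekind-complete ordered field, which determine ℝ up to
-- unique isomorphism. The value 0# ⁻¹ is left unspecified.
record CompleteOrderedField : Set₁ where
  infix  8 -_
  infix  9 _⁻¹
  infixl 7 _*_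
  infixl 6 _+_
  infix  4 _<_ _≤_
  field
    ℝ                  : Set
    _+_ _*_            : ℝ → ℝ → ℝ
    -_ _⁻¹             : ℝ → ℝ
    0# 1#              : ℝ
    _<_                : ℝ → ℝ → Set
    isCommutativeRing  : IsCommutativeRing _≡_ _+_ _*_ -_ 0# 1#
    0≢1                : 0# ≢ 1#
    *-inverseʳ         : ∀ x → x ≢ 0# → x * x ⁻¹ ≡ 1#
    isStrictTotalOrder : IsStrictTotalOrder _≡_ _<_
    +-monoʳ-<          : ∀ z {x y} → x < y → z + x < z + y
    *-positive         : ∀ {x y} → 0# < x → 0# < y → 0# < x * y

  _≤_ : ℝ → ℝ → Set
  x ≤ y = x < y ⊎ x ≡ y

  field
    supremum : (S : Pred ℝ 0ℓ) → ∃ S → (∃[ b ] ∀ x → S x → x ≤ b) →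
               ∃[ s ] (∀ x → S x → x ≤ s) × (∀ b → (∀ x → S x → x ≤ b) → s ≤ b)

-- The theory is classical. Excluded middle is a parameter here; since it
-- decides inhabitation of sets, it also provides a choice operator.
module Theory (em : ExcludedMiddle 0ℓ) (𝓡 : CompleteOrderedField) where
  open CompleteOrderedField 𝓡 public

  choose : {A : Set} → A → Pred A 0ℓ → A
  choose default P with em {∃ P}
  ... | yes (a , _) = a
  ... | no _        = default

  ℝ-commutativeRing : CommutativeRing 0ℓ 0ℓ
  ℝ-commutativeRing = record { isCommutativeRing = isCommutativeRing }

  open CommutativeRing ℝ-commutativeRing public
    using (_-_; +-assoc; +-comm; +-identityˡ; +-identityʳ; -‿inverseˡ; -‿inverseʳ;
           *-assoc; *-comm; *-identityˡ; *-identityʳ; zeroˡ; zeroʳ; distribˡ; distribʳ)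
  open IsStrictTotalOrder isStrictTotalOrder public
    using (compare; irrefl) renaming (trans to <-trans)
  open Fromℤ ℝ-commutativeRing public

  +-mono-< : ∀ {a b c d} → a < b → c < d → a + c < b + d
  +-mono-< {a} {b} {c} {d} a<b c<d =
    <-trans (+-monoʳ-< a c<d) (subst₂ _<_ (+-comm d a) (+-comm d b) (+-monoʳ-< d a<b))

  +-nonneg-pos : ∀ {a b} → 0# ≤ a → 0# < b → 0# < a + b
  +-nonneg-pos (inj₁ 0<a)  0<b = subst (_< _) (+-identityˡ 0#) (+-mono-< 0<a 0<b)
  +-nonneg-pos (inj₂ refl) 0<b = subst (0# <_) (sym (+-identityˡ _)) 0<b

  +-pos-nonneg : ∀ {a b} → 0# < a → 0# ≤ b → 0# < a + b
  +-pos-nonneg 0<a 0≤b = subst (0# <_) (+-comm _ _) (+-nonneg-pos 0≤b 0<a)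

  <⇒0<- : ∀ {x y} → x < y → 0# < y - x
  <⇒0<- {x} {y} x<y = subst₂ _<_ (-‿inverseˡ x) (+-comm (- x) y) (+-monoʳ-< (- x) x<y)

  0<-⇒< : ∀ {x y} → 0# < y - x → x < y
  0<-⇒< {x} {y} 0<y-x = subst₂ _<_ (+-identityʳ x)
    (Solver.solve 2 (λ x y → x Solver.:+ (y Solver.:- x) Solver.:= y) refl x y) (+-monoʳ-< x 0<y-x)

  sq-pos : ∀ {x} → x ≢ 0# → 0# < x * x
  sq-pos {x} x≢0 with compare x 0#
  ... | tri< x<0 _ _ = subst (0# <_) (Solver.solve 1 (λ x → (Solver.con 0ℤ Solver.:- x) Solver.:* (Solver.con 0ℤ Solver.:- x) Solver.:= x Solver.:* x) refl x)
                         (*-positive (<⇒0<- x<0) (<⇒0<- x<0))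
  ... | tri≈ _ x≡0 _ = ⊥-elim (x≢0 x≡0)
  ... | tri> _ _ 0<x = *-positive 0<x 0<x

  sq-nonneg : ∀ x → 0# ≤ x * x
  sq-nonneg x with compare x 0#
  ... | tri< _ x≢0 _  = inj₁ (sq-pos x≢0)
  ... | tri≈ _ refl _ = inj₂ (sym (zeroˡ 0#))
  ... | tri> _ x≢0 _  = inj₁ (sq-pos x≢0)

  0<1 : 0# < 1#
  0<1 = subst (0# <_) (*-identityˡ 1#) (sq-pos λ 1≡0 → 0≢1 (sym 1≡0))

  pos⇒≢0 : ∀ {x} → 0# < x → x ≢ 0#
  pos⇒≢0 0<x x≡0 = irrefl (sym x≡0) 0<x

  ⁻¹-pos : ∀ {x} → 0# < x → 0# < x ⁻¹
  ⁻¹-pos {x} 0<x = subst (0# <_) eq (*-positive 0<x (sq-pos x⁻¹≢0))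
    where
    xx⁻¹ : x * x ⁻¹ ≡ 1#
    xx⁻¹ = *-inverseʳ x (pos⇒≢0 0<x)
    x⁻¹≢0 : x ⁻¹ ≢ 0#
    x⁻¹≢0 x⁻¹≡0 = 0≢1 (trans (sym (zeroʳ x)) (trans (cong (x *_) (sym x⁻¹≡0)) xx⁻¹))
    eq : x * (x ⁻¹ * x ⁻¹) ≡ x ⁻¹
    eq = trans (sym (*-assoc x _ _)) (trans (cong (_* x ⁻¹) xx⁻¹) (*-identityˡ _))

  sq-<⇒< : ∀ {x ε} → 0# < ε → x * x < ε * ε → x < ε
  sq-<⇒< {x} {ε} 0<ε x²<ε² with compare x ε
  ... | tri< x<ε _ _  = x<ε
  ... | tri≈ _ refl _ = ⊥-elim (irrefl refl x²<ε²)
  ... | tri> _ _ ε<x  = ⊥-elim (irrefl refl (<-trans x²<ε² (0<-⇒< (subst (0# <_)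
    (Solver.solve 2 (λ x ε → (x Solver.:- ε) Solver.:* (x Solver.:+ ε) Solver.:= x Solver.:* x Solver.:- ε Solver.:* ε) refl x ε)
    (*-positive (<⇒0<- ε<x) (+-pos-nonneg (<-trans 0<ε ε<x) (inj₁ 0<ε)))))))

  ½ : ℝ
  ½ = (fromℕ 2) ⁻¹

  -- Nonnegative square root (0# on negative numbers).
  √_ : ℝ → ℝ
  √ x = choose 0# λ r → 0# ≤ r × r * r ≡ x

  -- Without η, operations on variables stay folded and normal forms small.
  record ℂ : Set where
    no-eta-equality
    pattern
    constructor _+i_
    field
      re im : ℝ

  open ℂ public

  ℂ-ext : ∀ {z w} → re z ≡ re w → im z ≡ im w → z ≡ w
  ℂ-ext {_ +i _} {_ +i _} = cong₂ _+i_

  infixl 6 _+ᶜ_ _-ᶜ_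
  infixl 7 _*ᶜ_
  infix  8 -ᶜ_
  infix  9 _⁻¹ᶜ
  infixr 8 _^_ _^ℤ_

  ofℝ : ℝ → ℂ
  ofℝ x = x +i 0#

  0ᶜ 1ᶜ 𝕚 : ℂ
  0ᶜ = ofℝ 0#
  1ᶜ = ofℝ 1#
  𝕚  = 0# +i 1#

  _+ᶜ_ _*ᶜ_ _-ᶜ_ : ℂ → ℂ → ℂ
  (a +i b) +ᶜ (c +i d) = (a + c) +i (b + d)
  (a +i b) *ᶜ (c +i d) = (a * c - b * d) +i (a * d + b * c)
  (a +i b) -ᶜ (c +i d) = (a - c) +i (b - d)

  -ᶜ_ conj _⁻¹ᶜ : ℂ → ℂ
  -ᶜ (a +i b)   = (- a) +i (- b)
  conj (a +i b) = a +i (- b)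

  normSq : ℂ → ℝ
  normSq (a +i b) = a * a + b * b

  z ⁻¹ᶜ = conj z *ᶜ ofℝ (normSq z ⁻¹)

  _^_ : ℂ → ℕ → ℂ
  z ^ zero  = 1ᶜ
  z ^ suc n = z *ᶜ z ^ n

  _^ℤ_ : ℂ → ℤ → ℂ
  z ^ℤ (+ n)      = z ^ n
  z ^ℤ (-[1+ n ]) = (z ⁻¹ᶜ) ^ suc n

  ℂ-commutativeRing : CommutativeRing 0ℓ 0ℓ
  ℂ-commutativeRing = record
    { Carrier = ℂ
    ; _≈_ = _≡_
    ; _+_ = _+ᶜ_
    ; _*_ = _*ᶜ_
    ; -_  = -ᶜ_
    ; 0#  = 0ᶜ
    ; 1#  = 1ᶜ
    ; isCommutativeRing = record
      { isRing = record
        { +-isAbelianGroup = record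
          { isGroup = record
            { isMonoid = record
              { isSemigroup = record
                { isMagma = record { isEquivalence = ≡.isEquivalence ; ∙-cong = cong₂ _+ᶜ_ }
                ; assoc = λ { (a +i b) (c +i d) (e +i f) → cong₂ _+i_ (+-assoc a c e) (+-assoc b d f) }
                }
              ; identity = (λ { (a +i b) → cong₂ _+i_ (+-identityˡ a) (+-identityˡ b) })
                         , (λ { (a +i b) → cong₂ _+i_ (+-identityʳ a) (+-identityʳ b) })
              }
            ; inverse = (λ { (a +i b) → cong₂ _+i_ (-‿inverseˡ a) (-‿inverseˡ b) })
                      , (λ { (a +i b) → cong₂ _+i_ (-‿inverseʳ a) (-‿inverseʳ b) })
            ; ⁻¹-cong = cong λ z → -ᶜ z
            }
          ; comm = λ { (a +i b) (c +i d) → cong₂ _+i_ (+-comm a c) (+-comm b d) }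
          }
        ; *-cong = cong₂ _*ᶜ_
        ; *-assoc = λ { (a +i b) (c +i d) (e +i f) → cong₂ _+i_
            (solve 6 (λ a b c d e f → (a :* c :- b :* d) :* e :- (a :* d :+ b :* c) :* f
                                   := a :* (c :* e :- d :* f) :- b :* (c :* f :+ d :* e)) refl a b c d e f)
            (solve 6 (λ a b c d e f → (a :* c :- b :* d) :* f :+ (a :* d :+ b :* c) :* e
                                   := a :* (c :* f :+ d :* e) :+ b :* (c :* e :- d :* f)) refl a b c d e f) }
        ; *-identity = *ᶜ-identityˡ , λ z → trans (*ᶜ-comm z 1ᶜ) (*ᶜ-identityˡ z)
        ; distrib = *ᶜ-distribˡ
                  , λ z w u → trans (*ᶜ-comm (w +ᶜ u) z) (trans (*ᶜ-distribˡ z w u) (cong₂ _+ᶜ_ (*ᶜ-comm z w) (*ᶜ-comm z u)))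
        }
      ; *-comm = *ᶜ-comm
      }
    }
    where
    open Solver
    *ᶜ-comm : ∀ z w → z *ᶜ w ≡ w *ᶜ z
    *ᶜ-comm (a +i b) (c +i d) = cong₂ _+i_
      (solve 4 (λ a b c d → a :* c :- b :* d := c :* a :- d :* b) refl a b c d)
      (solve 4 (λ a b c d → a :* d :+ b :* c := c :* b :+ d :* a) refl a b c d)
    *ᶜ-identityˡ : ∀ z → 1ᶜ *ᶜ z ≡ z
    *ᶜ-identityˡ (a +i b) = cong₂ _+i_
      (solve 2 (λ a b → con 1ℤ :* a :- con 0ℤ :* b := a) refl a b)
      (solve 2 (λ a b → con 1ℤ :* b :+ con 0ℤ :* a := b) refl a b)
    *ᶜ-distribˡ : ∀ z w u → z *ᶜ (w +ᶜ u) ≡ z *ᶜ w +ᶜ z *ᶜ u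
    *ᶜ-distribˡ (a +i b) (c +i d) (e +i f) = cong₂ _+i_
      (solve 6 (λ a b c d e f → a :* (c :+ e) :- b :* (d :+ f) := (a :* c :- b :* d) :+ (a :* e :- b :* f)) refl a b c d e f)
      (solve 6 (λ a b c d e f → a :* (d :+ f) :+ b :* (c :+ e) := (a :* d :+ b :* c) :+ (a :* f :+ b :* e)) refl a b c d e f)

  -- Bounds on absolute values are compared after squaring; the real number r
  -- is meant to be nonnegative.
  ∣_∣<_ : ℂ → ℝ → Set
  ∣ z ∣< r = normSq z < r * r

  ∣_∣≤_·∣_∣ : ℂ → ℝ → ℂ → Set
  ∣ z ∣≤ r ·∣ w ∣ = normSq z ≤ (r * r) * normSq w

  sumOver : {A : Set} → (A → ℂ) → List A → ℂ
  sumOver f = foldr (λ a s → f a +ᶜ s) 0ᶜ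

  FiniteSubset : {A : Set} → Pred A 0ℓ → List A → Set
  FiniteSubset S as = Unique as × All S as

  -- Unconditional convergence of the family (f a), a ranging over S, to s:
  -- convergence of the net of finite partial sums.
  HasSum : {A : Set} → Pred A 0ℓ → (A → ℂ) → ℂ → Set
  HasSum S f s = ∀ ε → 0# < ε → ∃[ as ] FiniteSubset S as ×
    (∀ bs → FiniteSubset S bs → as ⊆ bs → ∣ sumOver f bs -ᶜ s ∣< ε)

  -- The sum of a summable family (0ᶜ for families that are not summable).
  tsum : {A : Set} → Pred A 0ℓ → (A → ℂ) → ℂ
  tsum S f = choose 0ᶜ (HasSum S f)

  ½+½ : ∀ x → x * ½ + x * ½ ≡ x
  ½+½ x = trans (Solver.solve 2 (λ x h → x Solver.:* h Solver.:+ x Solver.:* h Solver.:= x Solver.:* (Solver.con (+ 2) Solver.:* h)) refl x ½)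
            (trans (cong (x *_) (*-inverseʳ (fromℕ 2) (pos⇒≢0 (+-pos-nonneg 0<1 (inj₁ 0<1))))) (*-identityʳ x))

  ½-pos : 0# < ½
  ½-pos = ⁻¹-pos (+-pos-nonneg 0<1 (inj₁ 0<1))

  not-< : ∀ {a b} → (∀ ε → 0# < ε → ∃[ p ] (p - a) * (p - a) < ε * ε × (p - b) * (p - b) < ε * ε) → ¬ a < b
  not-< {a} {b} near a<b with near ((b - a) * ½) (*-positive (<⇒0<- a<b) ½-pos)
  ... | p , p≈a , p≈b = irrefl refl (subst₂ _<_
    (solve 3 (λ a b p → (p :- a) :+ (b :- p) := b :- a) refl a b p)
    (½+½ (b - a))
    (+-mono-< (sq-<⇒< 0<ε p≈a)
      (sq-<⇒< 0<ε (subst (_< ((b - a) * ½) * ((b - a) * ½)) (solve 2 (λ b p → (p :- b) :* (p :- b) := (b :- p) :* (b :- p)) refl b p) p≈b))))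
    where
    open Solver
    0<ε : 0# < (b - a) * ½
    0<ε = *-positive (<⇒0<- a<b) ½-pos

  close : ∀ {a b} → (∀ ε → 0# < ε → ∃[ p ] (p - a) * (p - a) < ε * ε × (p - b) * (p - b) < ε * ε) → a ≡ b
  close {a} {b} near with compare a b
  ... | tri< a<b _ _ = ⊥-elim (not-< near a<b)
  ... | tri≈ _ a≡b _ = a≡b
  ... | tri> _ _ b<a = ⊥-elim (not-< (λ ε 0<ε → let p , p≈a , p≈b = near ε 0<ε in p , p≈b , p≈a) b<a)

  drop-nonneg : ∀ {a b c} → 0# ≤ b → a + b < c → a < c
  drop-nonneg {c = c} (inj₂ refl) a+0<c = subst (_< c) (+-identityʳ _) a+0<c
  drop-nonneg {a} {b} (inj₁ 0<b)  a+b<c = <-trans (subst (_< a + b) (+-identityʳ a) (+-monoʳ-< a 0<b)) a+b<c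

  re-∣< : ∀ z w {ε} → ∣ z -ᶜ w ∣< ε → (re z - re w) * (re z - re w) < ε * ε
  re-∣< (a +i b) (c +i d) = drop-nonneg (sq-nonneg (b - d))

  im-∣< : ∀ z w {ε} → ∣ z -ᶜ w ∣< ε → (im z - im w) * (im z - im w) < ε * ε
  im-∣< (a +i b) (c +i d) {ε} z≈w =
    drop-nonneg (sq-nonneg (a - c)) (subst (_< ε * ε) (+-comm _ _) z≈w)

  HasSum-unique : ∀ {A : Set} {S : Pred A 0ℓ} {f : A → ℂ} {s s′} → HasSum S f s → HasSum S f s′ → s ≡ s′
  HasSum-unique {A} {S} {f} {s} {s′} Σ≡s Σ≡s′ = ℂ-ext
    (close λ ε 0<ε → let p , p≈s , p≈s′ = near ε 0<ε in re p , re-∣< p s p≈s , re-∣< p s′ p≈s′)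
    (close λ ε 0<ε → let p , p≈s , p≈s′ = near ε 0<ε in im p , im-∣< p s p≈s , im-∣< p s′ p≈s′)
    where
    _≟_ : DecidableEquality A
    a ≟ b = em
    near : ∀ ε → 0# < ε → ∃[ p ] ∣ p -ᶜ s ∣< ε × ∣ p -ᶜ s′ ∣< ε
    near ε 0<ε with Σ≡s ε 0<ε | Σ≡s′ ε 0<ε
    ... | as , (_ , as⊆S) , beyond-as | bs , (_ , bs⊆S) , beyond-bs =
      sumOver f cs , beyond-as cs finite (λ a∈as → ∈-deduplicate⁺ _≟_ (∈-++⁺ˡ a∈as))
                   , beyond-bs cs finite (λ b∈bs → ∈-deduplicate⁺ _≟_ (∈-++⁺ʳ as b∈bs))
      where
      cs : List A
      cs = deduplicate _≟_ (as List.++ bs)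
      finite : FiniteSubset S cs
      finite = deduplicate-! _≟_ (as List.++ bs) , AllP.deduplicate⁺ _≟_ (AllP.++⁺ as⊆S bs⊆S)

  HasSum-transfer : ∀ {A : Set} {S S′ : Pred A 0ℓ} {f : A → ℂ} {s} →
                    (∀ {a} → S a → S′ a) → (∀ {a} → S′ a → S a) → HasSum S f s → HasSum S′ f s
  HasSum-transfer S⊆S′ S′⊆S Σ≡s ε 0<ε with Σ≡s ε 0<ε
  ... | as , (as! , as⊆S) , beyond =
    as , (as! , All.map S⊆S′ as⊆S) , λ bs (bs! , bs⊆S′) → beyond bs (bs! , All.map S′⊆S bs⊆S′)

  tsum-cong : ∀ {A : Set} {S S′ : Pred A 0ℓ} {f : A → ℂ} →
              (∀ {a} → S a → S′ a) → (∀ {a} → S′ a → S a) → tsum S f ≡ tsum S′ f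
  tsum-cong {S = S} {S′} {f} S⊆S′ S′⊆S with em {∃ (HasSum S f)} | em {∃ (HasSum S′ f)}
  ... | yes (_ , Σ≡s) | yes (_ , Σ≡s′) = HasSum-unique (HasSum-transfer S⊆S′ S′⊆S Σ≡s) Σ≡s′
  ... | yes (s , Σ≡s) | no ¬S′         = ⊥-elim (¬S′ (s , HasSum-transfer S⊆S′ S′⊆S Σ≡s))
  ... | no ¬S         | yes (s , Σ≡s)  = ⊥-elim (¬S (s , HasSum-transfer S′⊆S S⊆S′ Σ≡s))
  ... | no _          | no _           = refl

  exp : ℂ → ℂ
  exp z = tsum U λ n → z ^ n *ᶜ ofℝ (fromℕ (n !) ⁻¹)

  expℝ sin : ℝ → ℝ
  expℝ x = re (exp (ofℝ x))
  sin x  = im (exp (𝕚 *ᶜ ofℝ x))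

  -- The least positive zero of the sine.
  π : ℝ
  π = choose 0# λ p → 0# < p × sin p ≡ 0# × (∀ x → 0# < x → x < p → sin x ≢ 0#)

  𝐞 : ℂ → ℂ
  𝐞 w = exp (ofℝ (fromℕ 2 * π) *ᶜ 𝕚 *ᶜ w)

  record ℍ : Set where
    field
      x y : ℝ
      0<y : 0# < y

    point : ℂ
    point = x +i y

  open ℍ public

  Continuous : (ℍ → ℂ) → Set
  Continuous f = ∀ τ ε → 0# < ε → ∃[ δ ] 0# < δ ×
    (∀ σ → ∣ point σ -ᶜ point τ ∣< δ → ∣ f σ -ᶜ f τ ∣< ε)

  Holomorphic : (ℍ → ℂ) → Set
  Holomorphic f = ∀ τ → ∃[ d ] (∀ ε → 0# < ε → ∃[ δ ] 0# < δ ×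
    (∀ σ → ∣ point σ -ᶜ point τ ∣< δ →
      ∣ f σ -ᶜ f τ -ᶜ d *ᶜ (point σ -ᶜ point τ) ∣≤ ε ·∣ point σ -ᶜ point τ ∣))

  -- g is the partial derivative of f with respect to x, respectively y.
  Has∂x Has∂y : (ℍ → ℂ) → (ℍ → ℂ) → Set
  Has∂x f g = ∀ τ ε → 0# < ε → ∃[ δ ] 0# < δ ×
    (∀ σ → y σ ≡ y τ → ∣ point σ -ᶜ point τ ∣< δ →
      ∣ f σ -ᶜ f τ -ᶜ ofℝ (x σ - x τ) *ᶜ g τ ∣≤ ε ·∣ point σ -ᶜ point τ ∣)
  Has∂y f g = ∀ τ ε → 0# < ε → ∃[ δ ] 0# < δ ×
    (∀ σ → x σ ≡ x τ → ∣ point σ -ᶜ point τ ∣< δ →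
      ∣ f σ -ᶜ f τ -ᶜ ofℝ (y σ - y τ) *ᶜ g τ ∣≤ ε ·∣ point σ -ᶜ point τ ∣)

  ContinuouslyDifferentiable : ℕ → (ℍ → ℂ) → Set
  ContinuouslyDifferentiable zero    f = Continuous f
  ContinuouslyDifferentiable (suc k) f = ∃[ fx ] ∃[ fy ] Has∂x f fx × Has∂y f fy ×
    ContinuouslyDifferentiable k fx × ContinuouslyDifferentiable k fy

  Smooth : (ℍ → ℂ) → Set
  Smooth f = ∀ k → ContinuouslyDifferentiable k f

  record SL₂ℝ : Set where
    field
      a b c d : ℝ
      det     : a * d - b * c ≡ 1#

    entries : ℝ × ℝ × ℝ × ℝ
    entries = a , b , c , d

  IsIntegral : SL₂ℝ → Set
  IsIntegral A = (∃[ k ] a ≡ fromℤ k) × (∃[ k ] b ≡ fromℤ k) × (∃[ k ] c ≡ fromℤ k) × (∃[ k ] d ≡ fromℤ k)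
    where open SL₂ℝ A

  j : SL₂ℝ → ℍ → ℂ
  j A τ = ofℝ c *ᶜ point τ +ᶜ ofℝ d
    where open SL₂ℝ A

  möbius : SL₂ℝ → ℍ → ℂ
  möbius A τ = (ofℝ a *ᶜ point τ +ᶜ ofℝ b) *ᶜ j A τ ⁻¹ᶜ
    where open SL₂ℝ A

  abstract
    normSq-j-pos : ∀ A τ → 0# < normSq (j A τ)
    normSq-j-pos A τ with em {SL₂ℝ.c A ≡ 0#}
    ... | no c≢0 = +-nonneg-pos (sq-nonneg _) (subst (0# <_)
      (solve 3 (λ c x y → (c :* c) :* (y :* y) := (c :* y :+ con 0ℤ :* x :+ con 0ℤ) :* (c :* y :+ con 0ℤ :* x :+ con 0ℤ))
        refl (SL₂ℝ.c A) (x τ) (y τ))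
      (*-positive (sq-pos c≢0) (*-positive (0<y τ) (0<y τ))))
      where open Solver
    ... | yes c≡0 = +-pos-nonneg (subst (λ r → 0# < r * r) (sym re-j) (sq-pos d≢0)) (sq-nonneg _)
      where
      open SL₂ℝ A
      open Solver
      re-j : c * x τ - 0# * y τ + d ≡ d
      re-j = trans (cong (λ r → r * x τ - 0# * y τ + d) c≡0)
                   (solve 3 (λ x y d → con 0ℤ :* x :- con 0ℤ :* y :+ d := d) refl (x τ) (y τ) d)
      d≢0 : d ≢ 0#
      d≢0 d≡0 = 0≢1 (trans (sym (trans (cong₂ (λ r s → a * r - b * s) d≡0 c≡0)
                  (solve 2 (λ a b → a :* con 0ℤ :- b :* con 0ℤ := con 0ℤ) refl a b))) det)

    im-möbius : ∀ A τ → im (möbius A τ) ≡ (SL₂ℝ.a A * SL₂ℝ.d A - SL₂ℝ.b A * SL₂ℝ.c A) * (y τ * normSq (j A τ) ⁻¹)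
    im-möbius A τ = trans
      (im-*ofℝ (ofℝ a *ᶜ point τ +ᶜ ofℝ b) (j A τ) (normSq (j A τ) ⁻¹))
      (trans (cong (_* normSq (j A τ) ⁻¹) numerator) (*-assoc _ _ _))
      where
      open SL₂ℝ A
      open Solver
      im-*ofℝ : ∀ z w n → im (z *ᶜ (conj w *ᶜ ofℝ n)) ≡ (im z * re w - re z * im w) * n
      im-*ofℝ (r +i s) (p +i q) n = solve 5
        (λ r s p q n → r :* (p :* con 0ℤ :+ (:- q) :* n) :+ s :* (p :* n :- (:- q) :* con 0ℤ) := (s :* p :- r :* q) :* n)
        refl r s p q n
      re-affine : ∀ a b → re (ofℝ a *ᶜ point τ +ᶜ ofℝ b) ≡ a * x τ + b
      re-affine a b = solve 4 (λ a b x y → a :* x :- con 0ℤ :* y :+ b := a :* x :+ b) refl a b (x τ) (y τ)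
      im-affine : ∀ a b → im (ofℝ a *ᶜ point τ +ᶜ ofℝ b) ≡ a * y τ
      im-affine a b = solve 3 (λ a x y → a :* y :+ con 0ℤ :* x :+ con 0ℤ := a :* y) refl a (x τ) (y τ)
      numerator : im (ofℝ a *ᶜ point τ +ᶜ ofℝ b) * re (j A τ) - re (ofℝ a *ᶜ point τ +ᶜ ofℝ b) * im (j A τ)
                  ≡ (a * d - b * c) * y τ
      numerator = trans
        (cong₂ _-_ (cong₂ _*_ (im-affine a b) (re-affine c d)) (cong₂ _*_ (re-affine a b) (im-affine c d)))
        (solve 6 (λ a b c d x y → (a :* y) :* (c :* x :+ d) :- (a :* x :+ b) :* (c :* y) := (a :* d :- b :* c) :* y)
          refl a b c d (x τ) (y τ))

    möbius-upper : ∀ A τ → 0# < im (möbius A τ)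
    möbius-upper A τ = subst (0# <_)
      (sym (trans (im-möbius A τ) (trans (cong (_* (y τ * normSq (j A τ) ⁻¹)) (SL₂ℝ.det A)) (*-identityˡ _))))
      (*-positive (0<y τ) (⁻¹-pos (normSq-j-pos A τ)))

  infixr 7 _•_

  _•_ : SL₂ℝ → ℍ → ℍ
  A • τ = record
    { x   = re (möbius A τ)
    ; y   = im (möbius A τ)
    ; 0<y = möbius-upper A τ
    }

  record Mp₂ℝ : Set where
    field
      matrix        : SL₂ℝ
      φ             : ℍ → ℂ
      φ-holomorphic : Holomorphic φ
      φ²≡j          : ∀ τ → φ τ *ᶜ φ τ ≡ j matrix τ

  open Mp₂ℝ public

  record Mp₂ℤ : Set where
    field
      pair     : Mp₂ℝ
      integral : IsIntegral (matrix pair)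

    open Mp₂ℝ pair public using () renaming (matrix to matrixℤ; φ to φℤ)

  open Mp₂ℤ public using (pair; matrixℤ; φℤ)

  -- Equality, unit, multiplication and the two generators of Mp₂(ℤ). All of
  -- them are relations: the elements concerned exist and are unique up to ≈ᴹ,
  -- since φ is compared pointwise.
  _≈ᴹ_ : Mp₂ℤ → Mp₂ℤ → Set
  g ≈ᴹ h = SL₂ℝ.entries (matrixℤ g) ≡ SL₂ℝ.entries (matrixℤ h) × (∀ τ → φℤ g τ ≡ φℤ h τ)

  IsUnit : Mp₂ℤ → Set
  IsUnit g = SL₂ℝ.entries (matrixℤ g) ≡ (1# , 0# , 0# , 1#) × (∀ τ → φℤ g τ ≡ 1ᶜ)

  IsProduct : Mp₂ℤ → Mp₂ℤ → Mp₂ℤ → Set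
  IsProduct g h gh =
    SL₂ℝ.entries (matrixℤ gh) ≡ (a * a′ + b * c′ , a * b′ + b * d′ , c * a′ + d * c′ , c * b′ + d * d′) ×
    (∀ τ → φℤ gh τ ≡ φℤ g (matrixℤ h • τ) *ᶜ φℤ h τ)
    where
    open SL₂ℝ (matrixℤ g)
    open SL₂ℝ (matrixℤ h) renaming (a to a′; b to b′; c to c′; d to d′)

  IsT IsS : Mp₂ℤ → Set
  IsT g = SL₂ℝ.entries (matrixℤ g) ≡ (1# , 1# , 0# , 1#) × (∀ τ → φℤ g τ ≡ 1ᶜ)
  -- The square root of τ lying in ℍ.
  IsS g = SL₂ℝ.entries (matrixℤ g) ≡ (0# , - 1# , 1# , 0#) × (∀ τ → 0# < im (φℤ g τ))

  record FiniteIndexSubgroup : Set₁ where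
    field
      _∈Γ              : Pred Mp₂ℤ 0ℓ
      respects         : ∀ {g h} → g ≈ᴹ h → g ∈Γ → h ∈Γ
      unit-closed      : ∀ {e} → IsUnit e → e ∈Γ
      product-closed   : ∀ {g h gh} → IsProduct g h gh → g ∈Γ → h ∈Γ → gh ∈Γ
      inverse-closed   : ∀ {g h e} → IsProduct g h e → IsUnit e → g ∈Γ → h ∈Γ
      representatives  : List Mp₂ℤ
      finite-index     : ∀ g → ∃[ r ] r ∈ representatives × (∃[ h ] h ∈Γ × IsProduct r h g)

  _⊗ℝ _⊗ℂ : EvenLattice → Set
  L ⊗ℝ = Vec ℝ (rank L)
  L ⊗ℂ = Vec ℂ (rank L)

  module ℝForm = Form ℝ-commutativeRing fromℤ
  module ℂForm = Form ℂ-commutativeRing (λ k → ofℝ (fromℤ k))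

  pairingℝ : ∀ L → L ⊗ℝ → L ⊗ℝ → ℝ
  pairingℝ L = ℝForm.pairing (gram L)

  pairingℂ : ∀ L → L ⊗ℂ → L ⊗ℂ → ℂ
  pairingℂ L = ℂForm.pairing (gram L)

  infixl 6 _+ᵥ_
  infixr 7 _·ᵥ_

  _+ᵥ_ : ∀ {n} → Vec ℝ n → Vec ℝ n → Vec ℝ n
  _+ᵥ_ = zipWith _+_

  _·ᵥ_ : ∀ {n} → ℝ → Vec ℝ n → Vec ℝ n
  r ·ᵥ v = Vec.map (r *_) v

  0ᵥ : ∀ {n} → Vec ℝ n
  0ᵥ = replicate _ 0#

  embed : ∀ {n} → Vec ℤ n → Vec ℝ n
  embed = Vec.map fromℤ

  record Dual (L : EvenLattice) : Set where
    field
      vec      : L ⊗ℝ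
      integral : ∀ l → ∃[ k ] pairingℝ L vec (embed l) ≡ fromℤ k

  open Dual public using (vec)

  -- λ′ ∈ L + γ
  Coset : ∀ L → Dual L → Pred (L ⊗ℝ) 0ℓ
  Coset L γ λ′ = ∃[ l ] λ′ ≡ vec γ +ᵥ embed l

  shift-0 : ∀ {n} (v : Vec ℝ n) → v ≡ v +ᵥ embed (replicate n 0ℤ)
  shift-0 []      = refl
  shift-0 (r ∷ v) = cong₂ _∷_ (sym (+-identityʳ r)) (shift-0 v)

  shift-neg : ∀ {n} (v : Vec ℝ n) l → v ≡ (v +ᵥ embed l) +ᵥ embed (Vec.map ℤ.-_ l)
  shift-neg []      []      = refl
  shift-neg (r ∷ v) (k ∷ l) = cong₂ _∷_
    (sym (trans (cong (λ s → r + fromℤ k + s) (fromℤ-neg k)) (solve 2 (λ r k → r :+ k :- k := r) refl r (fromℤ k))))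
    (shift-neg v l)
    where open Solver

  shift-+ : ∀ {n} (v : Vec ℝ n) l m → (v +ᵥ embed l) +ᵥ embed m ≡ v +ᵥ embed (zipWith ℤ._+_ l m)
  shift-+ []      []      []      = refl
  shift-+ (r ∷ v) (k ∷ l) (k′ ∷ m) = cong₂ _∷_
    (trans (+-assoc r _ _) (cong (λ s → r + s) (sym (fromℤ-+ k k′))))
    (shift-+ v l m)

  -- D_L is the dual lattice with equality modulo L.
  D : EvenLattice → Setoid 0ℓ 0ℓ
  D L = record
    { Carrier       = Dual L
    ; _≈_           = λ γ δ → Coset L γ (vec δ)
    ; isEquivalence = record
      { refl  = λ {γ} → _ , shift-0 (vec γ)
      ; sym   = λ {γ} {δ} (l , δ≡γ+l) → _ , trans (shift-neg (vec γ) l) (cong (_+ᵥ _) (sym δ≡γ+l))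
      ; trans = λ {γ} {δ} {η} (l , δ≡γ+l) (m , η≡δ+m) →
                  _ , trans η≡δ+m (trans (cong (_+ᵥ embed m) δ≡γ+l) (shift-+ (vec γ) l m))
      }
    }

  record Enumeration (L : EvenLattice) : Set where
    open Setoid (D L)
    field
      order    : ℕ
      rep      : Fin order → Dual L
      covers   : ∀ γ → ∃[ i ] rep i ≈ γ
      distinct : ∀ i i′ → rep i ≈ rep i′ → i ≡ i′

  -- D_L is finite because the form is nondegenerate, so that the default
  -- values below are never taken.
  ∣D_∣ : EvenLattice → ℕ
  ∣D L ∣ with em {Enumeration L}
  ... | yes E = Enumeration.order E
  ... | no _  = 0

  ∑D : ∀ L → (Dual L → ℂ) → ℂ
  ∑D L f with em {Enumeration L}
  ... | yes E = sum λ i → f (Enumeration.rep E i)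
    where open import Algebra.Properties.CommutativeMonoid.Sum (CommutativeRing.+-commutativeMonoid ℂ-commutativeRing) using (sum)
  ... | no _  = 0ᶜ

  -- A function on L* invariant under L, as the family of coefficients of the
  -- basis elements 𝔢 γ.
  record ℂ[D_] (L : EvenLattice) : Set where
    field
      coeff      : Dual L → ℂ
      coeff-cong : ∀ {γ δ} → Setoid._≈_ (D L) γ δ → coeff γ ≡ coeff δ

  open ℂ[D_] public

  infix 4 _≋_

  _≋_ : ∀ {L} → ℂ[D L ] → ℂ[D L ] → Set
  u ≋ v = ∀ γ → coeff u γ ≡ coeff v γ

  _⊹_ : ∀ {L} → ℂ[D L ] → ℂ[D L ] → ℂ[D L ]
  u ⊹ v = record
    { coeff      = λ γ → coeff u γ +ᶜ coeff v γ
    ; coeff-cong = λ γ≈δ → cong₂ _+ᶜ_ (coeff-cong u γ≈δ) (coeff-cong v γ≈δ)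
    }

  _⊙_ : ∀ {L} → ℂ → ℂ[D L ] → ℂ[D L ]
  z ⊙ u = record
    { coeff      = λ γ → z *ᶜ coeff u γ
    ; coeff-cong = λ γ≈δ → cong (z *ᶜ_) (coeff-cong u γ≈δ)
    }

  𝔢 : ∀ {L} → Dual L → ℂ[D L ]
  𝔢 {L} γ = record { coeff = indicator ; coeff-cong = indicator-cong }
    where
    module DL = Setoid (D L)
    indicator : Dual L → ℂ
    indicator δ with em {γ DL.≈ δ}
    ... | yes _ = 1ᶜ
    ... | no _  = 0ᶜ
    indicator-cong : ∀ {δ δ′} → δ DL.≈ δ′ → indicator δ ≡ indicator δ′
    indicator-cong {δ} {δ′} δ≈δ′ with em {γ DL.≈ δ} | em {γ DL.≈ δ′}
    ... | yes _   | yes _    = refl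
    ... | no _    | no _     = refl
    ... | yes γ≈δ | no γ≉δ′  = ⊥-elim (γ≉δ′ (DL.trans {γ} {δ} {δ′} γ≈δ δ≈δ′))
    ... | no γ≉δ  | yes γ≈δ′ = ⊥-elim (γ≉δ (DL.trans {γ} {δ′} {δ} γ≈δ′ (DL.sym {δ} {δ′} δ≈δ′)))

  -- The inclusions between L* and L(-1)*, which are the same subset of L_ℝ.
  negateDual : ∀ {L} → Dual L → Dual (L ⟨-1⟩)
  negateDual {L} γ = record
    { vec      = vec γ
    ; integral = λ l → let k , eq = Dual.integral γ l in
        ℤ.- k , trans (ℝForm.pairing-negate fromℤ-neg (gram L) (vec γ) (embed l)) (trans (cong -_ eq) (sym (fromℤ-neg k)))
    }

  unnegateDual : ∀ {L} → Dual (L ⟨-1⟩) → Dual L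
  unnegateDual {L} γ = record
    { vec      = vec γ
    ; integral = λ l → let k , eq = Dual.integral γ l in
        ℤ.- k , trans (-x≡y⇒x≡-y (trans (sym (ℝForm.pairing-negate fromℤ-neg (gram L) (vec γ) (embed l))) eq)) (sym (fromℤ-neg k))
    }
    where
    -x≡y⇒x≡-y : ∀ {r s} → - r ≡ s → r ≡ - s
    -x≡y⇒x≡-y {r} refl = Solver.solve 1 (λ r → r Solver.:= Solver.:- (Solver.:- r)) refl r

  -- The bilinear pairing of ℂ[D_L] and ℂ[D_{L(-1)}] for which (𝔢 γ) and
  -- (𝔢 (negateDual γ)) are dual bases.
  ⟨_,_⟩ : ∀ {L} → ℂ[D L ] → ℂ[D L ⟨-1⟩ ] → ℂ
  ⟨_,_⟩ {L} u v = ∑D L λ γ → coeff u γ *ᶜ coeff v (negateDual γ)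

  -- Signature (b₊ , b₋), by an orthogonal basis of L_ℝ.
  record HasSignature (L : EvenLattice) (b₊ b₋ : ℕ) : Set where
    field
      basis      : Fin b₊ ⊎ Fin b₋ → L ⊗ℝ
      dimension  : b₊ ℕ.+ b₋ ≡ rank L
      orthogonal : ∀ {i i′} → i ≢ i′ → pairingℝ L (basis i) (basis i′) ≡ 0#
      positive   : ∀ i → 0# < pairingℝ L (basis (inj₁ i)) (basis (inj₁ i))
      negative   : ∀ i → pairingℝ L (basis (inj₂ i)) (basis (inj₂ i)) < 0#

  -- As T and S generate Mp₂(ℤ), the axioms determine ρ up to pointwise equality.
  record WeilRepresentation (L : EvenLattice) : Set where
    field
      ρ           : Mp₂ℤ → ℂ[D L ] → ℂ[D L ]
      ρ-cong      : ∀ {g h u v} → g ≈ᴹ h → u ≋ v → ρ g u ≋ ρ h v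
      ρ-additive  : ∀ g u v → ρ g (u ⊹ v) ≋ ρ g u ⊹ ρ g v
      ρ-scalar    : ∀ g z u → ρ g (z ⊙ u) ≋ z ⊙ ρ g u
      ρ-unit      : ∀ {e} → IsUnit e → ∀ u → ρ e u ≋ u
      ρ-product   : ∀ {g h gh} → IsProduct g h gh → ∀ u → ρ gh u ≋ ρ g (ρ h u)
      ρ-T         : ∀ {g} → IsT g → ∀ (γ : Dual L) →
                    ρ g (𝔢 γ) ≋ 𝐞 (ofℝ (pairingℝ L (vec γ) (vec γ) * ½)) ⊙ 𝔢 γ
      ρ-S         : ∀ {g b₊ b₋} → IsS g → HasSignature L b₊ b₋ → ∀ (γ η : Dual L) →
                    coeff (ρ g (𝔢 γ)) η ≡
                      𝐞 (ofℝ ((fromℕ b₋ - fromℕ b₊) * fromℕ 8 ⁻¹)) *ᶜ ofℝ ((√ fromℕ ∣D L ∣) ⁻¹) *ᶜ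
                      ∑D L (λ δ → 𝐞 (ofℝ (- pairingℝ L (vec γ) (vec δ))) *ᶜ coeff (𝔢 δ) η)

  record ½ℤ : Set where
    constructor _/2
    field
      double : ℤ

  open ½ℤ public

  record IsModularForm (Γ : FiniteIndexSubgroup) (p q : ½ℤ) {L : EvenLattice}
                       (W : WeilRepresentation L) (F : ℍ → ℂ[D L ]) : Set where
    open FiniteIndexSubgroup Γ
    open WeilRepresentation W
    field
      smooth    : ∀ γ → Smooth λ τ → coeff (F τ) γ
      modular   : ∀ g → g ∈Γ → ∀ τ →
                  F (matrixℤ g • τ) ≋ (φℤ g τ ^ℤ double p *ᶜ conj (φℤ g τ) ^ℤ double q) ⊙ ρ g (F τ)
      -- F(Aτ) = O(exp(Cy)) as y → ∞, uniformly for ∣x∣ ≤ B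
      growth    : ∀ A → IsIntegral A → ∃[ C ] ∀ B → ∃[ M ] ∃[ y₀ ] ∀ τ →
                  - B ≤ x τ → x τ ≤ B → y₀ ≤ y τ → ∀ γ →
                  ∣ coeff (F (A • τ)) γ ∣≤ M * expℝ (C * y τ) ·∣ 1ᶜ ∣

  record IsSubspace {n} (V : Pred (Vec ℝ n) 0ℓ) : Set where
    field
      0-closed : V 0ᵥ
      +-closed : ∀ {u v} → V u → V v → V (u +ᵥ v)
      ·-closed : ∀ r {v} → V v → V (r ·ᵥ v)

  record Gr (L : EvenLattice) : Set₁ where
    field
      V₊ V₋      : Pred (L ⊗ℝ) 0ℓ
      subspace₊  : IsSubspace V₊
      subspace₋  : IsSubspace V₋
      positive   : ∀ {u} → V₊ u → u ≢ 0ᵥ → 0# < pairingℝ L u u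
      negative   : ∀ {u} → V₋ u → u ≢ 0ᵥ → pairingℝ L u u < 0#
      orthogonal : ∀ {u v} → V₊ u → V₋ v → pairingℝ L u v ≡ 0#
      decompose  : ∀ u → ∃[ u₊ ] ∃[ u₋ ] V₊ u₊ × V₋ u₋ × u ≡ u₊ +ᵥ u₋

    proj₊ proj₋ : L ⊗ℝ → L ⊗ℝ
    proj₊ u = proj₁ (decompose u)
    proj₋ u = proj₁ (proj₂ (decompose u))

  _⊞ₛ_ : ∀ {m n} → Pred (Vec ℝ m) 0ℓ → Pred (Vec ℝ n) 0ℓ → Pred (Vec ℝ (m ℕ.+ n)) 0ℓ
  (U₁ ⊞ₛ U₂) u = ∃[ u₁ ] ∃[ u₂ ] U₁ u₁ × U₂ u₂ × u ≡ u₁ ++ u₂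

  ⊞ₛ-subspace : ∀ {m n} {U₁ : Pred (Vec ℝ m) 0ℓ} {U₂ : Pred (Vec ℝ n) 0ℓ} →
                IsSubspace U₁ → IsSubspace U₂ → IsSubspace (U₁ ⊞ₛ U₂)
  ⊞ₛ-subspace {m} S₁ S₂ = record
    { 0-closed = _ , _ , 0-closed S₁ , 0-closed S₂ , sym (replicate-++ m)
    ; +-closed = λ { (u₁ , u₂ , U₁u , U₂u , refl) (v₁ , v₂ , U₁v , U₂v , refl) →
                     _ , _ , +-closed S₁ U₁u U₁v , +-closed S₂ U₂u U₂v , VecP.zipWith-++ _+_ u₁ u₂ v₁ v₂ }
    ; ·-closed = λ { r (u₁ , u₂ , U₁u , U₂u , refl) →
                     _ , _ , ·-closed S₁ r U₁u , ·-closed S₂ r U₂u , VecP.map-++ (r *_) u₁ u₂ }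
    }
    where open IsSubspace

  _⊕ᴳ_ : ∀ {L K} → Gr L → Gr K → Gr (L ⊕ K)
  _⊕ᴳ_ {L} {K} v w = record
    { V₊         = V₊ v ⊞ₛ V₊ w
    ; V₋         = V₋ v ⊞ₛ V₋ w
    ; subspace₊  = ⊞ₛ-subspace (subspace₊ v) (subspace₊ w)
    ; subspace₋  = ⊞ₛ-subspace (subspace₋ v) (subspace₋ w)
    ; positive   = λ { (u₁ , u₂ , U₁ , U₂ , refl) u≢0 →
        subst (0# <_) (sym (splits u₁ u₂ u₁ u₂)) (pos u₁ u₂ U₁ U₂ u≢0) }
    ; negative   = λ { (u₁ , u₂ , U₁ , U₂ , refl) u≢0 →
        subst (_< 0#) (sym (splits u₁ u₂ u₁ u₂)) (neg u₁ u₂ U₁ U₂ u≢0) }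
    ; orthogonal = λ { (u₁ , u₂ , U₁ , U₂ , refl) (u₁′ , u₂′ , U₁′ , U₂′ , refl) →
        trans (splits u₁ u₂ u₁′ u₂′) (trans (cong₂ _+_ (orthogonal v U₁ U₁′) (orthogonal w U₂ U₂′)) (+-identityˡ 0#)) }
    ; decompose  = λ u →
        let a₊ , a₋ , a₊∈ , a₋∈ , a≡ = decompose v (take (rank L) u)
            b₊ , b₋ , b₊∈ , b₋∈ , b≡ = decompose w (drop (rank L) u)
        in a₊ ++ b₊ , a₋ ++ b₋ , (a₊ , b₊ , a₊∈ , b₊∈ , refl) , (a₋ , b₋ , a₋∈ , b₋∈ , refl) ,
           trans (split (rank L) u) (trans (cong₂ _++_ a≡ b≡) (sym (VecP.zipWith-++ _+_ a₊ b₊ a₋ b₋)))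
    }
    where
    open Gr

    splits : ∀ u₁ u₂ u₁′ u₂′ → pairingℝ (L ⊕ K) (u₁ ++ u₂) (u₁′ ++ u₂′) ≡ pairingℝ L u₁ u₁′ + pairingℝ K u₂ u₂′
    splits = ℝForm.pairing-⊞ refl (gram L) (gram K)

    zero² : ∀ M {u} → u ≡ 0ᵥ → pairingℝ M u u ≡ 0#
    zero² M refl = ℝForm.pairing-zeroˡ (gram M) 0ᵥ

    pos : ∀ u₁ u₂ → V₊ v u₁ → V₊ w u₂ → u₁ ++ u₂ ≢ 0ᵥ → 0# < pairingℝ L u₁ u₁ + pairingℝ K u₂ u₂
    pos u₁ u₂ U₁ U₂ u≢0 with em {u₁ ≡ 0ᵥ} | em {u₂ ≡ 0ᵥ}
    ... | yes p | yes q = ⊥-elim (u≢0 (trans (cong₂ _++_ p q) (replicate-++ (rank L))))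
    ... | yes p | no q  = +-nonneg-pos (inj₂ (sym (zero² L p))) (positive w U₂ q)
    ... | no p  | yes q = +-pos-nonneg (positive v U₁ p) (inj₂ (sym (zero² K q)))
    ... | no p  | no q  = +-pos-nonneg (positive v U₁ p) (inj₁ (positive w U₂ q))

    neg : ∀ u₁ u₂ → V₋ v u₁ → V₋ w u₂ → u₁ ++ u₂ ≢ 0ᵥ → pairingℝ L u₁ u₁ + pairingℝ K u₂ u₂ < 0#
    neg u₁ u₂ U₁ U₂ u≢0 with em {u₁ ≡ 0ᵥ} | em {u₂ ≡ 0ᵥ}
    ... | yes p | yes q = ⊥-elim (u≢0 (trans (cong₂ _++_ p q) (replicate-++ (rank L))))
    ... | yes p | no q  = subst (_< 0#) (sym (trans (cong (_+ pairingℝ K u₂ u₂) (zero² L p)) (+-identityˡ (pairingℝ K u₂ u₂)))) (negative w U₂ q)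
    ... | no p  | yes q = subst (_< 0#) (sym (trans (cong (λ s → pairingℝ L u₁ u₁ + s) (zero² K q)) (+-identityʳ (pairingℝ L u₁ u₁)))) (negative v U₁ p)
    ... | no p  | no q  = subst (pairingℝ L u₁ u₁ + pairingℝ K u₂ u₂ <_) (+-identityˡ 0#) (+-mono-< (negative v U₁ p) (negative w U₂ q))

  -- The families are summable, u ↦ (u₊,u₊) - (u₋,u₋) being positive definite.
  Θ : ∀ L → Gr L → ℍ → L ⊗ℂ → ℂ[D L ]
  Θ L v τ ζ = record
    { coeff      = λ γ → tsum (Coset L γ) term
    ; coeff-cong = λ {γ} {δ} γ≈δ → tsum-cong
        (λ {λ′} → DL-trans δ γ λ′ (Setoid.sym (D L) {γ} {δ} γ≈δ))
        (λ {λ′} → DL-trans γ δ λ′ γ≈δ)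
    }
    where
    open Gr v
    half-square : L ⊗ℝ → ℂ
    half-square u = ofℝ (pairingℝ L u u * ½)

    term : L ⊗ℝ → ℂ
    term λ′ = 𝐞 (point τ *ᶜ half-square (proj₊ λ′) +ᶜ conj (point τ) *ᶜ half-square (proj₋ λ′)
                 +ᶜ pairingℂ L (Vec.map ofℝ λ′) ζ)

    DL-trans : ∀ γ δ λ′ → Coset L γ (vec δ) → Coset L δ λ′ → Coset L γ λ′
    DL-trans γ δ λ′ (l , δ≡γ+l) (m , λ′≡δ+m) =
      _ , trans λ′≡δ+m (trans (cong (_+ᵥ embed m) δ≡γ+l) (shift-+ (vec γ) l m))

  Φ : ∀ L → Gr L → (ℍ → ℂ[D L ⟨-1⟩ ]) → ℍ → L ⊗ℂ → ℂ
  Φ L v F τ ζ = ⟨ Θ L v τ ζ , F τ ⟩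

  module _ {L K : EvenLattice} where
    private
      splits : ∀ u l l′ → pairingℝ (L ⊕ K) u (embed (l ++ l′)) ≡
               pairingℝ L (take (rank L) u) (embed l) + pairingℝ K (drop (rank L) u) (embed l′)
      splits u l l′ = trans
        (cong₂ (pairingℝ (L ⊕ K)) (split (rank L) u) (VecP.map-++ fromℤ l l′))
        (ℝForm.pairing-⊞ refl (gram L) (gram K) (take (rank L) u) (drop (rank L) u) (embed l) (embed l′))

      embed-0 : ∀ M u → pairingℝ M u (embed (replicate (rank M) 0ℤ)) ≡ 0#
      embed-0 M u = trans (cong (pairingℝ M u) (VecP.map-replicate fromℤ 0ℤ (rank M))) (ℝForm.pairing-zeroʳ (gram M) u)

      left : ∀ u l → pairingℝ (L ⊕ K) u (embed (l ++ replicate (rank K) 0ℤ)) ≡ pairingℝ L (take (rank L) u) (embed l)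
      left u l = trans (splits u l (replicate (rank K) 0ℤ)) (trans
        (cong (λ s → pairingℝ L (take (rank L) u) (embed l) + s) (embed-0 K (drop (rank L) u)))
        (+-identityʳ (pairingℝ L (take (rank L) u) (embed l))))

      right : ∀ u l → pairingℝ (L ⊕ K) u (embed (replicate (rank L) 0ℤ ++ l)) ≡ pairingℝ K (drop (rank L) u) (embed l)
      right u l = trans (splits u (replicate (rank L) 0ℤ) l) (trans
        (cong (λ s → s + pairingℝ K (drop (rank L) u) (embed l)) (embed-0 L (take (rank L) u)))
        (+-identityˡ (pairingℝ K (drop (rank L) u) (embed l))))

    -- (L ⊕ K)* = L* ⊕ K*
    dual₁ : Dual (L ⊕ K) → Dual L
    dual₁ γ = record
      { vec      = take (rank L) (vec γ)
      ; integral = λ l → let k , eq = Dual.integral γ (l ++ replicate (rank K) 0ℤ) in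
          k , trans (sym (left (vec γ) l)) eq
      }

    dual₂ : Dual (L ⊕ K) → Dual K
    dual₂ γ = record
      { vec      = drop (rank L) (vec γ)
      ; integral = λ l → let k , eq = Dual.integral γ (replicate (rank L) 0ℤ ++ l) in
          k , trans (sym (right (vec γ) l)) eq
      }

  take-shift : ∀ m {n} (v u : Vec ℝ (m ℕ.+ n)) l → v ≡ u +ᵥ embed l → take m v ≡ take m u +ᵥ embed (take m l)
  take-shift m _ u l refl = trans (VecP.take-zipWith {m = m} _+_ u (embed l))
    (cong (take m u +ᵥ_) (VecP.take-map fromℤ m l))

  drop-shift : ∀ m {n} (v u : Vec ℝ (m ℕ.+ n)) l → v ≡ u +ᵥ embed l → drop m v ≡ drop m u +ᵥ embed (drop m l)
  drop-shift m _ u l refl = trans (VecP.drop-zipWith {m = m} _+_ u (embed l))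
    (cong (drop m u +ᵥ_) (VecP.drop-map fromℤ m l))

  -- (L ⊕ K)(-1)* = L(-1)* ⊕ K(-1)*
  component₁ : ∀ L K → Dual ((L ⊕ K) ⟨-1⟩) → Dual (L ⟨-1⟩)
  component₁ L K γ = negateDual {L} (dual₁ {L} {K} (unnegateDual {L ⊕ K} γ))

  component₂ : ∀ L K → Dual ((L ⊕ K) ⟨-1⟩) → Dual (K ⟨-1⟩)
  component₂ L K γ = negateDual {K} (dual₂ {L} {K} (unnegateDual {L ⊕ K} γ))

  component₁-cong : ∀ L K (u : ℂ[D L ⟨-1⟩ ]) γ δ → Coset ((L ⊕ K) ⟨-1⟩) γ (vec δ) →
              coeff u (component₁ L K γ) ≡ coeff u (component₁ L K δ)
  component₁-cong L K u γ δ (l , δ≡γ+l) = coeff-cong u {component₁ L K γ} {component₁ L K δ}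
    (take (rank L) l , take-shift (rank L) (vec δ) (vec γ) l δ≡γ+l)

  component₂-cong : ∀ L K (u : ℂ[D K ⟨-1⟩ ]) γ δ → Coset ((L ⊕ K) ⟨-1⟩) γ (vec δ) →
               coeff u (component₂ L K γ) ≡ coeff u (component₂ L K δ)
  component₂-cong L K u γ δ (l , δ≡γ+l) = coeff-cong u {component₂ L K γ} {component₂ L K δ}
    (drop (rank L) l , drop-shift (rank L) (vec δ) (vec γ) l δ≡γ+l)

  -- u ⊗ v, through 𝔢*_(γ,δ) = 𝔢*_γ ⊗ 𝔢*_δ
  tensor : ∀ L K → ℂ[D L ⟨-1⟩ ] → ℂ[D K ⟨-1⟩ ] → ℂ[D (L ⊕ K) ⟨-1⟩ ]
  tensor L K u v = record
    { coeff      = λ γ → coeff u (component₁ L K γ) *ᶜ coeff v (component₂ L K γ)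
    ; coeff-cong = λ {γ} {δ} γ≈δ → cong₂ _*ᶜ_ (component₁-cong L K u γ δ γ≈δ) (component₂-cong L K v γ δ γ≈δ)
    }

{-# OPTIONS --safe #-}

-- A theta term of L ⊕ K at u + u′ is the product of the terms of L and K,
-- because 𝐞 turns sums into products. Summing over a coset of L ⊕ K gives the
-- product of the sums over the cosets of L and K: an unconditionally convergent
-- complex family is absolutely summable, so its product with another one is
-- summable, and the sum can be computed along rectangles. Summing over
-- D (L ⊕ K) = D L × D K then factorises the pairing as well. The default
-- values of tsum and ∑D factorise too, so convergence of the theta series and
-- finiteness of D L never enter.
module Submission where

open import Defs
open import Level using (0ℓ)
open import Algebra.Bundles using (CommutativeRing)
open import Axiom.ExcludedMiddle using (ExcludedMiddle)
open import Data.Empty using (⊥-elim)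
open import Data.Fin.Base using (Fin; zero; suc; combine; remQuot; _↑ˡ_; _↑ʳ_)
import Data.Fin.Properties as FinP
open import Data.Fin.Permutation using (permutation)
open import Data.Integer.Base as ℤ using (+_; 0ℤ; 1ℤ)
import Data.Integer.Properties as ℤP
open import Data.List.Base as List using (List; []; _∷_; foldr; map; filter; deduplicate; cartesianProduct; downFrom)
open import Data.List.Membership.Propositional using (_∈_; _∉_)
open import Data.List.Membership.Propositional.Properties
open import Data.List.Properties using (filter-accept; filter-reject)
open import Data.List.Relation.Binary.Subset.Propositional using (_⊆_)
open import Data.List.Relation.Unary.All as All using (All; []; _∷_)
import Data.List.Relation.Unary.All.Properties as AllP
import Data.List.Relation.Unary.AllPairs as AllPairs
open import Data.List.Relation.Unary.Any using (here; there)
open import Data.List.Relation.Unary.Unique.DecPropositional.Properties using (deduplicate-!)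
open import Data.List.Relation.Unary.Unique.Propositional using (Unique)
import Data.List.Relation.Unary.Unique.Propositional.Properties as UniqueP
open import Data.Nat.Base as ℕ using (ℕ; zero; suc; _!)
import Data.Nat.Properties as ℕP
open import Data.Product.Base using (∃; ∃-syntax; Σ-syntax; _×_; _,_; proj₁; proj₂; map₁; map₂; uncurry)
open import Data.Sum.Base using (_⊎_; inj₁; inj₂; [_,_]′)
open import Data.Unit.Base using (tt)
open import Data.Vec.Base as Vec using (Vec; _++_; take; drop)
import Data.Vec.Properties as VecP
open import Function.Base using (_∘_; id)
open import Relation.Binary.Bundles using (Setoid)
open import Relation.Binary.Definitions using (tri<; tri≈; tri>; DecidableEquality)
open import Relation.Binary.PropositionalEquality using (_≡_; refl; sym; trans; cong; cong₂; subst; subst₂)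
open import Relation.Nullary using (¬_; Dec; yes; no)
open import Relation.Nullary.Decidable using (toSum)
open import Relation.Unary using (Pred; U; Decidable; _⟨×⟩_)

open EvenLattice using (rank; gram)

-- The product theorem serves twice. `exp` is itself an unconditional sum, so its additivity comes
-- from a product family over ℕ × ℕ, evaluated along triangles, where the theta series use
-- rectangles; `HasSum-cofinal` is the common principle. Completeness is available only as the
-- existence of suprema. Summability is therefore derived from a bound on finite sums of norms, by
-- way of nonnegative real families. The default values are the delicate point: a product family
-- could be summable with one factor not summable, if the other factor were zero. This cannot happen
-- here because `𝐞` takes invertible values. For the outer sums, an enumeration of `D (L ⊕ K)`
-- projects to enumerations of `D L` and `D K`, so if one of these is missing, both sides are zero.
-- Finally, `∑D` uses an enumeration supplied by excluded middle, and the one for L ⊕ K is unrelated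
-- to those for L and K; hence the sums must be shown independent of the enumeration.

private
  variable
    A B : Set

-- Concatenated vectors, and finite subsets of ℕ and ℕ × ℕ

take-++ : ∀ m {n} (u : Vec A m) (v : Vec A n) → take m (u ++ v) ≡ u
take-++ m u v = VecP.++-injectiveˡ (take m (u ++ v)) u (VecP.take++drop≡id m (u ++ v))

drop-++ : ∀ m {n} (u : Vec A m) (v : Vec A n) → drop m (u ++ v) ≡ v
drop-++ m u v = VecP.++-injectiveʳ (take m (u ++ v)) u (VecP.take++drop≡id m (u ++ v))

bound : (h : A → ℕ) (as : List A) → ∃[ m ] ∀ {a} → a ∈ as → h a ℕ.< m
bound h []       = 0 , λ ()
bound h (a ∷ as) with bound h as
... | m , as<m = suc (h a) ℕ.⊔ m , λ
  { (here refl)  → ℕP.m≤m⊔n (suc (h a)) m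
  ; (there a∈as) → ℕP.≤-trans (as<m a∈as) (ℕP.m≤n⊔m (suc (h a)) m) }

all-U : ∀ (as : List A) → All U as
all-U as = All.universal (λ _ → tt) as

antidiagonal : ℕ → List (ℕ × ℕ)
antidiagonal zero    = (0 , 0) ∷ []
antidiagonal (suc n) = (0 , suc n) ∷ map (map₁ suc) (antidiagonal n)

∈-antidiagonal⁺ : ∀ i j → (i , j) ∈ antidiagonal (i ℕ.+ j)
∈-antidiagonal⁺ zero    zero    = here refl
∈-antidiagonal⁺ zero    (suc j) = here refl
∈-antidiagonal⁺ (suc i) j       = there (∈-map⁺ (map₁ suc) (∈-antidiagonal⁺ i j))

∈-antidiagonal⁻ : ∀ n {ij} → ij ∈ antidiagonal n → proj₁ ij ℕ.+ proj₂ ij ≡ n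
∈-antidiagonal⁻ zero    (here refl)  = refl
∈-antidiagonal⁻ (suc n) (here refl)  = refl
∈-antidiagonal⁻ (suc n) (there ij∈) with ∈-map⁻ (map₁ suc) ij∈
... | _ , ij∈ , refl = cong suc (∈-antidiagonal⁻ n ij∈)

antidiagonal-unique : ∀ n → Unique (antidiagonal n)
antidiagonal-unique zero    = [] AllPairs.∷ AllPairs.[]
antidiagonal-unique (suc n) =
  AllP.map⁺ (All.universal (λ _ ()) _) AllPairs.∷ UniqueP.map⁺ (λ { refl → refl }) (antidiagonal-unique n)

-- The index sets of partial sums of a Cauchy product. They are cofinal among the finite subsets of
-- ℕ × ℕ.
triangle : ℕ → List (ℕ × ℕ)
triangle zero    = []
triangle (suc n) = antidiagonal n List.++ triangle n

∈-triangle⁺ : ∀ {n i j} → i ℕ.+ j ℕ.< n → (i , j) ∈ triangle n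
∈-triangle⁺ {suc n} {i} {j} (ℕ.s≤s i+j≤n) with ℕP.m≤n⇒m<n∨m≡n i+j≤n
... | inj₁ i+j<n = ∈-++⁺ʳ (antidiagonal n) (∈-triangle⁺ i+j<n)
... | inj₂ refl  = ∈-++⁺ˡ (∈-antidiagonal⁺ i j)

∈-triangle⁻ : ∀ n {ij} → ij ∈ triangle n → proj₁ ij ℕ.+ proj₂ ij ℕ.< n
∈-triangle⁻ (suc n) ij∈ with ∈-++⁻ (antidiagonal n) ij∈
... | inj₁ ij∈ = ℕ.s≤s (ℕP.≤-reflexive (∈-antidiagonal⁻ n ij∈))
... | inj₂ ij∈ = ℕP.m≤n⇒m≤1+n (∈-triangle⁻ n ij∈)

triangle-unique : ∀ n → Unique (triangle n)
triangle-unique zero    = AllPairs.[]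
triangle-unique (suc n) = UniqueP.++⁺ (antidiagonal-unique n) (triangle-unique n)
  λ (ij∈ , ij∈′) → ℕP.<⇒≢ (∈-triangle⁻ n ij∈′) (∈-antidiagonal⁻ n ij∈)

module _ (em : ExcludedMiddle 0ℓ) (𝓡 : CompleteOrderedField) where
  open Theory em 𝓡
  open Fromℤ ℂ-commutativeRing using () renaming (module Solver to ℂS)
  open import Algebra.Properties.CommutativeMonoid.Sum (CommutativeRing.+-commutativeMonoid ℂ-commutativeRing)
    using (sum; sum-permute; sum-cong-≗)
  open import Algebra.Properties.Semiring.Sum (CommutativeRing.semiring ℂ-commutativeRing) using (*-distribˡ-sum)

  private
    module ℂR = CommutativeRing ℂ-commutativeRing

    _≟_ : DecidableEquality A
    a ≟ b = em

  module _ where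
    open Solver

    -- Order and absolute value

    ≤-refl : ∀ {x} → x ≤ x
    ≤-refl = inj₂ refl

    ≤-trans : ∀ {x y z} → x ≤ y → y ≤ z → x ≤ z
    ≤-trans (inj₂ refl) y≤z         = y≤z
    ≤-trans (inj₁ x<y)  (inj₂ refl) = inj₁ x<y
    ≤-trans (inj₁ x<y)  (inj₁ y<z)  = inj₁ (<-trans x<y y<z)

    <-≤-trans : ∀ {x y z} → x < y → y ≤ z → x < z
    <-≤-trans x<y (inj₂ refl) = x<y
    <-≤-trans x<y (inj₁ y<z)  = <-trans x<y y<z

    ≤-<-trans : ∀ {x y z} → x ≤ y → y < z → x < z
    ≤-<-trans (inj₂ refl) y<z = y<z
    ≤-<-trans (inj₁ x<y)  y<z = <-trans x<y y<z

    ≮⇒≥ : ∀ {x y} → ¬ x < y → y ≤ x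
    ≮⇒≥ {x} {y} x≮y with compare x y
    ... | tri< x<y _ _ = ⊥-elim (x≮y x<y)
    ... | tri≈ _ x≡y _ = inj₂ (sym x≡y)
    ... | tri> _ _ y<x = inj₁ y<x

    ≤⇒0≤- : ∀ {x y} → x ≤ y → 0# ≤ y - x
    ≤⇒0≤- (inj₁ x<y)  = inj₁ (<⇒0<- x<y)
    ≤⇒0≤- (inj₂ refl) = inj₂ (sym (-‿inverseʳ _))

    0≤-⇒≤ : ∀ {x y} → 0# ≤ y - x → x ≤ y
    0≤-⇒≤ (inj₁ 0<y-x) = inj₁ (0<-⇒< 0<y-x)
    0≤-⇒≤ {x} {y} (inj₂ 0≡y-x) = inj₂ (trans (sym (+-identityʳ x)) (trans (cong (λ d → x + d) 0≡y-x)
      (solve 2 (λ x y → x :+ (y :- x) := y) refl x y)))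

    +-nonneg : ∀ {a b} → 0# ≤ a → 0# ≤ b → 0# ≤ a + b
    +-nonneg (inj₁ 0<a)  0≤b         = inj₁ (+-pos-nonneg 0<a 0≤b)
    +-nonneg (inj₂ refl) 0≤b         = subst (0# ≤_) (sym (+-identityˡ _)) 0≤b

    *-nonneg : ∀ {a b} → 0# ≤ a → 0# ≤ b → 0# ≤ a * b
    *-nonneg (inj₂ refl) _           = inj₂ (sym (zeroˡ _))
    *-nonneg (inj₁ _)    (inj₂ refl) = inj₂ (sym (zeroʳ _))
    *-nonneg (inj₁ 0<a)  (inj₁ 0<b)  = inj₁ (*-positive 0<a 0<b)

    +-mono-≤ : ∀ {a b c d} → a ≤ b → c ≤ d → a + c ≤ b + d
    +-mono-≤ {a} {b} {c} {d} a≤b c≤d = 0≤-⇒≤ (subst (0# ≤_)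
      (solve 4 (λ a b c d → (b :- a) :+ (d :- c) := (b :+ d) :- (a :+ c)) refl a b c d)
      (+-nonneg (≤⇒0≤- a≤b) (≤⇒0≤- c≤d)))

    +-monoʳ-≤ : ∀ c {a b} → a ≤ b → c + a ≤ c + b
    +-monoʳ-≤ c a≤b = +-mono-≤ ≤-refl a≤b

    *-monoˡ-≤ : ∀ {c a b} → 0# ≤ c → a ≤ b → c * a ≤ c * b
    *-monoˡ-≤ {c} {a} {b} 0≤c a≤b = 0≤-⇒≤ (subst (0# ≤_)
      (solve 3 (λ a b c → c :* (b :- a) := c :* b :- c :* a) refl a b c)
      (*-nonneg 0≤c (≤⇒0≤- a≤b)))

    *-mono-≤ : ∀ {a b c d} → 0# ≤ a → 0# ≤ c → a ≤ b → c ≤ d → a * c ≤ b * d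
    *-mono-≤ {a} {b} {c} {d} 0≤a 0≤c a≤b c≤d = ≤-trans (*-monoˡ-≤ 0≤a c≤d)
      (subst₂ _≤_ (*-comm d a) (*-comm d b) (*-monoˡ-≤ (≤-trans 0≤c c≤d) a≤b))

    *-monoˡ-< : ∀ {c a b} → 0# < c → a < b → c * a < c * b
    *-monoˡ-< {c} {a} {b} 0<c a<b = 0<-⇒< (subst (0# <_)
      (solve 3 (λ a b c → c :* (b :- a) := c :* b :- c :* a) refl a b c)
      (*-positive 0<c (<⇒0<- a<b)))

    x≤x+y : ∀ {x y} → 0# ≤ y → x ≤ x + y
    x≤x+y {x} {y} 0≤y = subst (_≤ x + y) (+-identityʳ x) (+-monoʳ-≤ x 0≤y)

    *½-pos : ∀ {ε} → 0# < ε → 0# < ε * ½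
    *½-pos 0<ε = *-positive 0<ε ½-pos

    -- The multiple behind `fromℕ` sends 1 to `1#` itself rather than to `0# + 1#`, hence the
    -- separate case.
    fromℕ-suc : ∀ n → fromℕ (suc n) ≡ fromℕ n + 1#
    fromℕ-suc zero    = sym (+-identityˡ 1#)
    fromℕ-suc (suc n) = refl

    fromℕ-nonneg : ∀ n → 0# ≤ fromℕ n
    fromℕ-nonneg zero    = ≤-refl
    fromℕ-nonneg (suc n) = subst (0# ≤_) (sym (fromℕ-suc n)) (+-nonneg (fromℕ-nonneg n) (inj₁ 0<1))

    fromℕ-suc-pos : ∀ n → 0# < fromℕ (suc n)
    fromℕ-suc-pos n = subst (0# <_) (sym (fromℕ-suc n)) (+-nonneg-pos (fromℕ-nonneg n) 0<1)

    archimedean : ∀ r → ∃[ n ] r ≤ fromℕ n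
    archimedean r with em {∃[ n ] r ≤ fromℕ n}
    ... | yes bound = bound
    -- Every natural number n satisfies n + 1 ≤ s, so s - 1 is again an upper bound, against the
    -- leastness of s.
    ... | no unbounded = ⊥-elim (irrefl refl (<-≤-trans s-1<s (least (s - 1#) λ { x (n , refl) →
      0≤-⇒≤ (subst (0# ≤_)
        (trans (cong (λ y → s - y) (fromℕ-suc n)) (solve 2 (λ s m → s :- (m :+ con 1ℤ) := s :- con 1ℤ :- m) refl s (fromℕ n)))
        (≤⇒0≤- (upper _ (suc n , refl)))) })))
      where
      IsNatural : ℝ → Set
      IsNatural x = ∃[ n ] x ≡ fromℕ n
      sup = supremum IsNatural (_ , 0 , refl) (r , λ { x (n , refl) → ≮⇒≥ λ r<n → unbounded (n , inj₁ r<n) })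
      s = proj₁ sup
      upper = proj₁ (proj₂ sup)
      least = proj₂ (proj₂ sup)
      s-1<s : s - 1# < s
      s-1<s = 0<-⇒< (subst (0# <_) (solve 1 (λ s → con 1ℤ := s :- (s :- con 1ℤ)) refl s) 0<1)

    ∣_∣ : ℝ → ℝ
    ∣ x ∣ with compare 0# x
    ... | tri< _ _ _ = x
    ... | tri≈ _ _ _ = x
    ... | tri> _ _ _ = - x

    -‿nonneg : ∀ {x} → x ≤ 0# → 0# ≤ - x
    -‿nonneg {x} x≤0 = subst (0# ≤_) (+-identityˡ (- x)) (≤⇒0≤- x≤0)

    ∣∣-cases : ∀ x → (0# ≤ x × ∣ x ∣ ≡ x) ⊎ (0# ≤ - x × ∣ x ∣ ≡ - x)
    ∣∣-cases x with compare 0# x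
    ... | tri< 0<x _ _ = inj₁ (inj₁ 0<x , refl)
    ... | tri≈ _ 0≡x _ = inj₁ (inj₂ 0≡x , refl)
    ... | tri> _ _ x<0 = inj₂ (-‿nonneg (inj₁ x<0) , refl)

    private
      neg≤pos : ∀ {x} → 0# ≤ x → - x ≤ x
      neg≤pos {x} 0≤x = 0≤-⇒≤ (subst (0# ≤_) (solve 1 (λ x → x :+ x := x :- (:- x)) refl x) (+-nonneg 0≤x 0≤x))

      -‿involutive : ∀ x → - (- x) ≡ x
      -‿involutive = solve 1 (λ x → :- (:- x) := x) refl

    ∣∣-nonneg : ∀ x → 0# ≤ ∣ x ∣
    ∣∣-nonneg x with ∣∣-cases x
    ... | inj₁ (0≤x , eq)  = subst (0# ≤_) (sym eq) 0≤x
    ... | inj₂ (0≤-x , eq) = subst (0# ≤_) (sym eq) 0≤-x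

    x≤∣x∣ : ∀ x → x ≤ ∣ x ∣
    x≤∣x∣ x with ∣∣-cases x
    ... | inj₁ (0≤x , eq)  = inj₂ (sym eq)
    ... | inj₂ (0≤-x , eq) = subst₂ _≤_ (-‿involutive x) (sym eq) (neg≤pos 0≤-x)

    -x≤∣x∣ : ∀ x → - x ≤ ∣ x ∣
    -x≤∣x∣ x with ∣∣-cases x
    ... | inj₁ (0≤x , eq)  = subst (- x ≤_) (sym eq) (neg≤pos 0≤x)
    ... | inj₂ (0≤-x , eq) = inj₂ (sym eq)

    ∣∣-least : ∀ {x b} → x ≤ b → - x ≤ b → ∣ x ∣ ≤ b
    ∣∣-least {x} x≤b -x≤b with ∣∣-cases x
    ... | inj₁ (_ , eq) = subst (_≤ _) (sym eq) x≤b
    ... | inj₂ (_ , eq) = subst (_≤ _) (sym eq) -x≤b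

    ∣∣-<-least : ∀ {x b} → x < b → - x < b → ∣ x ∣ < b
    ∣∣-<-least {x} x<b -x<b with ∣∣-cases x
    ... | inj₁ (_ , eq) = subst (_< _) (sym eq) x<b
    ... | inj₂ (_ , eq) = subst (_< _) (sym eq) -x<b

    antisym : ∀ {x y} → x ≤ y → y ≤ x → x ≡ y
    antisym (inj₂ x≡y) _          = x≡y
    antisym (inj₁ _)   (inj₂ y≡x) = sym y≡x
    antisym (inj₁ x<y) (inj₁ y<x) = ⊥-elim (irrefl refl (<-trans x<y y<x))

    ∣x∣≡x : ∀ {x} → 0# ≤ x → ∣ x ∣ ≡ x
    ∣x∣≡x {x} 0≤x = antisym (∣∣-least ≤-refl (neg≤pos 0≤x)) (x≤∣x∣ x)

    ∣-x∣≡∣x∣ : ∀ x → ∣ - x ∣ ≡ ∣ x ∣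
    ∣-x∣≡∣x∣ x = antisym
      (∣∣-least (-x≤∣x∣ x) (subst (_≤ ∣ x ∣) (sym (-‿involutive x)) (x≤∣x∣ x)))
      (∣∣-least (subst (_≤ ∣ - x ∣) (-‿involutive x) (-x≤∣x∣ (- x))) (x≤∣x∣ (- x)))

    ∣x+y∣≤∣x∣+∣y∣ : ∀ x y → ∣ x + y ∣ ≤ ∣ x ∣ + ∣ y ∣
    ∣x+y∣≤∣x∣+∣y∣ x y = ∣∣-least (+-mono-≤ (x≤∣x∣ x) (x≤∣x∣ y))
      (subst (_≤ ∣ x ∣ + ∣ y ∣) (solve 2 (λ x y → :- x :+ :- y := :- (x :+ y)) refl x y) (+-mono-≤ (-x≤∣x∣ x) (-x≤∣x∣ y)))

    ∣x*y∣≤∣x∣*∣y∣ : ∀ x y → ∣ x * y ∣ ≤ ∣ x ∣ * ∣ y ∣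
    ∣x*y∣≤∣x∣*∣y∣ x y with ∣∣-cases x | ∣∣-cases y
    ... | inj₁ (0≤x , p) | inj₁ (0≤y , q) rewrite p | q = ∣∣-least ≤-refl (neg≤pos (*-nonneg 0≤x 0≤y))
    ... | inj₁ (0≤x , p) | inj₂ (0≤y , q) rewrite p | q = ∣∣-least
      (subst (_≤ x * - y) (solve 2 (λ x y → :- (x :* :- y) := x :* y) refl x y) (neg≤pos (*-nonneg 0≤x 0≤y)))
      (inj₂ (solve 2 (λ x y → :- (x :* y) := x :* :- y) refl x y))
    ... | inj₂ (0≤x , p) | inj₁ (0≤y , q) rewrite p | q = ∣∣-least
      (subst (_≤ - x * y) (solve 2 (λ x y → :- (:- x :* y) := x :* y) refl x y) (neg≤pos (*-nonneg 0≤x 0≤y)))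
      (inj₂ (solve 2 (λ x y → :- (x :* y) := :- x :* y) refl x y))
    ... | inj₂ (0≤x , p) | inj₂ (0≤y , q) rewrite p | q = ∣∣-least
      (inj₂ (solve 2 (λ x y → x :* y := :- x :* :- y) refl x y))
      (subst (_≤ - x * - y) (solve 2 (λ x y → :- (:- x :* :- y) := :- (x :* y)) refl x y) (neg≤pos (*-nonneg 0≤x 0≤y)))

    -- The ℓ¹-norm rather than the modulus: it is submultiplicative as well, and
    -- needs no square roots.
    ‖_‖ : ℂ → ℝ
    ‖ z ‖ = ∣ re z ∣ + ∣ im z ∣

    ‖‖-nonneg : ∀ z → 0# ≤ ‖ z ‖
    ‖‖-nonneg z = +-nonneg (∣∣-nonneg (re z)) (∣∣-nonneg (im z))

    ∣re∣≤‖‖ : ∀ z → ∣ re z ∣ ≤ ‖ z ‖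
    ∣re∣≤‖‖ z = x≤x+y (∣∣-nonneg (im z))

    ∣im∣≤‖‖ : ∀ z → ∣ im z ∣ ≤ ‖ z ‖
    ∣im∣≤‖‖ z = subst (∣ im z ∣ ≤_) (+-comm _ _) (x≤x+y (∣∣-nonneg (re z)))

    ‖+‖ : ∀ z w → ‖ z +ᶜ w ‖ ≤ ‖ z ‖ + ‖ w ‖
    ‖+‖ (a +i b) (c +i d) = subst (∣ a + c ∣ + ∣ b + d ∣ ≤_)
      (solve 4 (λ a b c d → (a :+ c) :+ (b :+ d) := (a :+ b) :+ (c :+ d)) refl (∣ a ∣) (∣ b ∣) (∣ c ∣) (∣ d ∣))
      (+-mono-≤ (∣x+y∣≤∣x∣+∣y∣ a c) (∣x+y∣≤∣x∣+∣y∣ b d))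

    ‖*‖ : ∀ z w → ‖ z *ᶜ w ‖ ≤ ‖ z ‖ * ‖ w ‖
    ‖*‖ (a +i b) (c +i d) = subst (∣ a * c - b * d ∣ + ∣ a * d + b * c ∣ ≤_)
      (solve 4 (λ a b c d → (a :* c :+ b :* d) :+ (a :* d :+ b :* c) := (a :+ b) :* (c :+ d)) refl (∣ a ∣) (∣ b ∣) (∣ c ∣) (∣ d ∣))
      (+-mono-≤
        (≤-trans (∣x+y∣≤∣x∣+∣y∣ (a * c) (- (b * d)))
          (+-mono-≤ (∣x*y∣≤∣x∣*∣y∣ a c) (subst (_≤ ∣ b ∣ * ∣ d ∣) (sym (∣-x∣≡∣x∣ (b * d))) (∣x*y∣≤∣x∣*∣y∣ b d))))
        (≤-trans (∣x+y∣≤∣x∣+∣y∣ (a * d) (b * c)) (+-mono-≤ (∣x*y∣≤∣x∣*∣y∣ a d) (∣x*y∣≤∣x∣*∣y∣ b c))))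

    ‖-‖ : ∀ z → ‖ -ᶜ z ‖ ≡ ‖ z ‖
    ‖-‖ (a +i b) = cong₂ _+_ (∣-x∣≡∣x∣ a) (∣-x∣≡∣x∣ b)

    ‖ofℝ‖ : ∀ {x} → 0# ≤ x → ‖ ofℝ x ‖ ≤ x
    ‖ofℝ‖ {x} 0≤x = subst (‖ ofℝ x ‖ ≤_) (+-identityʳ x)
      (+-mono-≤ (inj₂ (∣x∣≡x 0≤x)) (inj₂ (∣x∣≡x ≤-refl)))

    -- Expanding the square of ∣a∣ + ∣b∣ leaves a nonnegative cross term beyond a² + b².
    ‖‖<⇒∣∣< : ∀ z {ε} → 0# < ε → ‖ z ‖ < ε → ∣ z ∣< ε
    ‖‖<⇒∣∣< (a +i b) {ε} 0<ε ‖z‖<ε = ≤-<-trans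
      (0≤-⇒≤ (subst (0# ≤_)
        (solve 4 (λ a b p q → (p :* p :- a :* a) :+ (q :* q :- b :* b) :+ (p :* q :+ p :* q)
                           := (p :+ q) :* (p :+ q) :- (a :* a :+ b :* b)) refl a b (∣ a ∣) (∣ b ∣))
        (+-nonneg (+-nonneg (square a) (square b)) (+-nonneg cross cross))))
      (≤-<-trans (*-monoˡ-≤ (‖‖-nonneg (a +i b)) (inj₁ ‖z‖<ε))
        (subst₂ _<_ (*-comm _ _) refl (*-monoˡ-< 0<ε ‖z‖<ε)))
      where
      cross : 0# ≤ ∣ a ∣ * ∣ b ∣
      cross = *-nonneg (∣∣-nonneg a) (∣∣-nonneg b)
      square : ∀ x → 0# ≤ ∣ x ∣ * ∣ x ∣ - x * x
      square x = ≤⇒0≤- (≤-trans (x≤∣x∣ (x * x)) (∣x*y∣≤∣x∣*∣y∣ x x))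

    sq-<⇒∣∣< : ∀ {x ε} → 0# < ε → x * x < ε * ε → ∣ x ∣ < ε
    sq-<⇒∣∣< {x} {ε} 0<ε x²<ε² = ∣∣-<-least (sq-<⇒< 0<ε x²<ε²)
      (sq-<⇒< 0<ε (subst (_< ε * ε) (solve 1 (λ x → x :* x := (:- x) :* (:- x)) refl x) x²<ε²))

    ∣-∣<⇒‖-‖< : ∀ z w {ε} → 0# < ε → ∣ z -ᶜ w ∣< (ε * ½) → ‖ z -ᶜ w ‖ < ε
    ∣-∣<⇒‖-‖< z@(_ +i _) w@(_ +i _) {ε} 0<ε near = subst (‖ z -ᶜ w ‖ <_) (½+½ ε) (+-mono-<
      (sq-<⇒∣∣< (*½-pos 0<ε) (re-∣< z w near)) (sq-<⇒∣∣< (*½-pos 0<ε) (im-∣< z w near)))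

    -- Unconditional sums

    -- Deduplicated, since a `FiniteSubset` is a list without repetitions.
    _∪_ : List A → List A → List A
    as ∪ bs = deduplicate _≟_ (as List.++ bs)

    ⊆-∪ˡ : ∀ {as bs : List A} → as ⊆ as ∪ bs
    ⊆-∪ˡ a∈as = ∈-deduplicate⁺ _≟_ (∈-++⁺ˡ a∈as)

    ⊆-∪ʳ : ∀ (as : List A) {bs} → bs ⊆ as ∪ bs
    ⊆-∪ʳ as b∈bs = ∈-deduplicate⁺ _≟_ (∈-++⁺ʳ as b∈bs)

    ∪-finite : ∀ {S : Pred A 0ℓ} {as bs} → All S as → All S bs → FiniteSubset S (as ∪ bs)
    ∪-finite {as = as} {bs} as⊆S bs⊆S =
      deduplicate-! _≟_ (as List.++ bs) , AllP.deduplicate⁺ _≟_ (AllP.++⁺ as⊆S bs⊆S)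

    sumOver-++ : ∀ (f : A → ℂ) as {bs} → sumOver f (as List.++ bs) ≡ sumOver f as +ᶜ sumOver f bs
    sumOver-++ f []       = sym (ℂR.+-identityˡ _)
    sumOver-++ f (a ∷ as) = trans (cong (f a +ᶜ_) (sumOver-++ f as)) (sym (ℂR.+-assoc _ _ _))

    sumOver-cong-∈ : ∀ {f g : A → ℂ} as → (∀ {a} → a ∈ as → f a ≡ g a) → sumOver f as ≡ sumOver g as
    sumOver-cong-∈ []       f≗g = refl
    sumOver-cong-∈ (a ∷ as) f≗g = cong₂ _+ᶜ_ (f≗g (here refl)) (sumOver-cong-∈ as (f≗g ∘ there))

    sumOver-cong : ∀ {f g : A → ℂ} → (∀ a → f a ≡ g a) → ∀ as → sumOver f as ≡ sumOver g as
    sumOver-cong f≗g as = sumOver-cong-∈ as (λ {a} _ → f≗g a)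

    sumOver-map : ∀ (f : B → ℂ) (e : A → B) as → sumOver f (map e as) ≡ sumOver (f ∘ e) as
    sumOver-map f e []       = refl
    sumOver-map f e (a ∷ as) = cong (f (e a) +ᶜ_) (sumOver-map f e as)

    sumOver-*ˡ : ∀ c (f : A → ℂ) as → sumOver (λ a → c *ᶜ f a) as ≡ c *ᶜ sumOver f as
    sumOver-*ˡ c f []       = sym (ℂR.zeroʳ c)
    sumOver-*ˡ c f (a ∷ as) = trans (cong (c *ᶜ f a +ᶜ_) (sumOver-*ˡ c f as)) (sym (ℂR.distribˡ c _ _))

    sumOver-+ : ∀ (f g : A → ℂ) as → sumOver (λ a → f a +ᶜ g a) as ≡ sumOver f as +ᶜ sumOver g as
    sumOver-+ f g []       = sym (ℂR.+-identityˡ 0ᶜ)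
    sumOver-+ f g (a ∷ as) = trans (cong (f a +ᶜ g a +ᶜ_) (sumOver-+ f g as))
      (ℂS.solve 4 (λ x y s t → (x ℂS.:+ y) ℂS.:+ (s ℂS.:+ t) ℂS.:= (x ℂS.:+ s) ℂS.:+ (y ℂS.:+ t))
        refl (f a) (g a) (sumOver f as) (sumOver g as))

    sumOver-cartesianProduct : ∀ (f : A → ℂ) (g : B → ℂ) as bs →
      sumOver (λ (a , b) → f a *ᶜ g b) (cartesianProduct as bs) ≡ sumOver f as *ᶜ sumOver g bs
    sumOver-cartesianProduct f g []       bs = sym (ℂR.zeroˡ _)
    sumOver-cartesianProduct f g (a ∷ as) bs = trans (sumOver-++ _ (map (a ,_) bs))
      (trans (cong₂ _+ᶜ_ (trans (sumOver-map _ (a ,_) bs) (sumOver-*ˡ (f a) g bs)) (sumOver-cartesianProduct f g as bs))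
             (sym (ℂR.distribʳ _ (f a) _)))

    sumℝ : (A → ℝ) → List A → ℝ
    sumℝ f = foldr (λ a s → f a + s) 0#

    sumℝ-++ : ∀ (f : A → ℝ) as {bs} → sumℝ f (as List.++ bs) ≡ sumℝ f as + sumℝ f bs
    sumℝ-++ f []       = sym (+-identityˡ _)
    sumℝ-++ f (a ∷ as) = trans (cong (λ s → f a + s) (sumℝ-++ f as)) (sym (+-assoc _ _ _))

    sumℝ-map : ∀ (f : B → ℝ) (e : A → B) as → sumℝ f (map e as) ≡ sumℝ (f ∘ e) as
    sumℝ-map f e []       = refl
    sumℝ-map f e (a ∷ as) = cong (λ s → f (e a) + s) (sumℝ-map f e as)

    sumℝ-*ˡ : ∀ c (f : A → ℝ) as → sumℝ (λ a → c * f a) as ≡ c * sumℝ f as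
    sumℝ-*ˡ c f []       = sym (zeroʳ c)
    sumℝ-*ˡ c f (a ∷ as) = trans (cong (λ s → c * f a + s) (sumℝ-*ˡ c f as)) (sym (distribˡ c _ _))

    sumℝ-+ : ∀ (f g : A → ℝ) as → sumℝ (λ a → f a + g a) as ≡ sumℝ f as + sumℝ g as
    sumℝ-+ f g []       = sym (+-identityˡ 0#)
    sumℝ-+ f g (a ∷ as) = trans (cong (λ s → f a + g a + s) (sumℝ-+ f g as))
      (solve 4 (λ x y s t → (x :+ y) :+ (s :+ t) := (x :+ s) :+ (y :+ t)) refl (f a) (g a) (sumℝ f as) (sumℝ g as))

    sumℝ-mono : ∀ {f g : A → ℝ} → (∀ a → f a ≤ g a) → ∀ as → sumℝ f as ≤ sumℝ g as
    sumℝ-mono f≤g []       = ≤-refl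
    sumℝ-mono f≤g (a ∷ as) = +-mono-≤ (f≤g a) (sumℝ-mono f≤g as)

    sumℝ-nonneg : ∀ {f : A → ℝ} → (∀ a → 0# ≤ f a) → ∀ as → 0# ≤ sumℝ f as
    sumℝ-nonneg 0≤f []       = ≤-refl
    sumℝ-nonneg 0≤f (a ∷ as) = +-nonneg (0≤f a) (sumℝ-nonneg 0≤f as)

    -- Each element of `as` is cut out of `bs` at one occurrence. As `as` has no repetitions, its
    -- remaining elements survive the cut.
    sumℝ-⊆ : ∀ {f : A → ℝ} → (∀ a → 0# ≤ f a) → ∀ {as bs} → Unique as → as ⊆ bs → sumℝ f as ≤ sumℝ f bs
    sumℝ-⊆ 0≤f {[]} {bs} as! as⊆bs = sumℝ-nonneg 0≤f bs
    sumℝ-⊆ {f = f} 0≤f {a ∷ as} (a∉as AllPairs.∷ as!) as⊆bs with ∈-∃++ (as⊆bs (here refl))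
    ... | ys , zs , refl = subst (f a + sumℝ f as ≤_)
      (trans (cong (λ s → f a + s) (sumℝ-++ f ys)) (trans
        (solve 3 (λ x s t → x :+ (s :+ t) := s :+ (x :+ t)) refl (f a) (sumℝ f ys) (sumℝ f zs))
        (sym (sumℝ-++ f ys))))
      (+-monoʳ-≤ (f a) (sumℝ-⊆ 0≤f as! as⊆))
      where
      as⊆ : as ⊆ ys List.++ zs
      as⊆ x∈as with ∈-++⁻ ys (as⊆bs (there x∈as))
      ... | inj₁ x∈ys         = ∈-++⁺ˡ x∈ys
      ... | inj₂ (here refl)  = ⊥-elim (All.lookup a∉as x∈as refl)
      ... | inj₂ (there x∈zs) = ∈-++⁺ʳ ys x∈zs

    sumℝ-cartesianProduct : ∀ (f : A → ℝ) (g : B → ℝ) as bs →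
      sumℝ (λ (a , b) → f a * g b) (cartesianProduct as bs) ≡ sumℝ f as * sumℝ g bs
    sumℝ-cartesianProduct f g []       bs = sym (zeroˡ _)
    sumℝ-cartesianProduct f g (a ∷ as) bs = trans (sumℝ-++ _ (map (a ,_) bs))
      (trans (cong₂ _+_ (trans (sumℝ-map _ (a ,_) bs) (sumℝ-*ˡ (f a) g bs)) (sumℝ-cartesianProduct f g as bs))
             (sym (distribʳ _ (f a) _)))

    sumOver-ofℝ : ∀ (f : A → ℝ) as → sumOver (ofℝ ∘ f) as ≡ ofℝ (sumℝ f as)
    sumOver-ofℝ f []       = refl
    sumOver-ofℝ f (a ∷ as) = trans (cong (ofℝ (f a) +ᶜ_) (sumOver-ofℝ f as)) (ℂ-ext refl (+-identityˡ 0#))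

    re-sumOver : ∀ (f : A → ℂ) as → re (sumOver f as) ≡ sumℝ (re ∘ f) as
    re-sumOver f []       = refl
    re-sumOver f (a ∷ as) = trans (re-+ (f a) (sumOver f as)) (cong (λ s → re (f a) + s) (re-sumOver f as))
      where
      re-+ : ∀ z w → re (z +ᶜ w) ≡ re z + re w
      re-+ (_ +i _) (_ +i _) = refl

    im-sumOver : ∀ (f : A → ℂ) as → im (sumOver f as) ≡ sumℝ (im ∘ f) as
    im-sumOver f []       = refl
    im-sumOver f (a ∷ as) = trans (im-+ (f a) (sumOver f as)) (cong (λ s → im (f a) + s) (im-sumOver f as))
      where
      im-+ : ∀ z w → im (z +ᶜ w) ≡ im z + im w
      im-+ (_ +i _) (_ +i _) = refl

    ‖-‖-triangle : ∀ z w u → ‖ z -ᶜ u ‖ ≤ ‖ z -ᶜ w ‖ + ‖ w -ᶜ u ‖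
    ‖-‖-triangle z w u = subst (λ v → ‖ v ‖ ≤ ‖ z -ᶜ w ‖ + ‖ w -ᶜ u ‖)
      (eq z w u) (‖+‖ (z -ᶜ w) (w -ᶜ u))
      where
      eq : ∀ z w u → (z -ᶜ w) +ᶜ (w -ᶜ u) ≡ z -ᶜ u
      eq (a +i b) (c +i d) (e +i f) = ℂ-ext (solve 3 (λ a c e → (a :- c) :+ (c :- e) := a :- e) refl a c e)
                                            (solve 3 (λ a c e → (a :- c) :+ (c :- e) := a :- e) refl b d f)

    ‖-‖-sym : ∀ z w → ‖ z -ᶜ w ‖ ≡ ‖ w -ᶜ z ‖
    ‖-‖-sym z@(a +i b) w@(c +i d) = trans (cong ‖_‖ eq) (‖-‖ (w -ᶜ z))
      where
      eq : z -ᶜ w ≡ -ᶜ (w -ᶜ z)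
      eq = ℂ-ext (solve 2 (λ a c → a :- c := :- (c :- a)) refl a c) (solve 2 (λ a c → a :- c := :- (c :- a)) refl b d)

    -ᶜ≡+ᶜ-ᶜ : ∀ z w → z -ᶜ w ≡ z +ᶜ (-ᶜ w)
    -ᶜ≡+ᶜ-ᶜ (_ +i _) (_ +i _) = refl

    -- `HasSum` compares squared moduli; `approximate` and `converges` translate to and from the
    -- ℓ¹-norm, in which all later estimates are made.
    approximate : ∀ {S : Pred A 0ℓ} {f s} → HasSum S f s → ∀ ε → 0# < ε → ∃[ as ] FiniteSubset S as ×
                  (∀ bs → FiniteSubset S bs → as ⊆ bs → ‖ sumOver f bs -ᶜ s ‖ < ε)
    approximate {f = f} {s} Σ≡s ε 0<ε with Σ≡s (ε * ½) (*½-pos 0<ε)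
    ... | as , as-finite , beyond = as , as-finite , λ bs bs-finite as⊆bs → ∣-∣<⇒‖-‖< (sumOver f bs) s 0<ε (beyond bs bs-finite as⊆bs)

    converges : ∀ {S : Pred A 0ℓ} {f s} → (∀ ε → 0# < ε → ∃[ as ] FiniteSubset S as ×
                  (∀ bs → FiniteSubset S bs → as ⊆ bs → ‖ sumOver f bs -ᶜ s ‖ < ε)) → HasSum S f s
    converges {f = f} {s} near ε 0<ε with near ε 0<ε
    ... | as , as-finite , beyond = as , as-finite , λ bs bs-finite as⊆bs →
      ‖‖<⇒∣∣< (sumOver f bs -ᶜ s) 0<ε (beyond bs bs-finite as⊆bs)

    HasSum-cong : ∀ {S : Pred A 0ℓ} {f g s} → (∀ a → f a ≡ g a) → HasSum S f s → HasSum S g s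
    HasSum-cong {s = s} f≗g Σ≡s ε 0<ε with Σ≡s ε 0<ε
    ... | as , as-finite , beyond = as , as-finite , λ bs bs-finite as⊆bs →
      subst (λ t → ∣ t -ᶜ s ∣< ε) (sumOver-cong f≗g bs) (beyond bs bs-finite as⊆bs)

    private
      squash : ∀ z w → (∀ ε → 0# < ε → ‖ z -ᶜ w ‖ < ε) → z ≡ w
      -- `close` asks for a point near both numbers; the coordinate of z itself is one.
      squash z w near = ℂ-ext
        (close λ ε 0<ε → re z , (subst (_< ε * ε) (sym (zero-sq (re z))) (*-positive 0<ε 0<ε)) , re-∣< z w (‖‖<⇒∣∣< (z -ᶜ w) 0<ε (near ε 0<ε)))
        (close λ ε 0<ε → im z , (subst (_< ε * ε) (sym (zero-sq (im z))) (*-positive 0<ε 0<ε)) , im-∣< z w (‖‖<⇒∣∣< (z -ᶜ w) 0<ε (near ε 0<ε)))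
        where
        zero-sq : ∀ x → (x - x) * (x - x) ≡ 0#
        zero-sq = solve 1 (λ x → (x :- x) :* (x :- x) := con 0ℤ) refl

    -- Once a sum is known to exist, it can be identified along any convenient cofinal collection of
    -- finite sets: rectangles, triangles or initial segments.
    HasSum-cofinal : ∀ {S : Pred A 0ℓ} {f s t} → HasSum S f s →
      (∀ ε → 0# < ε → ∀ as → FiniteSubset S as → ∃[ bs ] FiniteSubset S bs × as ⊆ bs × ‖ sumOver f bs -ᶜ t ‖ < ε) →
      s ≡ t
    HasSum-cofinal {f = f} {s} {t} Σ≡s cofinal = squash s t near
      where
      near : ∀ ε → 0# < ε → ‖ s -ᶜ t ‖ < ε
      near ε 0<ε with approximate Σ≡s (ε * ½) (*½-pos 0<ε)
      ... | as , as-finite , beyond with cofinal (ε * ½) (*½-pos 0<ε) as as-finite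
      ... | bs , bs-finite , as⊆bs , bs≈t = ≤-<-trans (‖-‖-triangle s (sumOver f bs) t)
        (subst (‖ s -ᶜ sumOver f bs ‖ + ‖ sumOver f bs -ᶜ t ‖ <_) (½+½ ε)
          (+-mono-< (subst (_< ε * ½) (‖-‖-sym (sumOver f bs) s) (beyond bs bs-finite as⊆bs)) bs≈t))

    -- The condition on c lets the two errors of ε/2 add up without rescaling; the coefficients that
    -- occur are -1, i and -i.
    HasSum-linear : ∀ {S : Pred A 0ℓ} {f g s t} c → ‖ c ‖ ≤ 1# → HasSum S f s → HasSum S g t →
                    HasSum S (λ a → f a +ᶜ c *ᶜ g a) (s +ᶜ c *ᶜ t)
    HasSum-linear {A} {S} {f} {g} {s} {t} c ‖c‖≤1 Σ≡s Σ≡t = converges near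
      where
      rearrange : ∀ x y → (x +ᶜ c *ᶜ y) -ᶜ (s +ᶜ c *ᶜ t) ≡ (x -ᶜ s) +ᶜ c *ᶜ (y -ᶜ t)
      rearrange x y = trans (-ᶜ≡+ᶜ-ᶜ _ _) (trans
        (ℂS.solve 5 (λ x y s t c → (x ℂS.:+ c ℂS.:* y) ℂS.:- (s ℂS.:+ c ℂS.:* t) ℂS.:= (x ℂS.:- s) ℂS.:+ c ℂS.:* (y ℂS.:- t)) refl x y s t c)
        (sym (cong₂ (λ d e → d +ᶜ c *ᶜ e) (-ᶜ≡+ᶜ-ᶜ x s) (-ᶜ≡+ᶜ-ᶜ y t))))
      near : ∀ ε → 0# < ε → ∃[ as ] FiniteSubset S as ×
             (∀ bs → FiniteSubset S bs → as ⊆ bs → ‖ sumOver (λ a → f a +ᶜ c *ᶜ g a) bs -ᶜ (s +ᶜ c *ᶜ t) ‖ < ε)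
      near ε 0<ε with approximate Σ≡s (ε * ½) (*½-pos 0<ε) | approximate Σ≡t (ε * ½) (*½-pos 0<ε)
      ... | as , (_ , as⊆S) , beyond-as | bs , (_ , bs⊆S) , beyond-bs = as ∪ bs , ∪-finite as⊆S bs⊆S , λ cs cs-finite ∪⊆cs →
        let x = sumOver f cs ; y = sumOver g cs in
        subst₂ (λ w η → ‖ w ‖ < η)
          (sym (trans (cong (_-ᶜ (s +ᶜ c *ᶜ t)) (trans (sumOver-+ f _ cs) (cong (x +ᶜ_) (sumOver-*ˡ c g cs)))) (rearrange x y)))
          (½+½ ε)
          (≤-<-trans (≤-trans (‖+‖ (x -ᶜ s) (c *ᶜ (y -ᶜ t)))
              (+-monoʳ-≤ (‖ x -ᶜ s ‖) (≤-trans (‖*‖ c (y -ᶜ t)) (subst (‖ c ‖ * ‖ y -ᶜ t ‖ ≤_) (*-identityˡ (‖ y -ᶜ t ‖))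
                 (*-mono-≤ (‖‖-nonneg c) (‖‖-nonneg (y -ᶜ t)) ‖c‖≤1 ≤-refl)))))
            (+-mono-< (beyond-as cs cs-finite (λ a∈ → ∪⊆cs (⊆-∪ˡ a∈))) (beyond-bs cs cs-finite (λ b∈ → ∪⊆cs (⊆-∪ʳ as b∈)))))

    ‖ofℝ-ofℝ‖ : ∀ {x y} → x ≤ y → ‖ ofℝ x -ᶜ ofℝ y ‖ ≤ y - x
    ‖ofℝ-ofℝ‖ {x} {y} x≤y = subst (_≤ y - x)
      (trans (cong ‖_‖ {ofℝ (y - x)} {ofℝ y -ᶜ ofℝ x} (ℂ-ext refl (sym (-‿inverseʳ 0#)))) (‖-‖-sym (ofℝ y) (ofℝ x)))
      (‖ofℝ‖ (≤⇒0≤- x≤y))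

    -- Absolute boundedness and summability

    AbsolutelyBounded : Pred A 0ℓ → (A → ℂ) → Set
    AbsolutelyBounded S f = ∃[ b ] ∀ as → FiniteSubset S as → sumℝ (‖_‖ ∘ f) as ≤ b

    -- The sum is the supremum of the finite partial sums. Some partial sum exceeds s - ε, and by
    -- nonnegativity every larger one lies between it and s.
    HasSum-nonneg : ∀ {S : Pred A 0ℓ} {g : A → ℝ} → (∀ a → 0# ≤ g a) →
                    (∃[ b ] ∀ as → FiniteSubset S as → sumℝ g as ≤ b) → ∃[ s ] HasSum S (ofℝ ∘ g) s
    HasSum-nonneg {A} {S} {g} 0≤g (b , bounded) = ofℝ s , converges near
      where
      PartialSum : ℝ → Set
      PartialSum x = ∃[ as ] FiniteSubset S as × x ≡ sumℝ g as
      sup = supremum PartialSum (0# , [] , (AllPairs.[] , []) , refl) (b , λ { x (as , as-finite , refl) → bounded as as-finite })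
      s = proj₁ sup
      upper = proj₁ (proj₂ sup)
      least = proj₂ (proj₂ sup)
      near : ∀ ε → 0# < ε → ∃[ as ] FiniteSubset S as ×
             (∀ bs → FiniteSubset S bs → as ⊆ bs → ‖ sumOver (ofℝ ∘ g) bs -ᶜ ofℝ s ‖ < ε)
      near ε 0<ε with em {∃[ as ] FiniteSubset S as × s - ε < sumℝ g as}
      ... | no none = ⊥-elim (irrefl refl (<-≤-trans
              (0<-⇒< (subst (0# <_) (solve 2 (λ s ε → ε := s :- (s :- ε)) refl s ε) 0<ε))
              (least (s - ε) λ { x (as , as-finite , refl) → ≮⇒≥ λ lt → none (as , as-finite , lt) })))
      ... | yes (as , (as! , as⊆S) , s-ε<as) = as , (as! , as⊆S) , λ bs bs-finite as⊆bs →
        let x = sumℝ g bs in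
        ≤-<-trans
          (subst (λ z → ‖ z -ᶜ ofℝ s ‖ ≤ s - x) (sym (sumOver-ofℝ g bs)) (‖ofℝ-ofℝ‖ (upper x (bs , bs-finite , refl))))
          (0<-⇒< (subst (0# <_) (solve 3 (λ x s ε → x :- (s :- ε) := ε :- (s :- x)) refl x s ε)
            (<⇒0<- (<-≤-trans s-ε<as (sumℝ-⊆ 0≤g as! as⊆bs)))))

    -- A real number x is the difference of the nonnegative numbers ∣x∣ + x and ∣x∣. Applied to real
    -- and imaginary parts, this writes the family as a combination of four nonnegative ones, with
    -- coefficients 1, -1, i and -i.
    bounded⇒summable : ∀ {S : Pred A 0ℓ} {f : A → ℂ} → AbsolutelyBounded S f → ∃[ s ] HasSum S f s
    bounded⇒summable {A} {S} {f} (b , bounded) = _ , HasSum-cong (λ a → sym (decomposition (f a)))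
      (HasSum-linear (-ᶜ 𝕚) (subst (_≤ 1#) (sym (‖-‖ 𝕚)) ‖𝕚‖≤1)
        (HasSum-linear 𝕚 ‖𝕚‖≤1
          (HasSum-linear (-ᶜ 1ᶜ) (subst (_≤ 1#) (sym (‖-‖ 1ᶜ)) ‖1‖≤1)
            (proj₂ (part λ z → twice (re z) (∣re∣≤‖‖ z)))
            (proj₂ (part λ z → once (re z) (∣re∣≤‖‖ z))))
          (proj₂ (part λ z → twice (im z) (∣im∣≤‖‖ z))))
        (proj₂ (part λ z → once (im z) (∣im∣≤‖‖ z))))
      where
      ‖1‖≤1 : ‖ 1ᶜ ‖ ≤ 1#
      ‖1‖≤1 = ‖ofℝ‖ (inj₁ 0<1)
      ‖𝕚‖≤1 : ‖ 𝕚 ‖ ≤ 1#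
      ‖𝕚‖≤1 = subst (_≤ 1#) (+-comm (∣ 1# ∣) (∣ 0# ∣)) ‖1‖≤1

      -- The factor 2 accommodates ∣x∣ + x, which can be as large as 2∣x∣.
      part : {q : ℂ → ℝ} → (∀ z → 0# ≤ q z × q z ≤ fromℕ 2 * ‖ z ‖) → ∃[ s ] HasSum S (λ a → ofℝ (q (f a))) s
      part dominated = HasSum-nonneg (λ a → proj₁ (dominated (f a))) (fromℕ 2 * b , λ as as-finite →
        ≤-trans (sumℝ-mono (λ a → proj₂ (dominated (f a))) as)
          (subst (_≤ fromℕ 2 * b) (sym (sumℝ-*ˡ _ _ as)) (*-monoˡ-≤ (fromℕ-nonneg 2) (bounded as as-finite))))

      x+x≡2x : ∀ x → x + x ≡ fromℕ 2 * x
      x+x≡2x = solve 1 (λ x → x :+ x := con (+ 2) :* x) refl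

      once : ∀ x {y} → ∣ x ∣ ≤ y → 0# ≤ ∣ x ∣ × ∣ x ∣ ≤ fromℕ 2 * y
      once x {y} ∣x∣≤y = ∣∣-nonneg x , ≤-trans ∣x∣≤y (subst (y ≤_) (x+x≡2x y) (x≤x+y (≤-trans (∣∣-nonneg x) ∣x∣≤y)))

      twice : ∀ x {y} → ∣ x ∣ ≤ y → 0# ≤ ∣ x ∣ + x × ∣ x ∣ + x ≤ fromℕ 2 * y
      twice x {y} ∣x∣≤y =
        subst (0# ≤_) (solve 2 (λ p x → p :- (:- x) := p :+ x) refl (∣ x ∣) x) (≤⇒0≤- (-x≤∣x∣ x)) ,
        subst (∣ x ∣ + x ≤_) (x+x≡2x y) (+-mono-≤ ∣x∣≤y (≤-trans (x≤∣x∣ x) ∣x∣≤y))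

      decomposition : ∀ z → z ≡ ofℝ (∣ re z ∣ + re z) +ᶜ (-ᶜ 1ᶜ) *ᶜ ofℝ ∣ re z ∣
                                +ᶜ 𝕚 *ᶜ ofℝ (∣ im z ∣ + im z) +ᶜ (-ᶜ 𝕚) *ᶜ ofℝ ∣ im z ∣
      decomposition (a +i b) = ℂ-ext
        (solve 4 (λ a b p q → a := (p :+ a) :+ (:- con 1ℤ :* p :- :- con 0ℤ :* con 0ℤ) :+ (con 0ℤ :* (q :+ b) :- con 1ℤ :* con 0ℤ)
                                    :+ (:- con 0ℤ :* q :- :- con 1ℤ :* con 0ℤ)) refl a b (∣ a ∣) (∣ b ∣))
        (solve 4 (λ a b p q → b := con 0ℤ :+ (:- con 1ℤ :* con 0ℤ :+ :- con 0ℤ :* p) :+ (con 0ℤ :* con 0ℤ :+ con 1ℤ :* (q :+ b))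
                                    :+ (:- con 0ℤ :* con 0ℤ :+ :- con 1ℤ :* q)) refl a b (∣ a ∣) (∣ b ∣))

    -- The sum of absolute values is the sum over the entries with r ≥ 0 minus the sum over the
    -- others. Both are sums over filtered sublists, so the bound b is spent twice.
    sumℝ-∣∣ : ∀ {b} (r : A → ℝ) as → (∀ {P : Pred A 0ℓ} → ∣ sumℝ r (filter (λ a → em {P a}) as) ∣ ≤ b) →
              sumℝ (λ a → ∣ r a ∣) as ≤ b + b
    sumℝ-∣∣ {A} {b} r as filter≤ = subst (_≤ b + b) (sym (split-signs as))
      (+-mono-≤ (≤-trans (x≤∣x∣ _) filter≤) (≤-trans (-x≤∣x∣ _) filter≤))
      where
      nonneg? : Decidable (λ a → 0# ≤ r a)
      nonneg? a = em
      neg? : Decidable (λ a → ¬ 0# ≤ r a)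
      neg? a = em
      split-signs : ∀ as → sumℝ (λ a → ∣ r a ∣) as ≡ sumℝ r (filter nonneg? as) - sumℝ r (filter neg? as)
      split-signs []       = sym (-‿inverseʳ 0#)
      split-signs (a ∷ as) = [ nonneg , neg ]′ (toSum (nonneg? a))
        where
        p = sumℝ r (filter nonneg? as)
        n = sumℝ r (filter neg? as)
        Step = ∣ r a ∣ + sumℝ (λ a → ∣ r a ∣) as ≡ sumℝ r (filter nonneg? (a ∷ as)) - sumℝ r (filter neg? (a ∷ as))
        nonneg : 0# ≤ r a → Step
        nonneg 0≤ra = trans (cong₂ _+_ (∣x∣≡x 0≤ra) (split-signs as)) (trans
          (solve 3 (λ x p n → x :+ (p :- n) := (x :+ p) :- n) refl (r a) p n)
          (sym (cong₂ (λ xs ys → sumℝ r xs - sumℝ r ys) (filter-accept nonneg? 0≤ra) (filter-reject neg? λ ¬0≤ra → ¬0≤ra 0≤ra))))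
        neg : ¬ 0# ≤ r a → Step
        neg ¬0≤ra = trans
          (cong₂ _+_ (trans (sym (∣-x∣≡∣x∣ (r a))) (∣x∣≡x (-‿nonneg (≮⇒≥ λ 0<ra → ¬0≤ra (inj₁ 0<ra))))) (split-signs as)) (trans
          (solve 3 (λ x p n → :- x :+ (p :- n) := p :- (x :+ n)) refl (r a) p n)
          (sym (cong₂ (λ xs ys → sumℝ r xs - sumℝ r ys) (filter-reject nonneg? ¬0≤ra) (filter-accept neg? ¬0≤ra))))

    -- Partial sums avoiding the set as of the Cauchy criterion are bounded, and
    -- the positive and negative real and imaginary parts are such partial sums.
    summable⇒bounded : ∀ {S : Pred A 0ℓ} {f : A → ℂ} {s} → HasSum S f s → AbsolutelyBounded S f
    summable⇒bounded {A} {S} {f} {s} Σ≡s with approximate Σ≡s 1# 0<1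
    ... | as , (as! , as⊆S) , beyond = sumℝ (‖_‖ ∘ f) as + ((two + two) + (two + two)) , bounded
      where
      -- A sum over a list disjoint from `as` is a difference of two partial sums, each within 1 of
      -- s. The final constant is four times this: a factor 2 for the two signs, and another for
      -- real and imaginary parts.
      two = 1# + 1#
      Away : Pred (List A) 0ℓ
      Away ds = FiniteSubset S ds × (∀ {d} → d ∈ ds → d ∉ as)

      away-bounded : ∀ ds → Away ds → ‖ sumOver f ds ‖ ≤ two
      away-bounded ds ((ds! , ds⊆S) , ds#as) = subst (λ z → ‖ z ‖ ≤ two) difference
        (≤-trans (‖-‖-triangle (sumOver f (as List.++ ds)) s (sumOver f as)) (+-mono-≤
          (inj₁ (beyond (as List.++ ds) (UniqueP.++⁺ as! ds! (λ (a∈as , a∈ds) → ds#as a∈ds a∈as) , AllP.++⁺ as⊆S ds⊆S) ∈-++⁺ˡ))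
          (inj₁ (subst (_< 1#) (‖-‖-sym (sumOver f as) s) (beyond as (as! , as⊆S) (λ a∈as → a∈as))))))
        where
        difference : sumOver f (as List.++ ds) -ᶜ sumOver f as ≡ sumOver f ds
        difference = trans (cong (_-ᶜ sumOver f as) (sumOver-++ f as)) (trans (-ᶜ≡+ᶜ-ᶜ _ _)
          (ℂS.solve 2 (λ x y → (x ℂS.:+ y) ℂS.:- x ℂS.:= y) refl (sumOver f as) (sumOver f ds)))

      filter-away : ∀ {P : Pred A 0ℓ} ds → Away ds → Away (filter (λ a → em {P a}) ds)
      filter-away ds ((ds! , ds⊆S) , ds#as) = (UniqueP.filter⁺ _ ds! , AllP.filter⁺ _ ds⊆S) , λ d∈ → ds#as (proj₁ (∈-filter⁻ _ d∈))

      away-sumℝ : ∀ ds → Away ds → sumℝ (‖_‖ ∘ f) ds ≤ (two + two) + (two + two)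
      away-sumℝ ds away = subst (_≤ (two + two) + (two + two)) (sym (sumℝ-+ (∣_∣ ∘ re ∘ f) (∣_∣ ∘ im ∘ f) ds)) (+-mono-≤
        (sumℝ-∣∣ (re ∘ f) ds λ {P} → re-bounded _ (filter-away {P} ds away))
        (sumℝ-∣∣ (im ∘ f) ds λ {P} → im-bounded _ (filter-away {P} ds away)))
        where
        re-bounded : ∀ ds → Away ds → ∣ sumℝ (re ∘ f) ds ∣ ≤ two
        re-bounded ds away = subst (λ x → ∣ x ∣ ≤ two) (re-sumOver f ds) (≤-trans (∣re∣≤‖‖ (sumOver f ds)) (away-bounded ds away))
        im-bounded : ∀ ds → Away ds → ∣ sumℝ (im ∘ f) ds ∣ ≤ two
        im-bounded ds away = subst (λ x → ∣ x ∣ ≤ two) (im-sumOver f ds) (≤-trans (∣im∣≤‖‖ (sumOver f ds)) (away-bounded ds away))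

      bounded : ∀ bs → FiniteSubset S bs → sumℝ (‖_‖ ∘ f) bs ≤ sumℝ (‖_‖ ∘ f) as + ((two + two) + (two + two))
      bounded bs (bs! , bs⊆S) = ≤-trans
        (sumℝ-⊆ (‖‖-nonneg ∘ f) bs! cover)
        (subst (_≤ sumℝ (‖_‖ ∘ f) as + ((two + two) + (two + two))) (sym (sumℝ-++ _ as))
          (+-monoʳ-≤ _ (away-sumℝ ds ((UniqueP.filter⁺ _ bs! , AllP.filter⁺ _ bs⊆S) , λ d∈ → proj₂ (∈-filter⁻ outside? {xs = bs} d∈)))))
        where
        outside? = λ a → em {a ∉ as}
        ds = filter outside? bs
        cover : bs ⊆ as List.++ ds
        cover {b} b∈bs with em {b ∈ as}
        ... | yes b∈as = ∈-++⁺ˡ b∈as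
        ... | no b∉as  = ∈-++⁺ʳ as (∈-filter⁺ outside? b∈bs b∉as)

    -- Products of summable families

    _⊗_ : (A → ℂ) → (B → ℂ) → A × B → ℂ
    (f ⊗ g) (a , b) = f a *ᶜ g b

    private
      shrink : ∀ k ε → 0# < k → 0# < ε → ∃[ δ ] 0# < δ × δ ≤ 1# × δ * k < ε
      -- Here δ = ε / (k + ε), which is at most 1 because k is positive, and δ k < ε because k < k +
      -- ε.
      shrink k ε 0<k 0<ε = ε * q , *-positive 0<ε 0<q ,
        inj₁ (subst₂ _<_ (*-comm q ε) (trans (*-comm q (k + ε)) q-inverse) (*-monoˡ-< 0<q ε<k+ε)) ,
        subst (ε * q * k <_) (trans (*-assoc ε q (k + ε)) (trans (cong (ε *_) (trans (*-comm q (k + ε)) q-inverse)) (*-identityʳ ε)))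
          (*-monoˡ-< (*-positive 0<ε 0<q) (subst (_< k + ε) (+-identityʳ k) (+-monoʳ-< k 0<ε)))
        where
        0<k+ε : 0# < k + ε
        0<k+ε = +-pos-nonneg 0<k (inj₁ 0<ε)
        q = (k + ε) ⁻¹
        0<q : 0# < q
        0<q = ⁻¹-pos 0<k+ε
        q-inverse : (k + ε) * q ≡ 1#
        q-inverse = *-inverseʳ (k + ε) (pos⇒≢0 0<k+ε)
        ε<k+ε : ε < k + ε
        ε<k+ε = subst₂ _<_ (+-identityʳ ε) (+-comm ε k) (+-monoʳ-< ε 0<k)

    module _ {S : Pred A 0ℓ} {T : Pred B 0ℓ} where

      cartesianProduct-finite : ∀ {as bs} → FiniteSubset S as → FiniteSubset T bs → FiniteSubset (S ⟨×⟩ T) (cartesianProduct as bs)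
      cartesianProduct-finite {as} {bs} (as! , as⊆S) (bs! , bs⊆T) = UniqueP.cartesianProduct⁺ as! bs! , All.tabulate λ {(a , b)} ab∈ →
        let a∈as , b∈bs = ∈-cartesianProduct⁻ as bs ab∈ in All.lookup as⊆S a∈as , All.lookup bs⊆T b∈bs

      -- The sides are the projections of `cs`, enlarged by the prescribed `as` and `bs` so that
      -- both factors are already close to their sums.
      rectangle : ∀ as bs → All S as → All T bs → ∀ cs → All (S ⟨×⟩ T) cs → ∃[ as′ ] ∃[ bs′ ]
        FiniteSubset S as′ × FiniteSubset T bs′ × as ⊆ as′ × bs ⊆ bs′ × cs ⊆ cartesianProduct as′ bs′
      rectangle as bs as⊆S bs⊆T cs cs⊆ =
        as ∪ map proj₁ cs , bs ∪ map proj₂ cs ,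
        ∪-finite as⊆S (AllP.map⁺ (All.map proj₁ cs⊆)) , ∪-finite bs⊆T (AllP.map⁺ (All.map proj₂ cs⊆)) ,
        ⊆-∪ˡ , ⊆-∪ˡ ,
        λ c∈cs → ∈-cartesianProduct⁺ (⊆-∪ʳ as (∈-map⁺ proj₁ c∈cs)) (⊆-∪ʳ bs (∈-map⁺ proj₂ c∈cs))

      ⊗-bounded : ∀ {f g} → AbsolutelyBounded S f → AbsolutelyBounded T g → AbsolutelyBounded (S ⟨×⟩ T) (f ⊗ g)
      ⊗-bounded {f} {g} (b , f≤b) (d , g≤d) = b * d , bounded
        where
        bounded : ∀ cs → FiniteSubset (S ⟨×⟩ T) cs → sumℝ (‖_‖ ∘ (f ⊗ g)) cs ≤ b * d
        bounded cs (cs! , cs⊆) with rectangle [] [] [] [] cs cs⊆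
        ... | as , bs , as-finite , bs-finite , _ , _ , cs⊆as×bs = ≤-trans (sumℝ-⊆ (λ (a , b) → ‖‖-nonneg (f a *ᶜ g b)) cs! cs⊆as×bs)
          (≤-trans (sumℝ-mono (λ (a , b) → ‖*‖ (f a) (g b)) (cartesianProduct as bs))
            (subst (_≤ b * d) (sym (sumℝ-cartesianProduct (‖_‖ ∘ f) (‖_‖ ∘ g) as bs))
              (*-mono-≤ (sumℝ-nonneg (‖‖-nonneg ∘ f) as) (sumℝ-nonneg (‖‖-nonneg ∘ g) bs) (f≤b as as-finite) (g≤d bs bs-finite))))

      HasSum-⊗ : ∀ {f g s t} → HasSum S f s → HasSum T g t → HasSum (S ⟨×⟩ T) (f ⊗ g) (s *ᶜ t)
      HasSum-⊗ {f} {g} {s} {t} Σ≡s Σ≡t = subst (HasSum (S ⟨×⟩ T) (f ⊗ g)) (HasSum-cofinal (proj₂ summable) cofinal) (proj₂ summable)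
        where
        summable : ∃[ p ] HasSum (S ⟨×⟩ T) (f ⊗ g) p
        summable = bounded⇒summable (⊗-bounded {f} {g} (summable⇒bounded Σ≡s) (summable⇒bounded Σ≡t))

        product-near : ∀ x y → ‖ x *ᶜ y -ᶜ s *ᶜ t ‖ ≤ ‖ x -ᶜ s ‖ * ‖ y -ᶜ t ‖ + ‖ x -ᶜ s ‖ * ‖ t ‖ + ‖ s ‖ * ‖ y -ᶜ t ‖
        product-near x y = subst (λ z → ‖ z ‖ ≤ ‖ x -ᶜ s ‖ * ‖ y -ᶜ t ‖ + ‖ x -ᶜ s ‖ * ‖ t ‖ + ‖ s ‖ * ‖ y -ᶜ t ‖) eq
          (≤-trans (‖+‖ ((x -ᶜ s) *ᶜ (y -ᶜ t) +ᶜ (x -ᶜ s) *ᶜ t) (s *ᶜ (y -ᶜ t))) (+-mono-≤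
            (≤-trans (‖+‖ ((x -ᶜ s) *ᶜ (y -ᶜ t)) ((x -ᶜ s) *ᶜ t)) (+-mono-≤ (‖*‖ (x -ᶜ s) (y -ᶜ t)) (‖*‖ (x -ᶜ s) t)))
            (‖*‖ s (y -ᶜ t))))
          where
          -- The product x y expanded about the point (s , t).
          eq : (x -ᶜ s) *ᶜ (y -ᶜ t) +ᶜ (x -ᶜ s) *ᶜ t +ᶜ s *ᶜ (y -ᶜ t) ≡ x *ᶜ y -ᶜ s *ᶜ t
          eq = trans (cong₂ (λ d e → d *ᶜ e +ᶜ d *ᶜ t +ᶜ s *ᶜ e) (-ᶜ≡+ᶜ-ᶜ x s) (-ᶜ≡+ᶜ-ᶜ y t)) (trans
            (ℂS.solve 4 (λ x y s t → (x ℂS.:- s) ℂS.:* (y ℂS.:- t) ℂS.:+ (x ℂS.:- s) ℂS.:* t ℂS.:+ s ℂS.:* (y ℂS.:- t)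
                                     ℂS.:= x ℂS.:* y ℂS.:- s ℂS.:* t) refl x y s t)
            (sym (-ᶜ≡+ᶜ-ᶜ (x *ᶜ y) (s *ᶜ t))))

        cofinal : ∀ ε → 0# < ε → ∀ cs → FiniteSubset (S ⟨×⟩ T) cs →
                  ∃[ ds ] FiniteSubset (S ⟨×⟩ T) ds × cs ⊆ ds × ‖ sumOver (f ⊗ g) ds -ᶜ s *ᶜ t ‖ < ε
        -- With both factors within δ ≤ 1 of their sums, the error is at most δ + δ ‖t‖ + ‖s‖ δ,
        -- which is δ times the constant given to `shrink`.
        cofinal ε 0<ε cs (_ , cs⊆) with shrink (1# + ‖ t ‖ + ‖ s ‖) ε (+-pos-nonneg (+-pos-nonneg 0<1 (‖‖-nonneg t)) (‖‖-nonneg s)) 0<ε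
        ... | δ , 0<δ , δ≤1 , δ*k<ε with approximate Σ≡s δ 0<δ | approximate Σ≡t δ 0<δ
        ... | as , (_ , as⊆S) , near-s | bs , (_ , bs⊆T) , near-t with rectangle as bs as⊆S bs⊆T cs cs⊆
        ... | as′ , bs′ , as′-finite , bs′-finite , as⊆as′ , bs⊆bs′ , cs⊆ds =
          cartesianProduct as′ bs′ , cartesianProduct-finite as′-finite bs′-finite , cs⊆ds ,
          subst (λ z → ‖ z -ᶜ s *ᶜ t ‖ < ε) (sym (sumOver-cartesianProduct f g as′ bs′)) (≤-<-trans (product-near X Y) (≤-<-trans
            (subst (‖ X -ᶜ s ‖ * ‖ Y -ᶜ t ‖ + ‖ X -ᶜ s ‖ * ‖ t ‖ + ‖ s ‖ * ‖ Y -ᶜ t ‖ ≤_)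
              (solve 3 (λ δ t s → δ :* con 1ℤ :+ δ :* t :+ s :* δ := δ :* (con 1ℤ :+ t :+ s)) refl δ (‖ t ‖) (‖ s ‖))
              (+-mono-≤ (+-mono-≤
                (*-mono-≤ (‖‖-nonneg (X -ᶜ s)) (‖‖-nonneg (Y -ᶜ t)) x≈s (≤-trans y≈t δ≤1))
                (*-mono-≤ (‖‖-nonneg (X -ᶜ s)) (‖‖-nonneg t) x≈s ≤-refl))
                (*-monoˡ-≤ (‖‖-nonneg s) y≈t)))
            δ*k<ε))
          where
          X = sumOver f as′
          Y = sumOver g bs′
          x≈s : ‖ X -ᶜ s ‖ ≤ δ
          x≈s = inj₁ (near-s as′ as′-finite as⊆as′)
          y≈t : ‖ Y -ᶜ t ‖ ≤ δ
          y≈t = inj₁ (near-t bs′ bs′-finite bs⊆bs′)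

    -- Values of `tsum`, products and reindexing

    tsum≡ : ∀ {S : Pred A 0ℓ} {f s} → HasSum S f s → tsum S f ≡ s
    tsum≡ {S = S} {f} Σ≡s with em {∃ (HasSum S f)}
    ... | yes (_ , Σ≡s′)  = HasSum-unique Σ≡s′ Σ≡s
    ... | no not-summable = ⊥-elim (not-summable (_ , Σ≡s))

    tsum≡0 : ∀ {S : Pred A 0ℓ} {f} → ¬ ∃ (HasSum S f) → tsum S f ≡ 0ᶜ
    tsum≡0 {S = S} {f} not-summable with em {∃ (HasSum S f)}
    ... | yes summable = ⊥-elim (not-summable summable)
    ... | no _         = refl

    tsum-pointwise : ∀ {S : Pred A 0ℓ} {f g} → (∀ a → f a ≡ g a) → tsum S f ≡ tsum S g
    tsum-pointwise {S = S} {f} {g} f≗g with em {∃ (HasSum S f)}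
    ... | yes (s , Σ≡s)   = sym (tsum≡ (HasSum-cong f≗g Σ≡s))
    ... | no not-summable = sym (tsum≡0 λ (s , Σ≡s) → not-summable (s , HasSum-cong (sym ∘ f≗g) Σ≡s))

    -- Bounds on sums of norms pass to subfamilies and to multiples, so the detour through absolute
    -- boundedness transfers summability along an injection.
    summable-slice : ∀ {S : Pred A 0ℓ} {T : Pred B 0ℓ} {f s} {g : B → ℂ} (e : B → A) (c : ℂ) →
      (∀ {b b′} → e b ≡ e b′ → b ≡ b′) → (∀ {b} → T b → S (e b)) → (∀ b → g b ≡ c *ᶜ f (e b)) →
      HasSum S f s → ∃ (HasSum T g)
    summable-slice {T = T} {f} {g = g} e c e-injective e-maps g≗cfe Σ≡s with summable⇒bounded Σ≡s
    ... | d , bounded = bounded⇒summable (‖ c ‖ * d , λ bs (bs! , bs⊆T) → ≤-trans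
      (sumℝ-mono (λ b → subst (λ z → ‖ z ‖ ≤ ‖ c ‖ * ‖ f (e b) ‖) (sym (g≗cfe b)) (‖*‖ c (f (e b)))) bs)
      (subst (_≤ ‖ c ‖ * d) (sym (trans (sumℝ-*ˡ (‖ c ‖) (λ b → ‖ f (e b) ‖) bs) (cong (‖ c ‖ *_) (sym (sumℝ-map (‖_‖ ∘ f) e bs)))))
        (*-monoˡ-≤ (‖‖-nonneg c) (bounded (map e bs) (UniqueP.map⁺ e-injective bs! , AllP.map⁺ (All.map e-maps bs⊆T))))))

    -- Neither sum need exist: a slice of the product family is a multiple of a
    -- factor, so that the product family is summable only if both factors are.
    tsum-⊗ : ∀ {S : Pred A 0ℓ} {T : Pred B 0ℓ} {f g} →
      (∃[ a ] S a × ∃[ u ] u *ᶜ f a ≡ 1ᶜ) → (∃[ b ] T b × ∃[ u ] u *ᶜ g b ≡ 1ᶜ) →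
      tsum (S ⟨×⟩ T) (f ⊗ g) ≡ tsum S f *ᶜ tsum T g
    tsum-⊗ {S = S} {T} {f} {g} (a , Sa , u , ufa≡1) (b , Tb , u′ , u′gb≡1) = by-cases em em
      where
      cancelˡ : ∀ y → y ≡ u *ᶜ (f a *ᶜ y)
      cancelˡ y = sym (trans (sym (ℂR.*-assoc u (f a) y)) (trans (cong (_*ᶜ y) ufa≡1) (ℂR.*-identityˡ y)))

      cancelʳ : ∀ x → x ≡ u′ *ᶜ (x *ᶜ g b)
      cancelʳ x = sym (trans
        (ℂS.solve 3 (λ u x y → u ℂS.:* (x ℂS.:* y) ℂS.:= x ℂS.:* (u ℂS.:* y)) refl u′ x (g b))
        (trans (cong (x *ᶜ_) u′gb≡1) (ℂR.*-identityʳ x)))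

      by-cases : Dec (∃ (HasSum S f)) → Dec (∃ (HasSum T g)) → tsum (S ⟨×⟩ T) (f ⊗ g) ≡ tsum S f *ᶜ tsum T g
      by-cases (yes (s , Σ≡s)) (yes (t , Σ≡t)) =
        trans (tsum≡ (HasSum-⊗ Σ≡s Σ≡t)) (sym (cong₂ _*ᶜ_ (tsum≡ Σ≡s) (tsum≡ Σ≡t)))
      by-cases (no ¬f) _ = trans
        (tsum≡0 λ (_ , Σfg) → ¬f (summable-slice (_, b) u′ (cong proj₁) (_, Tb) (λ x → cancelʳ (f x)) Σfg))
        (sym (trans (cong (_*ᶜ tsum T g) (tsum≡0 ¬f)) (ℂR.zeroˡ (tsum T g))))
      by-cases (yes _) (no ¬g) = trans
        (tsum≡0 λ (_ , Σfg) → ¬g (summable-slice (a ,_) u (cong proj₂) (Sa ,_) (λ y → cancelˡ (g y)) Σfg))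
        (sym (trans (cong (tsum S f *ᶜ_) (tsum≡0 ¬g)) (ℂR.zeroʳ (tsum S f))))

    module _ (e : A → B) (e⁻¹ : B → A) (e∘e⁻¹ : ∀ b → e (e⁻¹ b) ≡ b) (e⁻¹∘e : ∀ a → e⁻¹ (e a) ≡ a) where

      private
        inverse-injective : ∀ {b b′} → e⁻¹ b ≡ e⁻¹ b′ → b ≡ b′
        inverse-injective eq = trans (sym (e∘e⁻¹ _)) (trans (cong e eq) (e∘e⁻¹ _))

        injective : ∀ {a a′} → e a ≡ e a′ → a ≡ a′
        injective eq = trans (sym (e⁻¹∘e _)) (trans (cong e⁻¹ eq) (e⁻¹∘e _))

      HasSum-reindex : ∀ {S : Pred B 0ℓ} {f s} → HasSum (S ∘ e) (f ∘ e) s → HasSum S f s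
      HasSum-reindex {S} {f} {s} Σ≡s ε 0<ε with Σ≡s ε 0<ε
      ... | as , (as! , as⊆) , beyond = map e as , (UniqueP.map⁺ injective as! , AllP.map⁺ as⊆) , λ bs (bs! , bs⊆S) as⊆bs →
        subst (λ z → ∣ z -ᶜ s ∣< ε)
          (trans (sumOver-map (f ∘ e) e⁻¹ bs) (sumOver-cong (λ b → cong f (e∘e⁻¹ b)) bs))
          (beyond (map e⁻¹ bs) (UniqueP.map⁺ inverse-injective bs! , AllP.map⁺ (All.map (λ {b} → subst S (sym (e∘e⁻¹ b))) bs⊆S))
            λ {a} a∈as → subst (_∈ map e⁻¹ bs) (e⁻¹∘e a) (∈-map⁺ e⁻¹ (as⊆bs (∈-map⁺ e a∈as))))

      tsum-reindex : ∀ {S : Pred B 0ℓ} {f} → tsum S f ≡ tsum (S ∘ e) (f ∘ e)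
      tsum-reindex {S} {f} = by-cases em
        where
        by-cases : Dec (∃ (HasSum (S ∘ e) (f ∘ e))) → tsum S f ≡ tsum (S ∘ e) (f ∘ e)
        by-cases (yes (s , Σ≡s)) = trans (tsum≡ (HasSum-reindex Σ≡s)) (sym (tsum≡ Σ≡s))
        by-cases (no ¬fe)        = trans
          -- The converse of `HasSum-reindex` is needed only as mere existence, and the slice along
          -- e with factor 1 provides it.
          (tsum≡0 λ (_ , Σf) → ¬fe (summable-slice e 1ᶜ injective (λ Sea → Sea) (λ a → sym (ℂR.*-identityˡ (f (e a)))) Σf))
          (sym (tsum≡0 ¬fe))

  -- The exponential function

  fromℕ-+ : ∀ m n → fromℕ (m ℕ.+ n) ≡ fromℕ m + fromℕ n
  fromℕ-+ m n = fromℤ-+ (+ m) (+ n)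

  fromℕ-* : ∀ m n → fromℕ (m ℕ.* n) ≡ fromℕ m * fromℕ n
  fromℕ-* m n = trans (cong fromℤ (ℤP.pos-* m n)) (fromℤ-* (+ m) (+ n))

  fromℕ-mono : ∀ {m n} → m ℕ.≤ n → fromℕ m ≤ fromℕ n
  fromℕ-mono {m} {n} m≤n = subst (λ k → fromℕ m ≤ fromℕ k) (ℕP.m+[n∸m]≡n m≤n)
    (subst (fromℕ m ≤_) (sym (fromℕ-+ m (n ℕ.∸ m))) (x≤x+y (fromℕ-nonneg (n ℕ.∸ m))))

  fromℕ-suc-inverse : ∀ n → fromℕ (suc n) * fromℕ (suc n) ⁻¹ ≡ 1#
  fromℕ-suc-inverse n = *-inverseʳ _ (pos⇒≢0 (fromℕ-suc-pos n))

  factorial-pos : ∀ n → 0# < fromℕ (n !)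
  factorial-pos zero    = 0<1
  factorial-pos (suc n) = subst (0# <_) (sym (fromℕ-* (suc n) (n !))) (*-positive (fromℕ-suc-pos n) (factorial-pos n))

  -- Positivity makes x, y and x y nonzero, as the inverse of zero is unspecified.
  *-⁻¹ : ∀ {x y} → 0# < x → 0# < y → (x * y) ⁻¹ ≡ x ⁻¹ * y ⁻¹
  *-⁻¹ {x} {y} 0<x 0<y = trans (sym (*-identityʳ _)) (trans
    (cong ((x * y) ⁻¹ *_) (sym (trans (cong₂ _*_ (*-inverseʳ x (pos⇒≢0 0<x)) (*-inverseʳ y (pos⇒≢0 0<y))) (*-identityˡ 1#))))
    (trans (solve 5 (λ p x x′ y y′ → p :* ((x :* x′) :* (y :* y′)) := ((x :* y) :* p) :* (x′ :* y′)) refl ((x * y) ⁻¹) x (x ⁻¹) y (y ⁻¹))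
      (trans (cong (_* (x ⁻¹ * y ⁻¹)) (*-inverseʳ (x * y) (pos⇒≢0 (*-positive 0<x 0<y)))) (*-identityˡ _))))
    where open Solver

  ofℝ-* : ∀ x y → ofℝ (x * y) ≡ ofℝ x *ᶜ ofℝ y
  ofℝ-* x y = ℂ-ext (solve 2 (λ x y → x :* y := x :* y :- con 0ℤ :* con 0ℤ) refl x y)
                    (solve 2 (λ x y → con 0ℤ := x :* con 0ℤ :+ con 0ℤ :* y) refl x y)
    where open Solver

  ofℝ-+ : ∀ x y → ofℝ (x + y) ≡ ofℝ x +ᶜ ofℝ y
  ofℝ-+ x y = ℂ-ext refl (sym (+-identityˡ 0#))

  expTerm : ℂ → ℕ → ℂ
  expTerm z n = z ^ n *ᶜ ofℝ (fromℕ (n !) ⁻¹)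

  1⁻¹≡1 : 1# ⁻¹ ≡ 1#
  1⁻¹≡1 = trans (sym (*-identityˡ (1# ⁻¹))) (*-inverseʳ 1# (pos⇒≢0 0<1))

  expTerm-0 : ∀ z → expTerm z 0 ≡ 1ᶜ
  expTerm-0 z = trans (cong (λ x → 1ᶜ *ᶜ ofℝ x) 1⁻¹≡1) (ℂR.*-identityˡ 1ᶜ)

  expTerm-suc : ∀ z n → expTerm z (suc n) ≡ ofℝ (fromℕ (suc n) ⁻¹) *ᶜ (z *ᶜ expTerm z n)
  expTerm-suc z n = trans
    (cong (z *ᶜ z ^ n *ᶜ_) (trans (cong (λ x → ofℝ (x ⁻¹)) (fromℕ-* (suc n) (n !)))
      (trans (cong ofℝ (*-⁻¹ (fromℕ-suc-pos n) (factorial-pos n))) (ofℝ-* _ _))))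
    (solve 4 (λ z p x y → (z :* p) :* (x :* y) := x :* (z :* (p :* y))) refl z (z ^ n) (ofℝ (fromℕ (suc n) ⁻¹)) (ofℝ (fromℕ (n !) ⁻¹)))
    where open ℂS

  -- A ratio test: the norm of a term shrinks by at least the factor ‖z‖ / (n + 1), which is at most
  -- one half once n ≥ N ≥ 2‖z‖.
  expTerm-bounded : ∀ z → AbsolutelyBounded U (expTerm z)
  expTerm-bounded z with archimedean (‖ z ‖ + ‖ z ‖)
  ... | N , 2z≤N = sumℝ t (downFrom N) + (t N + t N) , λ ns (ns! , _) → let m , ns<m = bound id ns in
    ≤-trans (sumℝ-⊆ (‖‖-nonneg ∘ expTerm z) ns! (λ n∈ns → ∈-downFrom⁺ (ℕP.≤-trans (ns<m n∈ns) (ℕP.m≤m+n m N))))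
    -- Twice the next term is added because the partial sum together with it never increases from N
    -- on.
    (≤-trans (x≤x+y (+-nonneg (‖‖-nonneg (expTerm z (m ℕ.+ N))) (‖‖-nonneg (expTerm z (m ℕ.+ N))))) (decreasing m))
    where
    open Solver
    t : ℕ → ℝ
    t n = ‖ expTerm z n ‖

    halving : ∀ n → N ℕ.≤ n → t (suc n) + t (suc n) ≤ t n
    halving n N≤n = ≤-trans (+-mono-≤ t-suc t-suc)
      (subst₂ _≤_ (solve 3 (λ q r t → q :* (r :+ r) :* t := q :* (r :* t) :+ q :* (r :* t)) refl q (‖ z ‖) (t n))
        (trans (cong (_* t n) (trans (*-comm q _) (fromℕ-suc-inverse n))) (*-identityˡ (t n)))
        (*-mono-≤ (*-nonneg 0≤q (+-nonneg (‖‖-nonneg z) (‖‖-nonneg z))) (‖‖-nonneg (expTerm z n))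
          (*-monoˡ-≤ 0≤q (≤-trans 2z≤N (fromℕ-mono (ℕP.m≤n⇒m≤1+n N≤n)))) ≤-refl))
      where
      q = fromℕ (suc n) ⁻¹
      0≤q : 0# ≤ q
      0≤q = inj₁ (⁻¹-pos (fromℕ-suc-pos n))
      t-suc : t (suc n) ≤ q * (‖ z ‖ * t n)
      t-suc = subst (λ w → ‖ w ‖ ≤ q * (‖ z ‖ * t n)) (sym (expTerm-suc z n))
        (≤-trans (‖*‖ (ofℝ q) (z *ᶜ expTerm z n))
          (*-mono-≤ (‖‖-nonneg (ofℝ q)) (‖‖-nonneg (z *ᶜ expTerm z n)) (‖ofℝ‖ 0≤q) (‖*‖ z (expTerm z n))))

    -- From N on the terms are at least halved, so twice the next one dominates the rest of the series.
    decreasing : ∀ k → sumℝ t (downFrom (k ℕ.+ N)) + (t (k ℕ.+ N) + t (k ℕ.+ N)) ≤ sumℝ t (downFrom N) + (t N + t N)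
    decreasing zero    = ≤-refl
    decreasing (suc k) = ≤-trans
      (subst (sumℝ t (downFrom (suc k ℕ.+ N)) + (t (suc k ℕ.+ N) + t (suc k ℕ.+ N)) ≤_)
        (solve 2 (λ t s → (t :+ s) :+ t := s :+ (t :+ t)) refl (t (k ℕ.+ N)) (sumℝ t (downFrom (k ℕ.+ N))))
        (+-monoʳ-≤ (sumℝ t (downFrom (suc k ℕ.+ N))) (halving (k ℕ.+ N) (ℕP.m≤n+m N k))))
      (decreasing k)

  exp-HasSum : ∀ z → HasSum U (expTerm z) (exp z)
  exp-HasSum z = let s , Σ≡s = bounded⇒summable (expTerm-bounded z) in subst (HasSum U (expTerm z)) (sym (tsum≡ Σ≡s)) Σ≡s

  antidiagonal-first : ∀ (F : ℕ × ℕ → ℂ) n →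
    sumOver F (antidiagonal (suc n)) ≡ F (0 , suc n) +ᶜ sumOver (F ∘ map₁ suc) (antidiagonal n)
  antidiagonal-first F n = cong (F (0 , suc n) +ᶜ_) (sumOver-map F (map₁ suc) (antidiagonal n))

  -- The list starts at (0 , suc n), so removing its other end takes an induction. Both ends are
  -- wanted: the weight i vanishes at the first, the weight j at the last.
  antidiagonal-last : ∀ (F : ℕ × ℕ → ℂ) n →
    sumOver F (antidiagonal (suc n)) ≡ sumOver (F ∘ map₂ suc) (antidiagonal n) +ᶜ F (suc n , 0)
  antidiagonal-last F zero    = solve 2 (λ x y → x :+ (y :+ con 0ℤ) := (x :+ con 0ℤ) :+ y) refl (F (0 , 1)) (F (1 , 0))
    where open ℂS
  antidiagonal-last F (suc n) = trans (antidiagonal-first F (suc n))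
    (trans (cong (F (0 , suc (suc n)) +ᶜ_) (antidiagonal-last (F ∘ map₁ suc) n))
    (trans (sym (ℂR.+-assoc (F (0 , suc (suc n))) _ _)) (cong (_+ᶜ F (suc (suc n) , 0)) (sym (antidiagonal-first (F ∘ map₂ suc) n)))))

  ofℝ-cancel : ∀ n x → ofℝ (fromℕ (suc n) ⁻¹) *ᶜ (ofℝ (fromℕ (suc n)) *ᶜ x) ≡ x
  ofℝ-cancel n x = trans (sym (ℂR.*-assoc _ _ x)) (trans
    (cong (_*ᶜ x) (trans (sym (ofℝ-* (fromℕ (suc n) ⁻¹) (fromℕ (suc n)))) (cong ofℝ (trans (*-comm _ _) (fromℕ-suc-inverse n)))))
    (ℂR.*-identityˡ x))

  expTerm-suc′ : ∀ z n → ofℝ (fromℕ (suc n)) *ᶜ expTerm z (suc n) ≡ z *ᶜ expTerm z n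
  expTerm-suc′ z n = trans (cong (ofℝ (fromℕ (suc n)) *ᶜ_) (expTerm-suc z n))
    (trans (swap-scalars (ofℝ (fromℕ (suc n))) (ofℝ (fromℕ (suc n) ⁻¹)) (z *ᶜ expTerm z n)) (ofℝ-cancel n (z *ᶜ expTerm z n)))
    where
    open ℂS
    swap-scalars : ∀ x y w → x *ᶜ (y *ᶜ w) ≡ y *ᶜ (x *ᶜ w)
    swap-scalars = solve 3 (λ x y w → x :* (y :* w) := y :* (x :* w)) refl

  -- Both sides satisfy (n + 1) G (n + 1) = (z + w) G n.
  expTerm-+ : ∀ z w n → sumOver (expTerm z ⊗ expTerm w) (antidiagonal n) ≡ expTerm (z +ᶜ w) n
  expTerm-+ z w zero = trans (ℂR.+-identityʳ _) (trans
    (cong₂ _*ᶜ_ (expTerm-0 z) (expTerm-0 w)) (trans (ℂR.*-identityˡ 1ᶜ) (sym (expTerm-0 (z +ᶜ w)))))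
  expTerm-+ z w (suc n) = trans (sym (ofℝ-cancel n (G (suc n)))) (trans
    (cong (ofℝ (fromℕ (suc n) ⁻¹) *ᶜ_) (trans recurrence (cong ((z +ᶜ w) *ᶜ_) (expTerm-+ z w n))))
    (sym (expTerm-suc (z +ᶜ w) n)))
    where
    F : ℕ × ℕ → ℂ
    F = expTerm z ⊗ expTerm w
    G : ℕ → ℂ
    G n = sumOver F (antidiagonal n)

    -- On this antidiagonal suc n is i + j. The part weighted by i lowers the first index and yields
    -- a factor z; the part weighted by j lowers the second and yields w.
    left right : ℕ × ℕ → ℂ
    left  (i , j) = ofℝ (fromℕ i) *ᶜ F (i , j)
    right (i , j) = ofℝ (fromℕ j) *ᶜ F (i , j)

    weight : ∀ {ij} → ij ∈ antidiagonal (suc n) → ofℝ (fromℕ (suc n)) *ᶜ F ij ≡ left ij +ᶜ right ij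
    weight {i , j} ij∈ = trans
      (cong (λ x → ofℝ x *ᶜ F (i , j)) (trans (cong fromℕ (sym (∈-antidiagonal⁻ (suc n) ij∈))) (fromℕ-+ i j)))
      (trans (cong (_*ᶜ F (i , j)) (ofℝ-+ (fromℕ i) (fromℕ j))) (ℂR.distribʳ (F (i , j)) _ _))

    open ℂS

    left-sum : sumOver left (antidiagonal (suc n)) ≡ z *ᶜ G n
    left-sum = trans (antidiagonal-first left n) (trans
      (cong₂ _+ᶜ_ (ℂR.zeroˡ (F (0 , suc n)))
        (trans (sumOver-cong (λ (i , j) → trans (sym (ℂR.*-assoc _ _ (expTerm w j)))
            (trans (cong (_*ᶜ expTerm w j) (expTerm-suc′ z i)) (ℂR.*-assoc z _ _))) (antidiagonal n))
          (sumOver-*ˡ z F (antidiagonal n))))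
      (ℂR.+-identityˡ (z *ᶜ G n)))

    right-sum : sumOver right (antidiagonal (suc n)) ≡ w *ᶜ G n
    right-sum = trans (antidiagonal-last right n) (trans
      (cong₂ _+ᶜ_
        (trans (sumOver-cong (λ (i , j) → trans (pull (ofℝ (fromℕ (suc j))) (expTerm z i) (expTerm w (suc j)))
            (trans (cong (expTerm z i *ᶜ_) (expTerm-suc′ w j)) (pull (expTerm z i) w (expTerm w j)))) (antidiagonal n))
          (sumOver-*ˡ w F (antidiagonal n)))
        (ℂR.zeroˡ (F (suc n , 0))))
      (ℂR.+-identityʳ (w *ᶜ G n)))
      where
      pull : ∀ x y z → x *ᶜ (y *ᶜ z) ≡ y *ᶜ (x *ᶜ z)
      pull = solve 3 (λ x y z → x :* (y :* z) := y :* (x :* z)) refl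

    recurrence : ofℝ (fromℕ (suc n)) *ᶜ G (suc n) ≡ (z +ᶜ w) *ᶜ G n
    recurrence = trans (sym (sumOver-*ˡ (ofℝ (fromℕ (suc n))) F (antidiagonal (suc n))))
      (trans (sumOver-cong-∈ (antidiagonal (suc n)) weight)
      (trans (sumOver-+ left right (antidiagonal (suc n)))
      (trans (cong₂ _+ᶜ_ left-sum right-sum) (sym (ℂR.distribʳ (G n) z w)))))

  sumOver-triangle : ∀ z w n → sumOver (expTerm z ⊗ expTerm w) (triangle n) ≡ sumOver (expTerm (z +ᶜ w)) (downFrom n)
  sumOver-triangle z w zero    = refl
  sumOver-triangle z w (suc n) = trans (sumOver-++ (expTerm z ⊗ expTerm w) (antidiagonal n))
    (cong₂ _+ᶜ_ (expTerm-+ z w n) (sumOver-triangle z w n))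

  HasSum-expTerm-+ : ∀ z w {p q r} → HasSum U (expTerm z) p → HasSum U (expTerm w) q → HasSum U (expTerm (z +ᶜ w)) r → p *ᶜ q ≡ r
  HasSum-expTerm-+ z w {p} {q} {r} Σ≡p Σ≡q Σ≡r =
    HasSum-cofinal {S = U ⟨×⟩ U} {f = expTerm z ⊗ expTerm w} (HasSum-⊗ {S = U} {T = U} {f = expTerm z} {g = expTerm w} Σ≡p Σ≡q) cofinal
    where
    cofinal : ∀ ε → 0# < ε → ∀ cs → FiniteSubset (U ⟨×⟩ U) cs →
      ∃[ ds ] FiniteSubset (U ⟨×⟩ U) ds × cs ⊆ ds × ‖ sumOver (expTerm z ⊗ expTerm w) ds -ᶜ r ‖ < ε
    cofinal ε 0<ε cs _ with approximate {S = U} {f = expTerm (z +ᶜ w)} {s = r} Σ≡r ε 0<ε | bound (λ (i , j) → i ℕ.+ j) cs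
    ... | as , _ , beyond | M , cs<M with bound id as
    -- M makes the triangle contain `cs`; N makes the corresponding initial segment large enough for
    -- the series at z + w.
    ... | N , as<N = triangle (M ℕ.+ N) , (triangle-unique (M ℕ.+ N) , All.universal (λ _ → tt , tt) _) ,
      (λ c∈cs → ∈-triangle⁺ (ℕP.≤-trans (cs<M c∈cs) (ℕP.m≤m+n M N))) ,
      subst (λ s → ‖ s -ᶜ r ‖ < ε) (sym (sumOver-triangle z w (M ℕ.+ N)))
        (beyond (downFrom (M ℕ.+ N)) (UniqueP.downFrom⁺ (M ℕ.+ N) , all-U _)
          (λ a∈as → ∈-downFrom⁺ (ℕP.≤-trans (as<N a∈as) (ℕP.m≤n+m N M))))

  exp-+ : ∀ z w → exp (z +ᶜ w) ≡ exp z *ᶜ exp w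
  exp-+ z w = sym (HasSum-expTerm-+ z w (exp-HasSum z) (exp-HasSum w) (exp-HasSum (z +ᶜ w)))

  HasSum-expTerm-0 : ∀ {s} → HasSum U (expTerm 0ᶜ) s → s ≡ 1ᶜ
  HasSum-expTerm-0 Σ≡s = HasSum-cofinal {S = U} {f = expTerm 0ᶜ} Σ≡s λ ε 0<ε as _ → let M , as<M = bound id as in
    -- The successor keeps the index 0, whose term is the only nonzero one.
    downFrom (suc M) , (UniqueP.downFrom⁺ (suc M) , all-U _) , (λ a∈as → ∈-downFrom⁺ (ℕP.m≤n⇒m≤1+n (as<M a∈as))) ,
    subst (λ s → ‖ s -ᶜ 1ᶜ ‖ < ε) (sym (partial M)) (subst (_< ε) (sym ‖1-1‖) 0<ε)
    where
    ‖1-1‖ : ‖ 1ᶜ -ᶜ 1ᶜ ‖ ≡ 0#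
    ‖1-1‖ = antisym (subst (‖ 1ᶜ -ᶜ 1ᶜ ‖ ≤_) (-‿inverseʳ 1#) (‖ofℝ-ofℝ‖ ≤-refl)) (‖‖-nonneg (1ᶜ -ᶜ 1ᶜ))
    partial : ∀ M → sumOver (expTerm 0ᶜ) (downFrom (suc M)) ≡ 1ᶜ
    partial zero    = trans (ℂR.+-identityʳ (expTerm 0ᶜ 0)) (expTerm-0 0ᶜ)
    partial (suc M) = trans (cong₂ _+ᶜ_
      (solve 2 (λ p q → (con 0ℤ :* p) :* q := con 0ℤ) refl (0ᶜ ^ M) (ofℝ (fromℕ (suc M !) ⁻¹))) (partial M)) (ℂR.+-identityˡ 1ᶜ)
      where open ℂS

  exp-0 : exp 0ᶜ ≡ 1ᶜ
  exp-0 = HasSum-expTerm-0 (exp-HasSum 0ᶜ)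

  𝐞-+ : ∀ z w → 𝐞 (z +ᶜ w) ≡ 𝐞 z *ᶜ 𝐞 w
  𝐞-+ z w = trans (cong exp (ℂR.distribˡ (ofℝ (fromℕ 2 * π) *ᶜ 𝕚) z w)) (exp-+ _ _)

  𝐞-invertible : ∀ z → ∃[ u ] u *ᶜ 𝐞 z ≡ 1ᶜ
  𝐞-invertible z = 𝐞 (-ᶜ z) , trans (sym (𝐞-+ (-ᶜ z) z)) (trans
    (cong 𝐞 (ℂR.-‿inverseˡ z)) (trans (cong exp (ℂR.zeroʳ (ofℝ (fromℕ 2 * π) *ᶜ 𝕚))) exp-0))

  -- Theta functions of direct sums

  halfSquare : ∀ L → L ⊗ℝ → ℂ
  halfSquare L u = ofℝ (pairingℝ L u u * ½)

  -- The argument of `𝐞` in the summand local to `Θ`, with which it agrees by definition.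
  thetaExponent : ∀ L → Gr L → ℍ → L ⊗ℂ → L ⊗ℝ → ℂ
  thetaExponent L v τ ζ u = point τ *ᶜ halfSquare L (Gr.proj₊ v u) +ᶜ conj (point τ) *ᶜ halfSquare L (Gr.proj₋ v u)
                            +ᶜ pairingℂ L (Vec.map ofℝ u) ζ

  halfSquare-⊕ : ∀ L K (u : L ⊗ℝ) (u′ : K ⊗ℝ) → halfSquare (L ⊕ K) (u ++ u′) ≡ halfSquare L u +ᶜ halfSquare K u′
  halfSquare-⊕ L K u u′ = trans
    (cong ofℝ (trans (cong (_* ½) (ℝForm.pairing-⊞ refl (gram L) (gram K) u u′ u u′)) (distribʳ ½ (pairingℝ L u u) (pairingℝ K u′ u′))))
    (ofℝ-+ (pairingℝ L u u * ½) (pairingℝ K u′ u′ * ½))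

  pairingℂ-⊕ : ∀ L K (u : L ⊗ℝ) (u′ : K ⊗ℝ) ζ ξ →
    pairingℂ (L ⊕ K) (Vec.map ofℝ (u ++ u′)) (ζ ++ ξ) ≡ pairingℂ L (Vec.map ofℝ u) ζ +ᶜ pairingℂ K (Vec.map ofℝ u′) ξ
  pairingℂ-⊕ L K u u′ ζ ξ = trans (cong (λ x → pairingℂ (L ⊕ K) x (ζ ++ ξ)) (VecP.map-++ ofℝ u u′))
    (ℂForm.pairing-⊞ refl (gram L) (gram K) (Vec.map ofℝ u) (Vec.map ofℝ u′) ζ ξ)

  module _ (L K : EvenLattice) (v : Gr L) (w : Gr K) (τ : ℍ) (ζ : L ⊗ℂ) (ξ : K ⊗ℂ) where

    -- The decomposition for v ⊕ w is built from those for v and w on `take` and `drop`, so its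
    -- projections are concatenations by definition and every quadratic term splits.
    thetaExponent-⊕ : ∀ u u′ → thetaExponent (L ⊕ K) (v ⊕ᴳ w) τ (ζ ++ ξ) (u ++ u′) ≡ thetaExponent L v τ ζ u +ᶜ thetaExponent K w τ ξ u′
    thetaExponent-⊕ u u′ = trans
      (cong₂ _+ᶜ_ (cong₂ (λ p q → point τ *ᶜ p +ᶜ conj (point τ) *ᶜ q) plus minus) (pairingℂ-⊕ L K u u′ ζ ξ))
      (solve 8 (λ t t̄ a a′ b b′ c c′ → (t :* (a :+ a′) :+ t̄ :* (b :+ b′)) :+ (c :+ c′)
                                    := (t :* a :+ t̄ :* b :+ c) :+ (t :* a′ :+ t̄ :* b′ :+ c′)) refl
        (point τ) (conj (point τ)) _ _ _ _ _ _)
      where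
      open ℂS
      plus : halfSquare (L ⊕ K) (Gr.proj₊ (v ⊕ᴳ w) (u ++ u′)) ≡ halfSquare L (Gr.proj₊ v u) +ᶜ halfSquare K (Gr.proj₊ w u′)
      plus = trans (halfSquare-⊕ L K (Gr.proj₊ v (take (rank L) (u ++ u′))) (Gr.proj₊ w (drop (rank L) (u ++ u′))))
        (cong₂ (λ x y → halfSquare L (Gr.proj₊ v x) +ᶜ halfSquare K (Gr.proj₊ w y)) (take-++ (rank L) u u′) (drop-++ (rank L) u u′))
      minus : halfSquare (L ⊕ K) (Gr.proj₋ (v ⊕ᴳ w) (u ++ u′)) ≡ halfSquare L (Gr.proj₋ v u) +ᶜ halfSquare K (Gr.proj₋ w u′)
      minus = trans (halfSquare-⊕ L K (Gr.proj₋ v (take (rank L) (u ++ u′))) (Gr.proj₋ w (drop (rank L) (u ++ u′))))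
        (cong₂ (λ x y → halfSquare L (Gr.proj₋ v x) +ᶜ halfSquare K (Gr.proj₋ w y)) (take-++ (rank L) u u′) (drop-++ (rank L) u u′))

  infixr 5 _⊕ᴰ_

  _⊕ᴰ_ : ∀ {L K} → Dual L → Dual K → Dual (L ⊕ K)
  _⊕ᴰ_ {L} {K} γ δ = record
    { vec      = vec γ ++ vec δ
    ; integral = integral
    }
    where
    integral : ∀ l → ∃[ k ] pairingℝ (L ⊕ K) (vec γ ++ vec δ) (embed l) ≡ fromℤ k
    integral l = let j , γl≡j = Dual.integral γ (take (rank L) l)
                     k , δl≡k = Dual.integral δ (drop (rank L) l) in
      j ℤ.+ k , trans
        (cong (pairingℝ (L ⊕ K) (vec γ ++ vec δ)) (trans (cong embed (split (rank L) l)) (VecP.map-++ fromℤ (take (rank L) l) (drop (rank L) l))))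
        (trans (ℝForm.pairing-⊞ refl (gram L) (gram K) (vec γ) (vec δ) (embed (take (rank L) l)) (embed (drop (rank L) l)))
          (trans (cong₂ _+_ γl≡j δl≡k) (sym (fromℤ-+ j k))))

  Coset-⊕⁺ : ∀ {L K} (γ : Dual L) (δ : Dual K) {u u′} → Coset L γ u → Coset K δ u′ → Coset (L ⊕ K) (γ ⊕ᴰ δ) (u ++ u′)
  Coset-⊕⁺ γ δ (l , refl) (l′ , refl) = l ++ l′ , trans
    (sym (VecP.zipWith-++ _+_ (vec γ) (vec δ) (embed l) (embed l′)))
    (cong ((vec γ ++ vec δ) +ᵥ_) (sym (VecP.map-++ fromℤ l l′)))

  Coset-⊕⁻ : ∀ {L K} (γ : Dual L) (δ : Dual K) {u u′} → Coset (L ⊕ K) (γ ⊕ᴰ δ) (u ++ u′) → Coset L γ u × Coset K δ u′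
  Coset-⊕⁻ {L} {K} γ δ {u} {u′} (l , eq) =
    (take (rank L) l , trans (sym (take-++ (rank L) u u′)) (trans (take-shift (rank L) _ (vec γ ++ vec δ) l eq)
      (cong (_+ᵥ embed (take (rank L) l)) (take-++ (rank L) (vec γ) (vec δ))))) ,
    (drop (rank L) l , trans (sym (drop-++ (rank L) u u′)) (trans (drop-shift (rank L) _ (vec γ ++ vec δ) l eq)
      (cong (_+ᵥ embed (drop (rank L) l)) (drop-++ (rank L) (vec γ) (vec δ)))))

  Θ-⊕ : ∀ L K (v : Gr L) (w : Gr K) τ (ζ : L ⊗ℂ) (ξ : K ⊗ℂ) (γ : Dual L) (δ : Dual K) →
    coeff (Θ (L ⊕ K) (v ⊕ᴳ w) τ (ζ ++ ξ)) (γ ⊕ᴰ δ) ≡ coeff (Θ L v τ ζ) γ *ᶜ coeff (Θ K w τ ξ) δ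
  Θ-⊕ L K v w τ ζ ξ γ δ = trans
    (tsum-reindex (uncurry _++_) (λ u → take (rank L) u , drop (rank L) u) (λ u → sym (split (rank L) u))
      (λ (u , u′) → cong₂ _,_ (take-++ (rank L) u u′) (drop-++ (rank L) u u′)))
    (trans (tsum-cong (Coset-⊕⁻ {L} {K} γ δ) (λ (u∈ , u′∈) → Coset-⊕⁺ {L} {K} γ δ u∈ u′∈))
    (trans (tsum-pointwise (λ (u , u′) → trans (cong 𝐞 (thetaExponent-⊕ L K v w τ ζ ξ u u′)) (𝐞-+ _ _)))
      -- Each coset contains its own representative, and the theta term there is invertible.
      (tsum-⊗ (vec γ , (_ , shift-0 (vec γ)) , 𝐞-invertible (thetaExponent L v τ ζ (vec γ)))
              (vec δ , (_ , shift-0 (vec δ)) , 𝐞-invertible (thetaExponent K w τ ξ (vec δ))))))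

  -- Sums over discriminant groups

  Invariant : ∀ L → (Dual L → ℂ) → Set
  Invariant L f = ∀ {γ δ} → Setoid._≈_ (D L) γ δ → f γ ≡ f δ

  sumᴱ : ∀ {L} → Enumeration L → (Dual L → ℂ) → ℂ
  sumᴱ E f = sum (f ∘ Enumeration.rep E)

  -- Two enumerations are transversals of the same classes. Matching representatives gives a
  -- permutation of the indices, and invariance equates the summands.
  sumᴱ-unique : ∀ {L} (E E′ : Enumeration L) {f} → Invariant L f → sumᴱ E f ≡ sumᴱ E′ f
  sumᴱ-unique {L} E E′ {f} f-inv = sym (trans
    (sum-permute (f ∘ rep E′) (permutation (to E E′) (to E′ E) (to-to E E′) (to-to E′ E)))
    (sum-cong-≗ (λ i → f-inv {rep E′ (to E E′ i)} {rep E i} (to-≈ E E′ i))))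
    where
    open Enumeration
    open Setoid (D L) renaming (sym to ≈-sym; trans to ≈-trans)
    to : (E E′ : Enumeration L) → Fin (order E) → Fin (order E′)
    to E E′ i = proj₁ (covers E′ (rep E i))
    to-≈ : ∀ E E′ i → rep E′ (to E E′ i) ≈ rep E i
    to-≈ E E′ i = proj₂ (covers E′ (rep E i))
    to-to : ∀ E E′ i → to E E′ (to E′ E i) ≡ i
    to-to E E′ i = distinct E′ (to E E′ (to E′ E i)) i
      (≈-trans {rep E′ (to E E′ (to E′ E i))} {rep E (to E′ E i)} {rep E′ i} (to-≈ E E′ (to E′ E i)) (to-≈ E′ E i))

  ∑D≡sumᴱ : ∀ {L} (E : Enumeration L) {f} → Invariant L f → ∑D L f ≡ sumᴱ E f
  ∑D≡sumᴱ {L} E {f} f-inv with em {Enumeration L}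
  ... | yes E′ = sumᴱ-unique E′ E {f} f-inv
  ... | no ¬E  = ⊥-elim (¬E E)

  ∑D≡0 : ∀ {L f} → ¬ Enumeration L → ∑D L f ≡ 0ᶜ
  ∑D≡0 {L} ¬E with em {Enumeration L}
  ... | yes E = ⊥-elim (¬E E)
  ... | no _  = refl

  sum-combine : ∀ m n (f : Fin (m ℕ.* n) → ℂ) → sum f ≡ sum (λ i → sum (λ j → f (combine {m} {n} i j)))
  sum-combine zero    n f = refl
  sum-combine (suc m) n f = trans (ℂForm.sum-++ n f) (cong (sum (λ j → f (j ↑ˡ (m ℕ.* n))) +ᶜ_) (sum-combine m n (λ i → f (n ↑ʳ i))))

  sum-*ʳ : ∀ {n} (f : Fin n → ℂ) z → sum (λ i → f i *ᶜ z) ≡ sum f *ᶜ z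
  sum-*ʳ {zero}  f z = sym (ℂR.zeroˡ z)
  sum-*ʳ {suc n} f z = trans (cong (f zero *ᶜ z +ᶜ_) (sum-*ʳ (f ∘ suc) z)) (sym (ℂR.distribʳ z (f zero) _))

  -- Projecting an enumeration of the direct sum lists classes repeatedly. A finite covering list is
  -- thinned by keeping an entry only if its class is not represented among the later ones.
  enumerate : ∀ {L n} (g : Fin n → Dual L) → (∀ γ → ∃[ i ] Setoid._≈_ (D L) (g i) γ) → Enumeration L
  enumerate {L} {n} g g-covers = let m , rep , g≈rep , distinct = select n g in record
    { order    = m
    ; rep      = rep
    ; covers   = λ γ → let i , gi≈γ = g-covers γ ; k , rk≈gi = g≈rep i in k , ≈-trans {rep k} {g i} {γ} rk≈gi gi≈γ
    ; distinct = distinct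
    }
    where
    open Setoid (D L) renaming (sym to ≈-sym; trans to ≈-trans; refl to ≈-refl)
    select : ∀ n (g : Fin n → Dual L) → ∃[ m ] Σ[ rep ∈ (Fin m → Dual L) ]
             (∀ i → ∃[ k ] rep k ≈ g i) × (∀ k k′ → rep k ≈ rep k′ → k ≡ k′)
    select zero    g = 0 , (λ ()) , (λ ()) , λ ()
    select (suc n) g with select n (g ∘ suc)
    ... | m , rep , covered , distinct with em {∃[ k ] rep k ≈ g zero}
    ... | yes old = m , rep , (λ { zero → old ; (suc i) → covered i }) , distinct
    ... | no new  = suc m , rep′ , covered′ , distinct′
      where
      rep′ : Fin (suc m) → Dual L
      rep′ zero    = g zero
      rep′ (suc k) = rep k
      covered′ : ∀ i → ∃[ k ] rep′ k ≈ g i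
      covered′ zero    = zero , ≈-refl {g zero}
      covered′ (suc i) = let k , eq = covered i in suc k , eq
      distinct′ : ∀ k k′ → rep′ k ≈ rep′ k′ → k ≡ k′
      distinct′ zero    zero     _  = refl
      distinct′ zero    (suc k′) eq = ⊥-elim (new (k′ , ≈-sym {g zero} {rep k′} eq))
      distinct′ (suc k) zero     eq = ⊥-elim (new (k , eq))
      distinct′ (suc k) (suc k′) eq = cong suc (distinct k k′ eq)

  0ᴰ : ∀ {L} → Dual L
  0ᴰ {L} = record { vec = 0ᵥ ; integral = λ l → 0ℤ , ℝForm.pairing-zeroˡ (gram L) (embed l) }

  module _ {L K : EvenLattice} where

    private
      module DL = Setoid (D L)
      module DK = Setoid (D K)
      module DLK = Setoid (D (L ⊕ K))

    dual₁-≈ : ∀ (η : Dual (L ⊕ K)) γ δ → η DLK.≈ γ ⊕ᴰ δ → dual₁ {L} {K} η DL.≈ γ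
    dual₁-≈ η γ δ (l , eq) = _ , trans (sym (take-++ (rank L) (vec γ) (vec δ))) (take-shift (rank L) _ (vec η) l eq)

    dual₂-≈ : ∀ (η : Dual (L ⊕ K)) γ δ → η DLK.≈ γ ⊕ᴰ δ → dual₂ {L} {K} η DK.≈ δ
    dual₂-≈ η γ δ (l , eq) = _ , trans (sym (drop-++ (rank L) (vec γ) (vec δ))) (drop-shift (rank L) _ (vec η) l eq)

    Enumeration-⊕⁻ : Enumeration (L ⊕ K) → Enumeration L × Enumeration K
    Enumeration-⊕⁻ E =
      enumerate (λ i → dual₁ {L} {K} (rep i))
        -- The class of γ is hit because (γ , 0) is a class of the direct sum.
        (λ γ → let i , eq = covers (γ ⊕ᴰ 0ᴰ {K}) in i , dual₁-≈ (rep i) γ (0ᴰ {K}) eq) ,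
      enumerate (λ i → dual₂ {L} {K} (rep i))
        (λ δ → let i , eq = covers (0ᴰ {L} ⊕ᴰ δ) in i , dual₂-≈ (rep i) (0ᴰ {L}) δ eq)
      where open Enumeration E

    Enumeration-⊕⁺ : Enumeration L → Enumeration K → Enumeration (L ⊕ K)
    Enumeration-⊕⁺ E E′ = record
      { order    = order E ℕ.* order E′
      ; rep      = rep-⊕ ∘ remQuot (order E′)
      ; covers   = covers-⊕
      ; distinct = distinct-⊕
      }
      where
      open Enumeration
      rep-⊕ : Fin (order E) × Fin (order E′) → Dual (L ⊕ K)
      rep-⊕ (i , j) = rep E i ⊕ᴰ rep E′ j

      covers-⊕ : ∀ η → ∃[ k ] rep-⊕ (remQuot (order E′) k) DLK.≈ η
      covers-⊕ η with covers E (dual₁ {L} {K} η) | covers E′ (dual₂ {L} {K} η)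
      ... | i , ri≈ | j , rj≈ = combine i j , subst (λ ij → rep-⊕ ij DLK.≈ η) (sym (FinP.remQuot-combine i j))
        (subst (Coset (L ⊕ K) (rep-⊕ (i , j))) (sym (split (rank L) (vec η))) (Coset-⊕⁺ {L} {K} (rep E i) (rep E′ j) ri≈ rj≈))

      distinct-⊕ : ∀ k k′ → rep-⊕ (remQuot (order E′) k) DLK.≈ rep-⊕ (remQuot (order E′) k′) → k ≡ k′
      distinct-⊕ k k′ eq with Coset-⊕⁻ {L} {K} (rep E (proj₁ (remQuot (order E′) k))) (rep E′ (proj₂ (remQuot {order E} (order E′) k))) eq
      ... | eq₁ , eq₂ = trans (sym (FinP.combine-remQuot {order E} (order E′) k)) (trans
        (cong₂ combine (distinct E _ _ eq₁) (distinct E′ _ _ eq₂)) (FinP.combine-remQuot {order E} (order E′) k′))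

    ∑D-⊕ : ∀ {f g h} → Invariant (L ⊕ K) f → Invariant L g → Invariant K h →
           (∀ γ δ → f (γ ⊕ᴰ δ) ≡ g γ *ᶜ h δ) → ∑D (L ⊕ K) f ≡ ∑D L g *ᶜ ∑D K h
    ∑D-⊕ {f} {g} {h} f-inv g-inv h-inv f≗gh = by-cases em em
      where
      open Enumeration
      by-cases : Dec (Enumeration L) → Dec (Enumeration K) → ∑D (L ⊕ K) f ≡ ∑D L g *ᶜ ∑D K h
      by-cases (yes E) (yes E′) = trans (∑D≡sumᴱ (Enumeration-⊕⁺ E E′) {f} f-inv) (trans
        (trans (sum-combine (order E) (order E′) _) (trans
          (sum-cong-≗ (λ i → trans
            (sum-cong-≗ (λ j → trans (cong (λ (k , l) → f (rep E k ⊕ᴰ rep E′ l)) (FinP.remQuot-combine i j)) (f≗gh (rep E i) (rep E′ j))))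
            (sym (*-distribˡ-sum (g (rep E i)) (h ∘ rep E′)))))
          (sum-*ʳ (g ∘ rep E) (sum (h ∘ rep E′)))))
        (sym (cong₂ _*ᶜ_ (∑D≡sumᴱ E {g} g-inv) (∑D≡sumᴱ E′ {h} h-inv))))
      -- Without an enumeration of a summand there is none of the direct sum either, so both sides
      -- take the default value `0ᶜ`.
      by-cases (no ¬E) _ = trans (∑D≡0 (λ E → ¬E (proj₁ (Enumeration-⊕⁻ E))))
        (sym (trans (cong (_*ᶜ ∑D K h) (∑D≡0 ¬E)) (ℂR.zeroˡ _)))
      by-cases (yes _) (no ¬E′) = trans (∑D≡0 (λ E → ¬E′ (proj₂ (Enumeration-⊕⁻ E))))
        (sym (trans (cong (∑D L g *ᶜ_) (∑D≡0 ¬E′)) (ℂR.zeroʳ _)))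

  -- Factorisation of the pairing with the theta function

  pairing-invariant : ∀ {L} (u : ℂ[D L ]) (v : ℂ[D L ⟨-1⟩ ]) → Invariant L (λ γ → coeff u γ *ᶜ coeff v (negateDual γ))
  -- `negateDual` keeps the vector, and congruence modulo L is the same relation for L(-1), so one
  -- proof serves both factors.
  pairing-invariant u v {γ} {δ} γ≈δ = cong₂ _*ᶜ_ (coeff-cong u {γ} {δ} γ≈δ) (coeff-cong v {negateDual γ} {negateDual δ} γ≈δ)

  Φ-⊕ : ∀ L K (v : Gr L) (w : Gr K) (F : ℍ → ℂ[D L ⟨-1⟩ ]) (H : ℍ → ℂ[D K ⟨-1⟩ ]) τ (ζ : L ⊗ℂ) (ξ : K ⊗ℂ) →
    Φ (L ⊕ K) (v ⊕ᴳ w) (λ τ′ → tensor L K (F τ′) (H τ′)) τ (ζ ++ ξ) ≡ Φ L v F τ ζ *ᶜ Φ K w H τ ξ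
  Φ-⊕ L K v w F H τ ζ ξ = ∑D-⊕ {L} {K}
    (λ {γ} {δ} → pairing-invariant (Θ (L ⊕ K) (v ⊕ᴳ w) τ (ζ ++ ξ)) (tensor L K (F τ) (H τ)) {γ} {δ})
    (λ {γ} {δ} → pairing-invariant (Θ L v τ ζ) (F τ) {γ} {δ}) (λ {γ} {δ} → pairing-invariant (Θ K w τ ξ) (H τ) {γ} {δ}) λ γ δ → trans
    (cong₂ _*ᶜ_ (Θ-⊕ L K v w τ ζ ξ γ δ) (cong₂ _*ᶜ_
      -- The component of γ ⊕ δ is a dual vector with its own integrality proof, and its vector
      -- equals that of γ only after cancelling `take` against `++`. Congruence with shift zero
      -- identifies the coefficients.
      (coeff-cong (F τ) {component₁ L K (negateDual {L ⊕ K} (γ ⊕ᴰ δ))} {negateDual γ}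
        (_ , trans (sym (take-++ (rank L) (vec γ) (vec δ))) (shift-0 _)))
      (coeff-cong (H τ) {component₂ L K (negateDual {L ⊕ K} (γ ⊕ᴰ δ))} {negateDual δ}
        (_ , trans (sym (drop-++ (rank L) (vec γ) (vec δ))) (shift-0 _)))))
    (interchange (coeff (Θ L v τ ζ) γ) _ _ _)
    where
    open ℂS
    interchange : ∀ a b c d → (a *ᶜ b) *ᶜ (c *ᶜ d) ≡ (a *ᶜ c) *ᶜ (b *ᶜ d)
    interchange = solve 4 (λ a b c d → (a :* b) :* (c :* d) := (a :* c) :* (b :* d)) refl

proposition3p5 : (em : ExcludedMiddle 0ℓ) (𝓡 : CompleteOrderedField) →
    let open Theory em 𝓡 in
    (L K : EvenLattice) (v : Gr L) (w : Gr K)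
    (Γ : FiniteIndexSubgroup) (k l κ μ : ½ℤ)
    (ρ*L : WeilRepresentation (L ⟨-1⟩)) (ρ*K : WeilRepresentation (K ⟨-1⟩))
    (F : ℍ → ℂ[D L ⟨-1⟩ ]) (H : ℍ → ℂ[D K ⟨-1⟩ ]) →
    IsModularForm Γ k l ρ*L F →
    IsModularForm Γ κ μ ρ*K H →
    (τ : ℍ) (ζ : L ⊗ℂ) (ξ : K ⊗ℂ) →
    Φ (L ⊕ K) (v ⊕ᴳ w) (λ τ′ → tensor L K (F τ′) (H τ′)) τ (ζ ++ ξ) ≡ Φ L v F τ ζ *ᶜ Φ K w H τ ξ
proposition3p5 em 𝓡 L K v w _ _ _ _ _ _ _ F H _ _ τ ζ ξ = Φ-⊕ em 𝓡 L K v w F H τ ζ ξ
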